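{- $\mathcal{B}_k$ is an empty set for any integer $k\geq 4$.
   Context: All groups are finite. For a group $G$ and a subset $S\subseteq G$ with $1_G\notin S=S^{ -1}$, $\mathrm{Cay}(G,S)$ is the undirected graph with vertex set $G$ in which $g,h$ are adjacent if and only if $hg^{ -1}\in S$. A graph $\Gamma$ is $2$-integral if $[\mathbb{SF}(\Gamma):\mathbb{Q}]=2$, where $\mathbb{SF}(\Gamma)$ is the smallest field extension of $\mathbb{Q}$ containing all eigenvalues of the adjacency matrix of $\Gamma$. For an integer $k\geq 2$, $\mathcal{B}_k$ is the set of all groups $G$ such that $\mathrm{Cay}(G,S)$ is $2$-integral whenever $S\subset G$ satisfies $1_G\notin S=S^{ -1}$ and $2\leq|S|\leq k$.
   Formalization: The groups of order 1 and 2 are excluded: they have no set S with 1 not in S = S⁻¹ and |S| ≥ 2, so they belong to every B_k vacuously; the result proved is that B_k contains no group of order at least 3 for any k ≥ 4. -}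

module Defs where

open import Algebra.Apartness.Bundles using (HeytingField)
open import Algebra.Bundles using (Group)
open import Algebra.Bundles.Raw using (RawRing)
import Algebra.Definitions.RawSemiring as RawSemiringDefs
open import Algebra.Morphism.Structures using (IsRingHomomorphism)
import Algebra.Properties.Group as GroupProperties
open import Data.Bool.Base using (if_then_else_)
open import Data.Fin.Base using (Fin; zero; suc; toℕ; punchIn)
open import Data.Fin.Properties using (_≟_)
open import Data.Fin.Subset using (Subset; _∈_; _∉_; ∣_∣)
open import Data.Fin.Subset.Properties using (_∈?_)
open import Data.List.Base using (List; []; _∷_; map)
open import Data.Nat.Base using (ℕ; zero; suc; _≤_)
open import Data.Product.Base using (Σ-syntax; ∃-syntax; _×_)
open import Data.Rational.Base using (ℚ; 0ℚ; +-*-rawRing)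
open import Function.Base using (_∘_)
open import Function.Bundles using (Inverse; Equivalence; _⇔_)
open import Level using (Level; 0ℓ) renaming (suc to lsuc; _⊔_ to _⊔ˡ_)
open import Relation.Binary.Core using (Rel)
open import Relation.Binary.Definitions using (Decidable; Irreflexive; Symmetric)
open import Relation.Binary.PropositionalEquality
  using (_≡_; subst) renaming (setoid to ≡-setoid; refl to ≡-refl)
open import Relation.Nullary.Decidable using (does)
open import Relation.Unary using (Pred)

private
  variable
    c ℓ : Level
    n : ℕ

record FiniteGroup (c ℓ : Level) : Set (lsuc (c ⊔ˡ ℓ)) where
  field
    group : Group c ℓ
    order : ℕ
    enum  : Inverse (Group.setoid group) (≡-setoid (Fin order))

  open Group group public

  index : Carrier → Fin order
  index = Inverse.to enum

  element : Fin order → Carrier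
  element = Inverse.from enum

record Graph (n : ℕ) : Set₁ where
  field
    Adj    : Rel (Fin n) 0ℓ
    adj?   : Decidable Adj
    symm   : Symmetric Adj
    irrefl : Irreflexive _≡_ Adj

-- A subset of G is given by the set of indices of its elements.
module _ (G : FiniteGroup c ℓ) where
  open FiniteGroup G

  IdentityFree : Subset order → Set
  IdentityFree S = index ε ∉ S

  InverseClosed : Subset order → Set c
  InverseClosed S = ∀ g → index g ∈ S ⇔ index (g ⁻¹) ∈ S

  Cay : (S : Subset order) → IdentityFree S → InverseClosed S → Graph order
  Cay S ε∉S S≡S⁻¹ = record
    { Adj    = λ i j → index (element j ∙ element i ⁻¹) ∈ S
    ; adj?   = λ i j → index (element j ∙ element i ⁻¹) ∈? S
    ; symm   = λ {i} {j} hg⁻¹∈S →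
        subst (_∈ S) (Inverse.to-cong enum (flip-quotient (element j) (element i)))
          (Equivalence.to (S≡S⁻¹ _) hg⁻¹∈S)
    ; irrefl = λ { {i} ≡-refl gg⁻¹∈S →
        ε∉S (subst (_∈ S) (Inverse.to-cong enum (inverseʳ (element i))) gg⁻¹∈S) }
    }
    where
    open GroupProperties group using (⁻¹-anti-homo-∙; ⁻¹-involutive)

    flip-quotient : ∀ h g → (h ∙ g ⁻¹) ⁻¹ ≈ g ∙ h ⁻¹
    flip-quotient h g = trans (⁻¹-anti-homo-∙ h (g ⁻¹)) (∙-congʳ (⁻¹-involutive g))

module Polynomials (R : RawRing c ℓ) where
  open RawRing R

  -- Coefficients are listed from degree 0 upwards; trailing zeros are allowed
  -- and do not matter for _≈ₚ_.
  Poly : Set c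
  Poly = List Carrier

  coeff : Poly → ℕ → Carrier
  coeff []      _       = 0#
  coeff (a ∷ p) zero    = a
  coeff (a ∷ p) (suc i) = coeff p i

  _≈ₚ_ : Rel Poly ℓ
  p ≈ₚ q = ∀ i → coeff p i ≈ coeff q i

  _+ₚ_ : Poly → Poly → Poly
  []      +ₚ q       = q
  (a ∷ p) +ₚ []      = a ∷ p
  (a ∷ p) +ₚ (b ∷ q) = (a + b) ∷ (p +ₚ q)

  _*ₚ_ : Poly → Poly → Poly
  []      *ₚ q = []
  (a ∷ p) *ₚ q = map (a *_) q +ₚ (0# ∷ (p *ₚ q))

  const : Carrier → Poly
  const a = a ∷ []

  X : Poly
  X = 0# ∷ 1# ∷ []

  polyRawRing : RawRing c ℓ
  polyRawRing = record
    { Carrier = Poly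
    ; _≈_     = _≈ₚ_
    ; _+_     = _+ₚ_
    ; _*_     = _*ₚ_
    ; -_      = map -_
    ; 0#      = []
    ; 1#      = const 1#
    }

module Matrices (R : RawRing c ℓ) where
  open RawRing R
  open RawSemiringDefs rawSemiring using (sum; _^_)

  Matrix : ℕ → Set c
  Matrix n = Fin n → Fin n → Carrier

  det : Matrix n → Carrier
  det {n = zero}  M = 1#
  det {n = suc n} M =
    sum λ j → ((- 1#) ^ toℕ j) * (M zero j * det λ i k → M (suc i) (punchIn j k))

  adjacencyMatrix : Graph n → Matrix n
  adjacencyMatrix Γ i j = if does (Graph.adj? Γ i j) then 1# else 0#

module _ (R : RawRing c ℓ) where
  open RawRing R using (-_)
  open Polynomials R
  open Matrices R using (Matrix)

  charpoly : Matrix n → Poly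
  charpoly M = Matrices.det polyRawRing λ i j →
    (if does (i ≟ j) then X else []) +ₚ const (- M i j)

record FieldExtensionOfℚ : Set₁ where
  field
    field′ : HeytingField 0ℓ 0ℓ 0ℓ

  open HeytingField field′ public

  rawRing : RawRing 0ℓ 0ℓ
  rawRing = record
    { _≈_ = _≈_ ; _+_ = _+_ ; _*_ = _*_ ; -_ = -_ ; 0# = 0# ; 1# = 1# }

  field
    ι      : ℚ → Carrier
    ι-homo : IsRingHomomorphism +-*-rawRing rawRing ι

module _ (K : FieldExtensionOfℚ) where
  open FieldExtensionOfℚ K
  open Polynomials rawRing
  open RawSemiringDefs (RawRing.rawSemiring rawRing) using (sum)
  open RawSemiringDefs (RawRing.rawSemiring polyRawRing) using (product)

  data GeneratedSubfield (r : Fin n → Carrier) : Pred Carrier 0ℓ where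
    generator : ∀ i → GeneratedSubfield r (r i)
    rational  : ∀ q → GeneratedSubfield r (ι q)
    resp      : ∀ {x y} → x ≈ y → GeneratedSubfield r x → GeneratedSubfield r y
    add       : ∀ {x y} → GeneratedSubfield r x → GeneratedSubfield r y →
                GeneratedSubfield r (x + y)
    neg       : ∀ {x} → GeneratedSubfield r x → GeneratedSubfield r (- x)
    mul       : ∀ {x y} → GeneratedSubfield r x → GeneratedSubfield r y →
                GeneratedSubfield r (x * y)
    inv       : ∀ {x y} → x * y ≈ 1# → GeneratedSubfield r x → GeneratedSubfield r y

  -- r lists the eigenvalues with multiplicity.
  AreEigenvalues : Graph n → (Fin n → Carrier) → Set
  AreEigenvalues Γ r =
    charpoly rawRing (Matrices.adjacencyMatrix rawRing Γ)
      ≈ₚ product λ i → X +ₚ const (- r i)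

  -- Minimality of SF(Γ) is expressed inside K: the eigenvalues generate K over ℚ.
  IsSF : Graph n → Set
  IsSF {n = n} Γ =
    ∃[ r ] (AreEigenvalues Γ r × (∀ x → GeneratedSubfield {n = n} r x))

  combination : (Fin n → ℚ) → (Fin n → Carrier) → Carrier
  combination a b = sum λ i → ι (a i) * b i

  record IsBasis (b : Fin n → Carrier) : Set where
    field
      spanning    : ∀ x → ∃[ a ] (x ≈ combination a b)
      independent : ∀ a → combination a b ≈ 0# → ∀ i → a i ≡ 0ℚ

  HasDegree : ℕ → Set
  HasDegree d = Σ[ b ∈ (Fin d → Carrier) ] IsBasis b

-- SF(Γ) is unique up to isomorphism over ℚ, so it is enough to exhibit one copy of it.
TwoIntegral : Graph n → Set₁
TwoIntegral Γ = Σ[ K ∈ FieldExtensionOfℚ ] (IsSF K Γ × HasDegree K 2)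

-- Groups of order at most 2 have no subset S as below, so they satisfy this vacuously.
𝓑 : ℕ → Pred (FiniteGroup c ℓ) (c ⊔ˡ lsuc 0ℓ)
𝓑 k G = ∀ (S : Subset (FiniteGroup.order G))
          (ε∉S : IdentityFree G S) (S≡S⁻¹ : InverseClosed G S) →
          2 ≤ ∣ S ∣ → ∣ S ∣ ≤ k → TwoIntegral (Cay G S ε∉S S≡S⁻¹)

-- A group G in 𝓑 k with k ≥ 4 and order ≥ 3 contains a subgroup H of order 3, 4 or 5, or an element g
-- of prime order p ≥ 7. In the first case S = H ∖ {1} gives a disjoint union of complete graphs, whose
-- eigenvalues are rational. In the second case take S = {g, g⁻¹}. An eigenvalue x = ζ + ζ⁻¹ outside ℚ
-- has a conjugate x′, and the p-periodic sequences xⱼ = ζʲ + ζ⁻ʲ and x′ⱼ have sum 0 over a period and are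
-- orthogonal, so νⱼ = (2 - xⱼ)(2 - x′ⱼ) has sum 4p. All νⱼ are integers, and those with p ∤ j are equal,
-- because 2 - x_{jk} is (2 - xⱼ) times the square of an algebraic integer for odd k. Hence
-- (p - 1) ν₁ = 4p, so p - 1 divides 4. As the aim is a contradiction, the argument may run under a
-- double negation, which replaces deciding equality in the splitting field.

module Submission where

-- `TwoIntegral` gives the eigenvalues only as roots of a characteristic polynomial over a field `K`
-- without decidable equality. So no spectrum is ever computed: an arbitrary root is taken,
-- elimination gives it an eigenvector, and its properties are read off from that vector. If all
-- roots are rational then `K`, which they generate, is ℚ, against degree 2. The root ζ need not lie
-- in `K`, so only the recurrence of the xⱼ is used. The conjugate of x does lie in `K`: it is t - x
-- when x² = t x - n. The νⱼ are integers because t and n are: their powers have bounded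
-- denominators. The νⱼ agree for the following reason. For odd k the norm gives ν_{jk} = νⱼ s² with
-- an integer s. If i j = ±1 modulo p, passing from 1 to j and on to i j gives ν₁ = ν₁ s² s′², and
-- ν₁ ≠ 0 forces s² = 1. The square removes the sign, and odd multipliers suffice because p is odd.
-- Order 5 has to be treated by a complete graph, since p - 1 = 4 does divide 4; its set S has 4
-- elements, which is where k ≥ 4 enters.

open import Defs
open import Algebra.Apartness.Bundles using (module HeytingCommutativeRing)
import Algebra.Apartness.Properties.HeytingCommutativeRing as HeytingProperties
open import Algebra.Bundles using (CommutativeRing; module CommutativeRing)
open import Algebra.Bundles.Raw using (module RawRing)
import Algebra.Definitions.RawSemiring as RawSemiringDefs
open import Algebra.Morphism.Structures using (module IsRingHomomorphism)
import Algebra.Properties.CommutativeSemigroup as CommutativeSemigroupProperties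
import Algebra.Properties.Group as GroupProperties
import Algebra.Properties.Monoid.Mult as Mult
import Algebra.Solver.Ring as RingSolver
open import Algebra.Solver.Ring.AlmostCommutativeRing
  using (fromCommutativeRing; _-Raw-AlmostCommutative⟶_)
open import Data.Bool.Base using (true; false; if_then_else_)
open import Data.Empty using (⊥-elim)
open import Data.Fin.Base as Fin using (Fin; zero; suc; toℕ; punchIn)
open import Data.Fin.Properties as Fin using (_≟_)
open import Data.Fin.Subset as Subset using (Subset; ∣_∣; ⁅_⁆; _∪_)
import Data.Fin.Subset.Properties as Subset
open import Data.Integer.Base as ℤ using (ℤ; +_; -[1+_])
import Data.Integer.Properties as ℤ
open import Data.Maybe.Base using (Maybe; just; nothing)
open import Data.Nat.Base as ℕ using (ℕ; zero; suc; _≤_; _<_; s≤s; z≤n)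
open import Data.Nat.Coprimality as Coprime using (Coprime)
open import Data.Nat.Divisibility as ℕ∣ using (_∣_; divides)
open import Data.Nat.DivMod as ℕ using (_/_; _%_)
open import Data.Nat.GCD using (module Bézout)
open import Data.Nat.Induction using (<-wellFounded)
open import Data.Nat.Primality as Prime using (Prime)
open import Data.Nat.Primality.Factorisation using (factorise)
import Data.Nat.Properties as ℕ
import Data.Nat.Solver as ℕ
open import Data.Product.Base using (∃-syntax; _×_; _,_; proj₁; proj₂)
open import Data.Rational.Base as ℚ using (ℚ; 0ℚ; 1ℚ; mkℚ)
open import Data.Rational.Literals using (fromℤ)
import Data.Rational.Properties as ℚ
open import Data.Rational.Unnormalised.Base using (*≡*)
import Data.Rational.Unnormalised.Properties as ℚᵘ
open import Data.Sum.Base using (_⊎_; inj₁; inj₂)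
open import Data.Vec.Functional as Vector using (Vector)
open import Function.Base using (_∘_; _$_)
open import Function.Bundles using (_⇔_; mk⇔; module Equivalence; module Inverse)
open import Induction.WellFounded using (Acc; acc)
open import Level using (Level; _⊔_; 0ℓ)
open import Relation.Binary.PropositionalEquality as ≡ using (_≡_; _≗_; _≢_)
open import Relation.Nullary.Decidable using (Dec; does; yes; no; ¬?; _⊎-dec_)
open import Relation.Nullary.Negation using (¬_)
open import Relation.Unary using (_∉_)

-- Determinants

module Determinant {c ℓ} (R : CommutativeRing c ℓ) where
  open CommutativeRing R hiding (zero)
  open Vector using (_∷_)
  open Matrices rawRing using (Matrix; det)
  open import Algebra.Definitions.RawSemiring (RawRing.rawSemiring rawRing) using (_^_)
  open import Algebra.Properties.Semiring.Sum semiring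
  open import Algebra.Properties.Ring ring using (-‿involutive; -1*x≈-x)
  open import Algebra.Properties.AbelianGroup +-abelianGroup using () renaming (inverseʳ-unique to neg-unique)
  open CommutativeSemigroupProperties *-commutativeSemigroup using () renaming (x∙yz≈y∙xz to x*yz≈y*xz; interchange to *-interchange)
  open CommutativeSemigroupProperties +-commutativeSemigroup using () renaming (interchange to +-interchange)
  open import Relation.Binary.Reasoning.Setoid setoid

  sgn : ∀ {n} → Fin n → Carrier
  sgn j = (- 1#) ^ toℕ j

  minor : ∀ {m n} → (Fin m → Fin (suc n) → Carrier) → Fin (suc n) → Fin m → Fin n → Carrier
  minor M j i k = M i (punchIn j k)

  sum-zero : ∀ {n} (f : Vector Carrier n) → (∀ i → f i ≈ 0#) → sum f ≈ 0#
  sum-zero {n} f f≈0 = trans (sum-cong-≋ f≈0) (sum-replicate-zero n)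

  x*yz≈0 : ∀ {x y z} → y ≈ 0# ⊎ z ≈ 0# → x * (y * z) ≈ 0#
  x*yz≈0 {x} {y} {z} y≈0⊎z≈0 = trans (*-congˡ (yz≈0 y≈0⊎z≈0)) (zeroʳ x)
    where
    yz≈0 : y ≈ 0# ⊎ z ≈ 0# → y * z ≈ 0#
    yz≈0 (inj₁ y≈0) = trans (*-congʳ y≈0) (zeroˡ z)
    yz≈0 (inj₂ z≈0) = trans (*-congˡ z≈0) (zeroʳ y)

  cofactor-term : ∀ {n} → Matrix (suc n) → Vector Carrier (suc n)
  cofactor-term M j = sgn j * (M zero j * det (minor (M ∘ suc) j))

  det-cong : ∀ {n} {M N : Matrix n} → (∀ i j → M i j ≈ N i j) → det M ≈ det N
  det-cong {zero}  M≈N = refl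
  det-cong {suc n} M≈N = sum-cong-≋ λ j → *-congˡ {sgn j} $
    *-cong (M≈N zero j) (det-cong λ i k → M≈N (suc i) (punchIn j k))

  det-zero-row : ∀ {n} {M : Matrix n} i → (∀ j → M i j ≈ 0#) → det M ≈ 0#
  det-zero-row {suc n} {M} zero Mᵢ≈0 = sum-zero (cofactor-term M) λ j →
    x*yz≈0 {sgn j} {z = det (minor (M ∘ suc) j)} (inj₁ (Mᵢ≈0 j))
  det-zero-row {suc n} {M} (suc i) Mᵢ≈0 = sum-zero (cofactor-term M) λ j →
    x*yz≈0 {sgn j} {M zero j}
      (inj₂ (det-zero-row {M = minor (M ∘ suc) j} i λ k → Mᵢ≈0 (punchIn j k)))

  det-zero-column : ∀ {n} {M : Matrix (suc n)} → (∀ i → M i zero ≈ 0#) → det M ≈ 0#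
  det-zero-column {n} {M} M₀≈0 = sum-zero (cofactor-term M) (term n M M₀≈0)
    where
    term : ∀ n (M : Matrix (suc n)) → (∀ i → M i zero ≈ 0#) → ∀ j → cofactor-term M j ≈ 0#
    term n M M₀≈0 zero = x*yz≈0 {1#} {z = det (minor (M ∘ suc) zero)} (inj₁ (M₀≈0 zero))
    term (suc n) M M₀≈0 (suc j) = x*yz≈0 {sgn (suc j)} {M zero (suc j)}
      (inj₂ (det-zero-column {M = minor (M ∘ suc) (suc j)} λ i → M₀≈0 (suc i)))

  -- `det` expands along row `zero`, so linearity is immediate there; other rows are brought to the
  -- top by `det-swap`.
  det-linear : ∀ {n} (a b : Vector Carrier (suc n)) c (M : Fin n → Vector Carrier (suc n)) →
               det ((λ j → a j + c * b j) ∷ M) ≈ det (a ∷ M) + c * det (b ∷ M)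
  det-linear {n} a b c M = begin
    sum (λ j → sgn j * ((a j + c * b j) * d j))            ≈⟨ sum-cong-≋ {suc n} distribute ⟩
    sum (λ j → sgn j * (a j * d j) + c * (sgn j * (b j * d j)))
      ≈⟨ ∑-distrib-+ {suc n} (cofactor-term (a ∷ M)) (λ j → c * cofactor-term (b ∷ M) j) ⟩
    det (a ∷ M) + sum (λ j → c * (sgn j * (b j * d j)))
      ≈⟨ +-congˡ (*-distribˡ-sum {suc n} c (cofactor-term (b ∷ M))) ⟨
    det (a ∷ M) + c * det (b ∷ M) ∎
    where
    d : Vector Carrier (suc n)
    d j = det (minor M j)
    distribute : ∀ j → sgn j * ((a j + c * b j) * d j) ≈ sgn j * (a j * d j) + c * (sgn j * (b j * d j))
    distribute j = begin
      sgn j * ((a j + c * b j) * d j)             ≈⟨ *-congˡ (distribʳ _ _ _) ⟩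
      sgn j * (a j * d j + c * b j * d j)         ≈⟨ distribˡ _ _ _ ⟩
      sgn j * (a j * d j) + sgn j * (c * b j * d j) ≈⟨ +-congˡ (*-congˡ (*-assoc _ _ _)) ⟩
      sgn j * (a j * d j) + sgn j * (c * (b j * d j)) ≈⟨ +-congˡ (x*yz≈y*xz _ _ _) ⟩
      sgn j * (a j * d j) + c * (sgn j * (b j * d j)) ∎

  private
    -- The summand of the expansion along two rows, with `Φ` the complementary minor as a function
    -- of the remaining columns. Leaving `Φ` arbitrary keeps the induction over the columns inside
    -- this family.
    double-term : ∀ {m} → Vector Carrier (suc (suc m)) → Vector Carrier (suc (suc m)) →
                  ((Fin m → Fin (suc (suc m))) → Carrier) →
                  Fin (suc (suc m)) → Fin (suc m) → Carrier
    double-term r s Φ j k = (sgn j * sgn k) * ((r j * s (punchIn j k)) * Φ (punchIn j ∘ punchIn k))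

    ∑∑ : ∀ {m n} → (Fin m → Fin n → Carrier) → Carrier
    ∑∑ f = sum λ j → sum (f j)

    -- (j , k) encodes the pair of distinct columns j and punchIn j k; the pairs containing 0 are split off.
    ∑∑-split : ∀ {m} (f : Fin (suc (suc m)) → Fin (suc m) → Carrier) →
      ∑∑ f ≈ sum (λ k → f zero k + f (suc k) zero) + ∑∑ (λ j k → f (suc j) (suc k))
    ∑∑-split {m} f = begin
      sum (f zero) + sum (λ j → f (suc j) zero + sum (λ k → f (suc j) (suc k)))
        ≈⟨ +-congˡ (∑-distrib-+ {suc m} (λ j → f (suc j) zero) (λ j → sum λ k → f (suc j) (suc k))) ⟩
      sum (f zero) + (sum (λ j → f (suc j) zero) + ∑∑ (λ j k → f (suc j) (suc k)))
        ≈⟨ +-assoc _ _ _ ⟨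
      (sum (f zero) + sum (λ j → f (suc j) zero)) + ∑∑ (λ j k → f (suc j) (suc k))
        ≈⟨ +-congʳ (∑-distrib-+ {suc m} (f zero) (λ j → f (suc j) zero)) ⟨
      sum (λ k → f zero k + f (suc k) zero) + ∑∑ (λ j k → f (suc j) (suc k)) ∎

    -- Deleting the same two columns in either order gives column maps that agree only pointwise.
    Extensional : ∀ {m n} → ((Fin m → Fin n) → Carrier) → Set ℓ
    Extensional Φ = ∀ {h h′} → h ≗ h′ → Φ h ≈ Φ h′

    a+b+c+d≈0 : ∀ {a b c d} → a + d ≈ 0# → b + c ≈ 0# → (a + b) + (c + d) ≈ 0#
    a+b+c+d≈0 {a} {b} {c} {d} a+d≈0 b+c≈0 = begin
      (a + b) + (c + d) ≈⟨ +-congˡ (+-comm c d) ⟩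
      (a + b) + (d + c) ≈⟨ +-interchange a b d c ⟩
      (a + d) + (b + c) ≈⟨ +-cong a+d≈0 b+c≈0 ⟩
      0# + 0#           ≈⟨ +-identityˡ 0# ⟩
      0# ∎

    first-pair : ∀ {m} (r s : Vector Carrier (suc (suc m))) {Φ} → Extensional Φ → ∀ k →
                 double-term {m} r s Φ zero k + double-term s r Φ (suc k) zero ≈ 0#
    first-pair r s {Φ} ext k = begin
      (1# * sgn k) * ((r zero * s (suc k)) * Φ h) + ((- 1# * sgn k) * 1#) * ((s (suc k) * r zero) * Φ h′)
        ≈⟨ +-cong (*-congʳ (*-identityˡ _)) (*-cong (trans (*-identityʳ _) (-1*x≈-x _)) (*-cong (*-comm _ _) (ext h′≗h))) ⟩
      sgn k * ((r zero * s (suc k)) * Φ h) + - sgn k * ((r zero * s (suc k)) * Φ h)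
        ≈⟨ distribʳ _ _ _ ⟨
      (sgn k + - sgn k) * ((r zero * s (suc k)) * Φ h)
        ≈⟨ *-congʳ (-‿inverseʳ _) ⟩
      0# * ((r zero * s (suc k)) * Φ h)
        ≈⟨ zeroˡ _ ⟩
      0# ∎
      where
      h h′ : _ → _
      h  = suc ∘ punchIn k
      h′ = punchIn (suc k) ∘ punchIn zero
      h′≗h : h′ ≗ h
      h′≗h l = ≡.refl

    -- Exchanging the two chosen columns keeps the complementary columns and flips the sign, so the
    -- terms cancel in pairs. `first-pair` cancels the pairs that contain column `zero`; in the rest
    -- this column always survives, and `Φ′` absorbs it.
    swap-sum : ∀ {m} (r s : Vector Carrier (suc (suc m))) {Φ} → Extensional Φ →
               ∑∑ (double-term {m} r s Φ) + ∑∑ (double-term s r Φ) ≈ 0#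
    swap-sum {m} r s {Φ} ext = begin
      ∑∑ t + ∑∑ t′                   ≈⟨ +-cong (∑∑-split t) (∑∑-split t′) ⟩
      (P + Q) + (P′ + Q′)            ≈⟨ +-interchange P Q P′ Q′ ⟩
      (P + P′) + (Q + Q′)            ≈⟨ +-cong P+P′≈0 (rest m r s ext) ⟩
      0# + 0#                        ≈⟨ +-identityˡ 0# ⟩
      0# ∎
      where
      t t′ : _ → _ → Carrier
      t  = double-term r s Φ
      t′ = double-term s r Φ
      p p′ : Vector Carrier (suc m)
      p k  = t zero k + t (suc k) zero
      p′ k = t′ zero k + t′ (suc k) zero
      P Q P′ Q′ : Carrier
      P  = sum p
      Q  = ∑∑ (λ j k → t (suc j) (suc k))
      P′ = sum p′
      Q′ = ∑∑ (λ j k → t′ (suc j) (suc k))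
      P+P′≈0 : P + P′ ≈ 0#
      P+P′≈0 = begin
        P + P′ ≈⟨ ∑-distrib-+ p p′ ⟨
        sum (λ k → p k + p′ k)
          ≈⟨ sum-zero {suc m} (λ k → p k + p′ k) (λ k → a+b+c+d≈0 (first-pair r s ext k)
               (trans (+-comm _ _) (first-pair s r ext k))) ⟩
        0# ∎
      rest : ∀ m (r s : Vector Carrier (suc (suc m))) {Φ} → Extensional Φ →
             ∑∑ (λ j k → double-term {m} r s Φ (suc j) (suc k)) +
             ∑∑ (λ j k → double-term {m} s r Φ (suc j) (suc k)) ≈ 0#
      rest zero r s ext = trans (+-cong (sum-zero {1} _ λ _ → refl) (sum-zero {1} _ λ _ → refl)) (+-identityˡ 0#)
      rest (suc m) r s {Φ} ext = begin
        _ ≈⟨ +-cong (sum-cong-≋ λ j → sum-cong-≋ λ k → shift r s j k) (sum-cong-≋ λ j → sum-cong-≋ λ k → shift s r j k) ⟩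
        ∑∑ (double-term (r ∘ suc) (s ∘ suc) Φ′) + ∑∑ (double-term (s ∘ suc) (r ∘ suc) Φ′)
          ≈⟨ swap-sum (r ∘ suc) (s ∘ suc) ext′ ⟩
        0# ∎
        where
        Φ′ : _ → Carrier
        Φ′ h = Φ (Fin.lift 1 h)
        ext′ : Extensional Φ′
        ext′ h≗h′ = ext λ { zero → ≡.refl ; (suc l) → ≡.cong suc (h≗h′ l) }
        shift : ∀ r s j k → double-term r s Φ (suc j) (suc k) ≈ double-term (r ∘ suc) (s ∘ suc) Φ′ j k
        shift r s j k = *-cong
          (begin
            (- 1# * sgn j) * (- 1# * sgn k) ≈⟨ *-interchange _ _ _ _ ⟩
            (- 1# * - 1#) * (sgn j * sgn k) ≈⟨ *-congʳ (trans (-1*x≈-x _) (-‿involutive 1#)) ⟩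
            1# * (sgn j * sgn k)            ≈⟨ *-identityˡ _ ⟩
            sgn j * sgn k ∎)
          (*-congˡ (ext λ { zero → ≡.refl ; (suc l) → ≡.refl }))

    det-expand₂ : ∀ {m} (r s : Vector Carrier (suc (suc m))) (M : Fin m → Vector Carrier (suc (suc m))) →
                  det (r ∷ s ∷ M) ≈ ∑∑ (double-term r s λ h → det λ i l → M i (h l))
    det-expand₂ {m} r s M = sum-cong-≋ λ j → begin
      sgn j * (r j * sum (λ k → sgn k * (s (punchIn j k) * d j k)))
        ≈⟨ *-assoc (sgn j) (r j) _ ⟨
      (sgn j * r j) * sum (λ k → sgn k * (s (punchIn j k) * d j k))
        ≈⟨ *-distribˡ-sum {suc m} (sgn j * r j) (λ k → sgn k * (s (punchIn j k) * d j k)) ⟩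
      sum (λ k → (sgn j * r j) * (sgn k * (s (punchIn j k) * d j k)))
        ≈⟨ sum-cong-≋ {suc m} (λ k → trans (*-interchange (sgn j) (r j) (sgn k) (s (punchIn j k) * d j k))
             (*-congˡ {sgn j * sgn k} (sym (*-assoc (r j) (s (punchIn j k)) (d j k))))) ⟩
      sum (λ k → (sgn j * sgn k) * ((r j * s (punchIn j k)) * d j k)) ∎
      where
      d : ∀ j k → Carrier
      d j k = det (minor (minor M j) k)

  det-swap : ∀ {m} (r s : Vector Carrier (suc (suc m))) (M : Fin m → Vector Carrier (suc (suc m))) →
             det (r ∷ s ∷ M) ≈ - det (s ∷ r ∷ M)
  det-swap {m} r s M = neg-unique _ _ (begin
    det (s ∷ r ∷ M) + det (r ∷ s ∷ M) ≈⟨ +-cong (det-expand₂ s r M) (det-expand₂ r s M) ⟩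
    _ ≈⟨ swap-sum s r (λ h≗h′ → det-cong λ i l → reflexive (≡.cong (M i) (h≗h′ l))) ⟩
    0# ∎)

  -- Antisymmetry det-swap gives only 2 det = 0 for a repeated row.
  module _ (2-cancel : ∀ {x} → x + x ≈ 0# → x ≈ 0#) where

    det-repeat : ∀ {m} (r : Vector Carrier (suc (suc m))) M → det (r ∷ r ∷ M) ≈ 0#
    det-repeat r M = 2-cancel (trans (+-congˡ (det-swap r r M)) (-‿inverseʳ _))

    -- After a swap the second row is on top, where linearity and `det-repeat` remove its multiple
    -- of `r`. The lower rows are handled by induction inside the minors, whose top row is again `r`
    -- with one column deleted.
    det-shear : ∀ {m} (r : Vector Carrier (suc m)) (c : Vector Carrier m) (M : Fin m → Vector Carrier (suc m)) →
                det (r ∷ λ i j → M i j + c i * r j) ≈ det (r ∷ M)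
    det-shear {zero}  r c M = det-cong {1} {r ∷ λ i j → M i j + c i * r j} {r ∷ M} λ { zero j → refl }
    det-shear {suc m} r c M = begin
      det (r ∷ N)                             ≈⟨ det-cong {M = r ∷ N} {r ∷ N zero ∷ N ∘ suc} (λ { zero _ → refl ; (suc zero) _ → refl ; (suc (suc i)) _ → refl }) ⟩
      det (r ∷ N zero ∷ N ∘ suc)              ≈⟨ det-swap r (N zero) (N ∘ suc) ⟩
      - det (N zero ∷ r ∷ N ∘ suc)            ≈⟨ -‿cong (det-linear (M zero) r (c zero) (r ∷ N ∘ suc)) ⟩
      - (det (M zero ∷ r ∷ N ∘ suc) + c zero * det (r ∷ r ∷ N ∘ suc))
        ≈⟨ -‿cong (+-congˡ (trans (*-congˡ (det-repeat r (N ∘ suc))) (zeroʳ _))) ⟩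
      - (det (M zero ∷ r ∷ N ∘ suc) + 0#)     ≈⟨ -‿cong (+-identityʳ _) ⟩
      - det (M zero ∷ r ∷ N ∘ suc)            ≈⟨ -‿cong (sum-cong-≋ λ j → *-congˡ {sgn j} (*-congˡ {M zero j} (minors j))) ⟩
      - det (M zero ∷ r ∷ M ∘ suc)            ≈⟨ det-swap r (M zero) (M ∘ suc) ⟨
      det (r ∷ M zero ∷ M ∘ suc)              ≈⟨ det-cong {M = r ∷ M} {r ∷ M zero ∷ M ∘ suc} (λ { zero _ → refl ; (suc zero) _ → refl ; (suc (suc i)) _ → refl }) ⟨
      det (r ∷ M) ∎
      where
      N : _ → _ → Carrier
      N i j = M i j + c i * r j
      minors : ∀ j → det (minor (r ∷ N ∘ suc) j) ≈ det (minor (r ∷ M ∘ suc) j)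
      minors j = begin
        det (minor (r ∷ N ∘ suc) j)
          ≈⟨ det-cong {M = minor (r ∷ N ∘ suc) j} {(r ∘ punchIn j) ∷ minor (N ∘ suc) j} (λ { zero _ → refl ; (suc i) _ → refl }) ⟩
        det ((r ∘ punchIn j) ∷ minor (N ∘ suc) j)
          ≈⟨ det-shear (r ∘ punchIn j) (c ∘ suc) (minor (M ∘ suc) j) ⟩
        det ((r ∘ punchIn j) ∷ minor (M ∘ suc) j)
          ≈⟨ det-cong {M = minor (r ∷ M ∘ suc) j} {(r ∘ punchIn j) ∷ minor (M ∘ suc) j} (λ { zero _ → refl ; (suc i) _ → refl }) ⟨
        det (minor (r ∷ M ∘ suc) j) ∎

-- Kernel vectors of singular matrices

record IsFieldOfCharacteristic≢2 {c ℓ} (R : CommutativeRing c ℓ) : Set (c ⊔ ℓ) where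
  open CommutativeRing R
  field
    1≉0          : ¬ (1# ≈ 0#)
    2-cancel     : ∀ {x} → x + x ≈ 0# → x ≈ 0#
    zero-or-unit : ∀ x → ¬ ¬ (x ≈ 0# ⊎ ∃[ y ] x * y ≈ 1#)

module Kernel {c ℓ} (R : CommutativeRing c ℓ) (isField : IsFieldOfCharacteristic≢2 R) where
  open CommutativeRing R hiding (zero)
  open IsFieldOfCharacteristic≢2 isField
  open Vector using (_∷_)
  open Matrices rawRing using (Matrix; det)
  open Determinant R
  open import Algebra.Properties.Semiring.Sum semiring
  open import Algebra.Properties.Ring ring using (-‿distribˡ-*; -‿distribʳ-*; -1*x≈-x)
  open import Relation.Binary.Reasoning.Setoid setoid

  infixl 7 _·_
  _·_ : ∀ {n} → Vector Carrier n → Vector Carrier n → Carrier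
  u · v = sum λ j → u j * v j

  ·-congˡ : ∀ {n} {u u′ : Vector Carrier n} v → (∀ j → u j ≈ u′ j) → u · v ≈ u′ · v
  ·-congˡ v u≈u′ = sum-cong-≋ λ j → *-congʳ {v j} (u≈u′ j)

  ·-linearˡ : ∀ {n} (u w : Vector Carrier n) a v → (λ j → u j + a * w j) · v ≈ u · v + a * (w · v)
  ·-linearˡ {n} u w a v = begin
    sum (λ j → (u j + a * w j) * v j)
      ≈⟨ sum-cong-≋ {n} (λ j → trans (distribʳ (v j) (u j) (a * w j)) (+-congˡ {u j * v j} (*-assoc a (w j) (v j)))) ⟩
    sum (λ j → u j * v j + a * (w j * v j)) ≈⟨ ∑-distrib-+ (λ j → u j * v j) (λ j → a * (w j * v j)) ⟩
    u · v + sum (λ j → a * (w j * v j))     ≈⟨ +-congˡ (*-distribˡ-sum a (λ j → w j * v j)) ⟨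
    u · v + a * (w · v) ∎

  Singular : ∀ {n} → Matrix n → Set (c ⊔ ℓ)
  Singular M = ∃[ v ] (∃[ i ] ¬ (v i ≈ 0#)) × (∀ i → M i · v ≈ 0#)

  private
    unit-zero-product : ∀ {x y z} → x * y ≈ 1# → x * z ≈ 0# → z ≈ 0#
    unit-zero-product {x} {y} {z} xy≈1 xz≈0 = begin
      z           ≈⟨ *-identityˡ z ⟨
      1# * z      ≈⟨ *-congʳ (trans (*-comm y x) xy≈1) ⟨
      (y * x) * z ≈⟨ *-assoc y x z ⟩
      y * (x * z) ≈⟨ *-congˡ xz≈0 ⟩
      y * 0#      ≈⟨ zeroʳ y ⟩
      0# ∎

    -- Clearing the first column below the unit pivot preserves the determinant and leaves a block
    -- `N` with det N = 0. A kernel vector `w` of `N` extends to one of `M`: the new first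
    -- coordinate is the solution of row `zero`, and the cleared rows then follow.
    pivot : ∀ {n} (M : Matrix (suc n)) {y} → M zero zero * y ≈ 1# → det M ≈ 0# →
            (∀ (N : Matrix n) → det N ≈ 0# → ¬ ¬ Singular N) → ¬ ¬ Singular M
    pivot {n} M {y} M₀₀y≈1 det≈0 ih ¬singular = ih N detN≈0 λ (w , (k , wₖ≉0) , Nw≈0) →
      ¬singular (extend w , (suc k , wₖ≉0) , λ
        { zero    → row-zero w
        ; (suc i) → row-suc w i (Nw≈0 i) })
      where
      a : Carrier
      a = M zero zero
      r : Vector Carrier n
      r k = M zero (suc k)
      c′ : Vector Carrier n
      c′ i = - (M (suc i) zero * y)
      cleared : Fin n → Vector Carrier (suc n)
      cleared i j = M (suc i) j + c′ i * M zero j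
      N : Matrix n
      N i k = cleared i (suc k)
      cleared-zero : ∀ i → cleared i zero ≈ 0#
      cleared-zero i = begin
        b + - (b * y) * a   ≈⟨ +-congˡ (-‿distribˡ-* (b * y) a) ⟨
        b + - (b * y * a)   ≈⟨ +-congˡ (-‿cong (trans (*-assoc b y a) (*-congˡ (trans (*-comm y a) M₀₀y≈1)))) ⟩
        b + - (b * 1#)      ≈⟨ +-congˡ (-‿cong (*-identityʳ b)) ⟩
        b + - b             ≈⟨ -‿inverseʳ b ⟩
        0# ∎
        where
        b : Carrier
        b = M (suc i) zero
      P : Matrix (suc n)
      P = M zero ∷ cleared
      detP≈0 : det P ≈ 0#
      detP≈0 = begin
        det P                  ≈⟨ det-shear 2-cancel (M zero) c′ (M ∘ suc) ⟩
        det (M zero ∷ M ∘ suc) ≈⟨ det-cong {M = M zero ∷ M ∘ suc} {M} (λ { zero _ → refl ; (suc i) _ → refl }) ⟩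
        det M                  ≈⟨ det≈0 ⟩
        0# ∎
      detN≈0 : det N ≈ 0#
      detN≈0 = unit-zero-product M₀₀y≈1 (begin
        a * det N                     ≈⟨ *-identityˡ _ ⟨
        1# * (a * det N)              ≈⟨ +-identityʳ _ ⟨
        1# * (a * det N) + 0#         ≈⟨ +-congˡ (sum-zero (cofactor-term P ∘ suc) (off-diagonal n M cleared cleared-zero)) ⟨
        det P                         ≈⟨ detP≈0 ⟩
        0# ∎)
        where
        off-diagonal : ∀ n (M : Matrix (suc n)) (C : Fin n → Vector Carrier (suc n)) → (∀ i → C i zero ≈ 0#) →
                       ∀ k → cofactor-term (M zero ∷ C) (suc k) ≈ 0#
        off-diagonal (suc n) M C C₀≈0 k = x*yz≈0 {sgn (suc k)} {M zero (suc k)}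
          (inj₂ (det-zero-column {M = minor C (suc k)} C₀≈0))
      extend : Vector Carrier n → Vector Carrier (suc n)
      extend w = (- (y * (r · w))) ∷ w
      row-zero : ∀ w → a * (- (y * (r · w))) + r · w ≈ 0#
      row-zero w = begin
        a * - (y * s) + s    ≈⟨ +-congʳ (-‿distribʳ-* a (y * s)) ⟨
        - (a * (y * s)) + s  ≈⟨ +-congʳ (-‿cong (trans (sym (*-assoc a y s)) (trans (*-congʳ M₀₀y≈1) (*-identityˡ s)))) ⟩
        - s + s              ≈⟨ -‿inverseˡ s ⟩
        0# ∎
        where
        s : Carrier
        s = r · w
      row-suc : ∀ w i → N i · w ≈ 0# → M (suc i) zero * (- (y * (r · w))) + (M (suc i) ∘ suc) · w ≈ 0#
      row-suc w i Nw≈0 = begin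
        b * - (y * s) + (M (suc i) ∘ suc) · w  ≈⟨ +-comm _ _ ⟩
        (M (suc i) ∘ suc) · w + b * - (y * s)  ≈⟨ +-congˡ (-‿distribʳ-* b (y * s)) ⟨
        (M (suc i) ∘ suc) · w + - (b * (y * s)) ≈⟨ +-congˡ (-‿cong (*-assoc b y s)) ⟨
        (M (suc i) ∘ suc) · w + - (b * y * s)  ≈⟨ +-congˡ (-‿distribˡ-* (b * y) s) ⟩
        (M (suc i) ∘ suc) · w + c′ i * s       ≈⟨ ·-linearˡ (M (suc i) ∘ suc) r (c′ i) w ⟨
        N i · w                                ≈⟨ Nw≈0 ⟩
        0# ∎
        where
        b s : Carrier
        b = M (suc i) zero
        s = r · w

    det-duplicate : ∀ {n} (r : Vector Carrier (suc n)) (M : Fin n → Vector Carrier (suc n)) i →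
                    (∀ j → r j ≈ M i j) → det (r ∷ M) ≈ 0#
    det-duplicate {n} r M i r≈Mᵢ = begin
      det (r ∷ M)                        ≈⟨ det-shear 2-cancel r δ M ⟨
      det (r ∷ λ k j → M k j + δ k * r j) ≈⟨ det-zero-row {M = r ∷ λ k j → M k j + δ k * r j} (suc i) vanish ⟩
      0# ∎
      where
      -- Subtracting `r` from its copy, and from no other row, produces a zero row.
      δ : Vector Carrier n
      δ k = if does (k ≟ i) then - 1# else 0#
      vanish : ∀ j → M i j + δ i * r j ≈ 0#
      vanish j with i ≟ i
      ... | no i≢i = ⊥-elim (i≢i ≡.refl)
      ... | yes _  = begin
        M i j + - 1# * r j ≈⟨ +-congˡ (-1*x≈-x (r j)) ⟩
        M i j + - r j      ≈⟨ +-congʳ (r≈Mᵢ j) ⟨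
        r j + - r j        ≈⟨ -‿inverseʳ (r j) ⟩
        0# ∎

    zeros-or-unit : ∀ {n} (f : Vector Carrier n) → ¬ ¬ ((∀ i → f i ≈ 0#) ⊎ ∃[ i ] ∃[ y ] f i * y ≈ 1#)
    zeros-or-unit {zero}  f k = k (inj₁ λ ())
    zeros-or-unit {suc n} f k = zero-or-unit (f zero) λ
      { (inj₂ unit) → k (inj₂ (zero , unit))
      ; (inj₁ f₀≈0) → zeros-or-unit (f ∘ suc) λ
        { (inj₂ (i , unit)) → k (inj₂ (suc i , unit))
        ; (inj₁ f≈0) → k (inj₁ λ { zero → f₀≈0 ; (suc i) → f≈0 i }) } }

  -- Gaussian elimination. The empty determinant is 1, hence nonzero. A unit in the corner is a
  -- pivot; a unit lower in the first column becomes one after its row is added to row `zero`, which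
  -- changes neither the determinant nor the kernel; if the first column vanishes, the first unit
  -- vector lies in the kernel.
  det≈0⇒singular : ∀ {n} (M : Matrix n) → det M ≈ 0# → ¬ ¬ Singular M
  det≈0⇒singular {zero}  M det≈0 _ = 1≉0 det≈0
  det≈0⇒singular {suc n} M det≈0 ¬singular = zero-or-unit (M zero zero) λ
    { (inj₂ (y , M₀₀y≈1)) → pivot M M₀₀y≈1 det≈0 det≈0⇒singular ¬singular
    ; (inj₁ M₀₀≈0) → zeros-or-unit (λ i → M (suc i) zero) λ
      { (inj₁ M₀≈0) → ¬singular (zero-column λ { zero → M₀₀≈0 ; (suc i) → M₀≈0 i })
      ; (inj₂ (i , y , unit)) →
          pivot (added i) (trans (*-congʳ (added-pivot i M₀₀≈0)) unit) (det-added i) det≈0⇒singular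
            λ (v , v≉0 , added·v≈0) → ¬singular (v , v≉0 , λ
              { zero    → row-zero i v (added·v≈0 (suc i)) (added·v≈0 zero)
              ; (suc k) → added·v≈0 (suc k) }) } }
    where
    e₀ : Vector Carrier (suc n)
    e₀ = 1# ∷ λ _ → 0#
    zero-column : (∀ i → M i zero ≈ 0#) → Singular M
    zero-column M₀≈0 = e₀ , (zero , 1≉0) , λ i →
      trans (+-cong (trans (*-identityʳ _) (M₀≈0 i)) (sum-zero (λ k → M i (suc k) * 0#) λ k → zeroʳ _)) (+-identityˡ 0#)
    added : Fin n → Matrix (suc n)
    added i = (λ j → M zero j + 1# * M (suc i) j) ∷ M ∘ suc
    added-pivot : ∀ i → M zero zero ≈ 0# → added i zero zero ≈ M (suc i) zero
    added-pivot i M₀₀≈0 = trans (+-cong M₀₀≈0 (*-identityˡ _)) (+-identityˡ _)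
    det-added : ∀ i → det (added i) ≈ 0#
    det-added i = begin
      det (added i) ≈⟨ det-linear (M zero) (M (suc i)) 1# (M ∘ suc) ⟩
      det (M zero ∷ M ∘ suc) + 1# * det (M (suc i) ∷ M ∘ suc)
        ≈⟨ +-cong (det-cong {M = M zero ∷ M ∘ suc} {M} (λ { zero _ → refl ; (suc i) _ → refl }))
                  (*-congˡ (det-duplicate (M (suc i)) (M ∘ suc) i λ _ → refl)) ⟩
      det M + 1# * 0# ≈⟨ +-cong det≈0 (zeroʳ 1#) ⟩
      0# + 0#         ≈⟨ +-identityˡ 0# ⟩
      0# ∎
    row-zero : ∀ i v → M (suc i) · v ≈ 0# → added i zero · v ≈ 0# → M zero · v ≈ 0#
    row-zero i v Mᵢv≈0 added≈0 = begin
      M zero · v                           ≈⟨ +-identityʳ _ ⟨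
      M zero · v + 0#                      ≈⟨ +-congˡ (trans (*-identityˡ _) Mᵢv≈0) ⟨
      M zero · v + 1# * (M (suc i) · v)    ≈⟨ ·-linearˡ (M zero) (M (suc i)) 1# v ⟨
      added i zero · v                     ≈⟨ added≈0 ⟩
      0# ∎

-- Evaluation of polynomials and of the characteristic polynomial

module Evaluation {c ℓ} (R : CommutativeRing c ℓ) (x : CommutativeRing.Carrier R) where
  open CommutativeRing R hiding (zero)
  open import Data.List.Base using ([]; _∷_; map)
  open Polynomials rawRing
  open import Algebra.Properties.Semiring.Sum semiring
  open import Algebra.Properties.Ring ring using (-0#≈0#; -‿+-comm; -‿distribʳ-*)
  open CommutativeSemigroupProperties *-commutativeSemigroup using () renaming (x∙yz≈y∙xz to x*yz≈y*xz)
  open CommutativeSemigroupProperties +-commutativeSemigroup using () renaming (interchange to +-interchange)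
  open import Algebra.Definitions.RawSemiring (RawRing.rawSemiring rawRing) using (_^_; product)
  module P = RawRing polyRawRing
  module PS = RawSemiringDefs P.rawSemiring
  open import Relation.Binary.Reasoning.Setoid setoid

  eval : Poly → Carrier
  eval []      = 0#
  eval (a ∷ p) = a + x * eval p

  eval-zero : ∀ p → (∀ i → coeff p i ≈ 0#) → eval p ≈ 0#
  eval-zero []      p≈0 = refl
  eval-zero (a ∷ p) p≈0 =
    trans (+-cong (p≈0 0) (trans (*-congˡ (eval-zero p (p≈0 ∘ suc))) (zeroʳ x))) (+-identityˡ 0#)

  eval-cong : ∀ p q → p ≈ₚ q → eval p ≈ eval q
  eval-cong []      q       p≈q = sym (eval-zero q (sym ∘ p≈q))
  eval-cong (a ∷ p) []      p≈q = eval-zero (a ∷ p) p≈q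
  eval-cong (a ∷ p) (b ∷ q) p≈q = +-cong (p≈q 0) (*-congˡ (eval-cong p q (p≈q ∘ suc)))

  eval-+ : ∀ p q → eval (p +ₚ q) ≈ eval p + eval q
  eval-+ []      q       = sym (+-identityˡ _)
  eval-+ (a ∷ p) []      = sym (+-identityʳ _)
  eval-+ (a ∷ p) (b ∷ q) = begin
    (a + b) + x * eval (p +ₚ q)            ≈⟨ +-congˡ (*-congˡ (eval-+ p q)) ⟩
    (a + b) + x * (eval p + eval q)        ≈⟨ +-congˡ (distribˡ x _ _) ⟩
    (a + b) + (x * eval p + x * eval q)    ≈⟨ +-interchange a b _ _ ⟩
    (a + x * eval p) + (b + x * eval q) ∎

  eval-scale : ∀ a q → eval (map (a *_) q) ≈ a * eval q
  eval-scale a []      = sym (zeroʳ a)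
  eval-scale a (b ∷ q) = begin
    a * b + x * eval (map (a *_) q) ≈⟨ +-congˡ (*-congˡ (eval-scale a q)) ⟩
    a * b + x * (a * eval q)        ≈⟨ +-congˡ (x*yz≈y*xz x a _) ⟩
    a * b + a * (x * eval q)        ≈⟨ distribˡ a b _ ⟨
    a * (b + x * eval q) ∎

  eval-* : ∀ p q → eval (p *ₚ q) ≈ eval p * eval q
  eval-* []      q = sym (zeroˡ _)
  eval-* (a ∷ p) q = begin
    eval (map (a *_) q +ₚ (0# ∷ (p *ₚ q)))        ≈⟨ eval-+ (map (a *_) q) _ ⟩
    eval (map (a *_) q) + (0# + x * eval (p *ₚ q)) ≈⟨ +-cong (eval-scale a q) (+-identityˡ _) ⟩
    a * eval q + x * eval (p *ₚ q)                ≈⟨ +-congˡ (*-congˡ (eval-* p q)) ⟩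
    a * eval q + x * (eval p * eval q)            ≈⟨ +-congˡ (*-assoc x _ _) ⟨
    a * eval q + x * eval p * eval q              ≈⟨ distribʳ _ a _ ⟨
    (a + x * eval p) * eval q ∎

  eval-const : ∀ a → eval (const a) ≈ a
  eval-const a = trans (+-congˡ (zeroʳ x)) (+-identityʳ a)

  eval-X : eval X ≈ x
  eval-X = trans (+-identityˡ _) (trans (*-congˡ (eval-const 1#)) (*-identityʳ x))

  eval-neg : ∀ p → eval (P.- p) ≈ - eval p
  eval-neg []      = sym -0#≈0#
  eval-neg (a ∷ p) = begin
    - a + x * eval (P.- p)  ≈⟨ +-congˡ (*-congˡ (eval-neg p)) ⟩
    - a + x * - eval p      ≈⟨ +-congˡ (-‿distribʳ-* x _) ⟨
    - a + - (x * eval p)    ≈⟨ -‿+-comm a _ ⟩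
    - (a + x * eval p) ∎

  eval-^ : ∀ p n → eval (p PS.^ n) ≈ eval p ^ n
  eval-^ p zero    = eval-const 1#
  eval-^ p (suc n) = trans (eval-* p (p PS.^ n)) (*-congˡ (eval-^ p n))

  eval-sum : ∀ {n} (f : Vector Poly n) → eval (PS.sum f) ≈ sum (eval ∘ f)
  eval-sum {zero}  f = refl
  eval-sum {suc n} f = trans (eval-+ (f zero) _) (+-congˡ (eval-sum (f ∘ suc)))

  eval-product-zero : ∀ {n} (f : Vector Poly n) i → eval (f i) ≈ 0# → eval (PS.product f) ≈ 0#
  eval-product-zero f zero    fᵢ≈0 = trans (eval-* (f zero) _) (trans (*-congʳ fᵢ≈0) (zeroˡ _))
  eval-product-zero f (suc i) fᵢ≈0 =
    trans (eval-* (f zero) _) (trans (*-congˡ (eval-product-zero (f ∘ suc) i fᵢ≈0)) (zeroʳ _))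

  open Matrices using (Matrix; det)

  eval-det : ∀ {n} (M : Matrix polyRawRing n) → eval (det polyRawRing M) ≈ det rawRing (λ i j → eval (M i j))
  eval-det {zero}  M = eval-const 1#
  eval-det {suc n} M = trans (eval-sum term) (sum-cong-≋ λ j →
    trans (eval-* (sgn j) (M zero j P.* d j)) (*-cong
      (trans (eval-^ (P.- P.1#) (toℕ j)) (^-cong (toℕ j) (trans (eval-neg P.1#) (-‿cong (eval-const 1#)))))
      (trans (eval-* (M zero j) (d j)) (*-congˡ {eval (M zero j)} (eval-det λ i k → M (suc i) (punchIn j k))))))
    where
    sgn d term : Vector Poly (suc n)
    sgn j = (P.- P.1#) PS.^ toℕ j
    d j = det polyRawRing λ i k → M (suc i) (punchIn j k)
    term j = sgn j P.* (M zero j P.* d j)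
    ^-cong : ∀ n {a b} → a ≈ b → a ^ n ≈ b ^ n
    ^-cong zero    a≈b = refl
    ^-cong (suc n) a≈b = *-cong a≈b (^-cong n a≈b)

  eval-charpoly : ∀ {n} (M : Matrix rawRing n) →
    eval (charpoly rawRing M) ≈ det rawRing (λ i j → (if does (i ≟ j) then x else 0#) + - M i j)
  eval-charpoly M = trans (eval-det entry) (Determinant.det-cong R λ i j →
    trans (eval-+ (if does (i ≟ j) then X else []) (const (- M i j))) (+-cong (diagonal i j) (eval-const (- M i j))))
    where
    entry : Matrix polyRawRing _
    entry i j = (if does (i ≟ j) then X else []) +ₚ const (- M i j)
    diagonal : ∀ i j → eval (if does (i ≟ j) then X else []) ≈ (if does (i ≟ j) then x else 0#)
    diagonal i j with i ≟ j
    ... | yes _ = eval-X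
    ... | no  _ = refl

-- Field extensions and eigenvectors

fromℤ-+ : ∀ a b → fromℤ (a ℤ.+ b) ≡ fromℤ a ℚ.+ fromℤ b
fromℤ-+ a b = ℚ.toℚᵘ-injective (ℚᵘ.≃-trans
  (*≡* (≡.cong (ℤ._* + 1) (≡.sym (≡.cong₂ ℤ._+_ (ℤ.*-identityʳ a) (ℤ.*-identityʳ b)))))
  (ℚᵘ.≃-sym (ℚ.toℚᵘ-homo-+ (fromℤ a) (fromℤ b))))

fromℤ-* : ∀ a b → fromℤ (a ℤ.* b) ≡ fromℤ a ℚ.* fromℤ b
fromℤ-* a b = ℚ.toℚᵘ-injective (ℚᵘ.≃-trans (*≡* ≡.refl) (ℚᵘ.≃-sym (ℚ.toℚᵘ-homo-* (fromℤ a) (fromℤ b))))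

fromℤ-neg : ∀ a → fromℤ (ℤ.- a) ≡ ℚ.- fromℤ a
fromℤ-neg (+ zero)  = ≡.refl
fromℤ-neg (+ suc n) = ≡.refl
fromℤ-neg -[1+ n ]  = ≡.refl

fromℤ-injective : ∀ {a b} → fromℤ a ≡ fromℤ b → a ≡ b
fromℤ-injective = ≡.cong ℚ.↥_

↧*≡↥ : ∀ q → fromℤ (ℚ.↧ q) ℚ.* q ≡ fromℤ (ℚ.↥ q)
↧*≡↥ q@record{} = ℚ.toℚᵘ-injective (ℚᵘ.≃-trans (ℚ.toℚᵘ-homo-* (fromℤ (ℚ.↧ q)) q)
  (*≡* (≡.trans (ℤ.*-identityʳ _) (≡.trans (ℤ.*-comm (ℚ.↧ q) (ℚ.↥ q)) (≡.cong (λ d → ℚ.↥ q ℤ.* d) (≡.sym (ℤ.*-identityˡ (ℚ.↧ q))))))))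

¬¬-em : ∀ {a} {A : Set a} → ¬ ¬ (A ⊎ ¬ A)
¬¬-em k = k (inj₂ (k ∘ inj₁))

¬¬-Fin : ∀ {n p} {P : Fin n → Set p} → (∀ i → ¬ ¬ P i) → ¬ ¬ (∀ i → P i)
¬¬-Fin {zero}  ¬¬P k = k λ ()
¬¬-Fin {suc n} ¬¬P k = ¬¬P zero λ p → ¬¬-Fin (¬¬P ∘ suc) λ ps → k λ { zero → p ; (suc i) → ps i }

module Extension (K : FieldExtensionOfℚ) where
  open FieldExtensionOfℚ K using (ι; ι-homo; rawRing; heytingCommutativeRing; tight; #⇒invertible)
  R : CommutativeRing 0ℓ 0ℓ
  R = HeytingCommutativeRing.commutativeRing heytingCommutativeRing
  open CommutativeRing R hiding (zero; rawRing)
  module ι = IsRingHomomorphism ι-homo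
  open import Relation.Binary.Reasoning.Setoid setoid

  ι-cong : ∀ {p q} → p ≡ q → ι p ≈ ι q
  ι-cong = ι.⟦⟧-cong

  int : ℤ → Carrier
  int a = ι (fromℤ a)

  int-0 : int (+ 0) ≈ 0#
  int-0 = ι.0#-homo

  int-1 : int (+ 1) ≈ 1#
  int-1 = ι.1#-homo

  int-+ : ∀ a b → int (a ℤ.+ b) ≈ int a + int b
  int-+ a b = trans (ι-cong (fromℤ-+ a b)) (ι.+-homo _ _)

  int-* : ∀ a b → int (a ℤ.* b) ≈ int a * int b
  int-* a b = trans (ι-cong (fromℤ-* a b)) (ι.*-homo _ _)

  int-neg : ∀ a → int (ℤ.- a) ≈ - int a
  int-neg a = trans (ι-cong (fromℤ-neg a)) (ι.-‿homo _)

  private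
    -- The literals 0 and 1 are read as 0# and 1#, so that the solver applies to goals mentioning them.
    coefficient : ℤ → Carrier
    coefficient (+ 0) = 0#
    coefficient (+ 1) = 1#
    coefficient a     = int a

    coefficient≈int : ∀ a → coefficient a ≈ int a
    coefficient≈int (+ 0)           = sym ι.0#-homo
    coefficient≈int (+ 1)           = sym ι.1#-homo
    coefficient≈int (+ suc (suc _)) = refl
    coefficient≈int -[1+ _ ]        = refl

    _coefficient≟_ : ∀ a b → Maybe (coefficient a ≈ coefficient b)
    a coefficient≟ b with a ℤ.≟ b
    ... | yes ≡.refl = just refl
    ... | no  _      = nothing

    morphism : ℤ.+-*-rawRing -Raw-AlmostCommutative⟶ fromCommutativeRing R
    morphism = record
      { ⟦_⟧    = coefficient
      ; +-homo = λ a b → trans (coefficient≈int (a ℤ.+ b)) (trans (int-+ a b) (sym (+-cong (coefficient≈int a) (coefficient≈int b))))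
      ; *-homo = λ a b → trans (coefficient≈int (a ℤ.* b)) (trans (int-* a b) (sym (*-cong (coefficient≈int a) (coefficient≈int b))))
      ; -‿homo = λ a → trans (coefficient≈int (ℤ.- a)) (trans (int-neg a) (sym (-‿cong (coefficient≈int a))))
      ; 0-homo = refl
      ; 1-homo = refl
      }

  module Solver = RingSolver ℤ.+-*-rawRing (fromCommutativeRing R) morphism _coefficient≟_
  open Solver using (solve; _:+_; _:*_; _:-_; :-_; _:=_; con)

  1≉0 : ¬ (1# ≈ 0#)
  1≉0 1≈0 = proj₂ (tight 1# 0#) 1≈0 (HeytingProperties.1#0 heytingCommutativeRing)

  -- Excluded middle is applied to apartness from 0: an apart element is invertible, and a non-apart
  -- one equals 0 by tightness.
  zero-or-unit : ∀ x → ¬ ¬ (x ≈ 0# ⊎ ∃[ y ] x * y ≈ 1#)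
  zero-or-unit x k = ¬¬-em λ
    { (inj₁ x#0) → let (y , _ , xy≈1) = #⇒invertible x#0 in
        k (inj₂ (y , trans (*-congʳ (sym (HeytingProperties.x-0≈x heytingCommutativeRing x))) xy≈1))
    ; (inj₂ ¬x#0) → k (inj₁ (proj₁ (tight x 0#) ¬x#0)) }

  unit-cancel : ∀ {x y z} → x * y ≈ 1# → x * z ≈ 0# → z ≈ 0#
  unit-cancel {x} {y} {z} xy≈1 xz≈0 = begin
    z           ≈⟨ solve 1 (λ z → z := con (+ 1) :* z) refl z ⟩
    1# * z      ≈⟨ *-congʳ xy≈1 ⟨
    (x * y) * z ≈⟨ solve 3 (λ x y z → x :* y :* z := y :* (x :* z)) refl x y z ⟩
    y * (x * z) ≈⟨ *-congˡ xz≈0 ⟩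
    y * 0#      ≈⟨ zeroʳ y ⟩
    0# ∎

  domain : ∀ {x y} → x * y ≈ 0# → ¬ (x ≈ 0#) → ¬ ¬ (y ≈ 0#)
  domain xy≈0 x≉0 k = zero-or-unit _ λ
    { (inj₁ x≈0) → x≉0 x≈0 ; (inj₂ (_ , unit)) → k (unit-cancel unit xy≈0) }

  ι-unit : ∀ {q} → q ≢ 0ℚ → ∃[ q⁻¹ ] ι q * ι q⁻¹ ≈ 1#
  ι-unit {q} q≢0 = q⁻¹ , trans (sym (ι.*-homo q q⁻¹)) (trans (ι-cong (ℚ.*-inverseʳ q)) ι.1#-homo)
    where
    instance _ = ℚ.≢-nonZero q≢0
    q⁻¹ : ℚ
    q⁻¹ = ℚ.1/ q

  ι≈0 : ∀ {q} → ι q ≈ 0# → q ≡ 0ℚ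
  ι≈0 {q} ιq≈0 with q ℚ.≟ 0ℚ
  ... | yes q≡0 = q≡0
  ... | no  q≢0 = let (_ , unit) = ι-unit q≢0 in
    ⊥-elim (1≉0 (trans (sym unit) (trans (*-congʳ ιq≈0) (zeroˡ _))))

  int-injective : ∀ {a b} → int a ≈ int b → a ≡ b
  int-injective {a} {b} a≈b = ℤ.i-j≡0⇒i≡j a b (fromℤ-injective (ι≈0 (begin
    int (a ℤ.- b)      ≈⟨ int-+ a (ℤ.- b) ⟩
    int a + int (ℤ.- b) ≈⟨ +-cong a≈b (int-neg b) ⟩
    int b + - int b    ≈⟨ -‿inverseʳ (int b) ⟩
    0# ∎)))

  2-cancel : ∀ {x} → x + x ≈ 0# → x ≈ 0#
  2-cancel {x} x+x≈0 = unit-cancel (proj₂ (ι-unit {fromℤ (+ 2)} λ ())) (begin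
    int (+ 2) * x ≈⟨ solve 1 (λ x → con (+ 2) :* x := x :+ x) refl x ⟩
    x + x         ≈⟨ x+x≈0 ⟩
    0# ∎)

  x≈y⇐x-y≈0 : ∀ {x y} → x - y ≈ 0# → x ≈ y
  x≈y⇐x-y≈0 {x} {y} x-y≈0 = begin
    x           ≈⟨ solve 2 (λ x y → x := (x :- y) :+ y) refl x y ⟩
    (x - y) + y ≈⟨ +-congʳ x-y≈0 ⟩
    0# + y      ≈⟨ +-identityˡ y ⟩
    y ∎

  IsRational : Carrier → Set
  IsRational x = ∃[ q ] x ≈ ι q

  rational-resp : ∀ {x y} → x ≈ y → IsRational x → IsRational y
  rational-resp x≈y (q , x≈q) = q , trans (sym x≈y) x≈q

  rational-+ : ∀ {x y} → IsRational x → IsRational y → IsRational (x + y)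
  rational-+ (p , x≈p) (q , y≈q) = p ℚ.+ q , trans (+-cong x≈p y≈q) (sym (ι.+-homo p q))

  rational-* : ∀ {x y} → IsRational x → IsRational y → IsRational (x * y)
  rational-* (p , x≈p) (q , y≈q) = p ℚ.* q , trans (*-cong x≈p y≈q) (sym (ι.*-homo p q))

  rational-neg : ∀ {x} → IsRational x → IsRational (- x)
  rational-neg (p , x≈p) = ℚ.- p , trans (-‿cong x≈p) (sym (ι.-‿homo p))

  rational-inverse : ∀ {x y} → x * y ≈ 1# → IsRational x → IsRational y
  rational-inverse {x} {y} xy≈1 (q , x≈q) = let (q⁻¹ , unit) = ι-unit q≢0 in q⁻¹ , (begin
    y                 ≈⟨ *-identityˡ y ⟨
    1# * y            ≈⟨ *-congʳ unit ⟨
    (ι q * ι q⁻¹) * y ≈⟨ solve 3 (λ q r y → q :* r :* y := r :* (q :* y)) refl (ι q) (ι q⁻¹) y ⟩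
    ι q⁻¹ * (ι q * y) ≈⟨ *-congˡ (trans (*-congʳ (sym x≈q)) xy≈1) ⟩
    ι q⁻¹ * 1#        ≈⟨ *-identityʳ _ ⟩
    ι q⁻¹ ∎)
    where
    q≢0 : q ≢ 0ℚ
    q≢0 ≡.refl = 1≉0 (trans (sym xy≈1) (trans (*-congʳ (trans x≈q ι.0#-homo)) (zeroˡ y)))

  rational-quotient : ∀ {x y} q → q ≢ 0ℚ → ι q * x ≈ y → IsRational y → IsRational x
  rational-quotient {x} {y} q q≢0 qx≈y y-rational = let (q⁻¹ , unit) = ι-unit q≢0 in
    rational-resp (begin
      ι q⁻¹ * y         ≈⟨ *-congˡ qx≈y ⟨
      ι q⁻¹ * (ι q * x) ≈⟨ solve 3 (λ q r x → r :* (q :* x) := q :* r :* x) refl (ι q) (ι q⁻¹) x ⟩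
      ι q * ι q⁻¹ * x   ≈⟨ *-congʳ unit ⟩
      1# * x            ≈⟨ *-identityˡ x ⟩
      x ∎) (rational-* (q⁻¹ , refl) y-rational)

  generated-rational : ∀ {n} {r : Fin n → Carrier} → (∀ i → IsRational (r i)) →
                       ∀ {x} → GeneratedSubfield K r x → IsRational x
  generated-rational r-rational = go
    where
    go : ∀ {x} → GeneratedSubfield K _ x → IsRational x
    go (generator i)  = r-rational i
    go (rational q)   = q , refl
    go (resp x≈y x)   = rational-resp x≈y (go x)
    go (add x y)      = rational-+ (go x) (go y)
    go (neg x)        = rational-neg (go x)
    go (mul x y)      = rational-* (go x) (go y)
    go (inv xy≈1 x)   = rational-inverse xy≈1 (go x)

  module Quadratic (degree : HasDegree K 2) where
    b₀ b₁ : Carrier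
    b₀ = proj₁ degree zero
    b₁ = proj₁ degree (suc zero)
    open IsBasis (proj₂ degree)

    Coordinates : Carrier → ℚ → ℚ → Set
    Coordinates x p q = x ≈ ι p * b₀ + ι q * b₁

    coordinates : ∀ x → ∃[ p ] ∃[ q ] Coordinates x p q
    coordinates x = let (a , x≈) = spanning x in a zero , a (suc zero) , trans x≈ (+-congˡ (+-identityʳ _))

    coordinates-zero : ∀ {p q} → Coordinates 0# p q → p ≡ 0ℚ × q ≡ 0ℚ
    coordinates-zero {p} {q} 0≈ = a≡0 zero , a≡0 (suc zero)
      where
      open Vector using (_∷_; [])
      a≡0 : ∀ i → (p ∷ q ∷ []) i ≡ 0ℚ
      a≡0 = independent (p ∷ q ∷ []) (trans (+-congˡ (+-identityʳ _)) (sym 0≈))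

    -- Rational basis elements p and q satisfy q b₀ - p b₁ = 0, so independence gives p = 0; then b₀
    -- = 0, which contradicts independence once more.
    ¬all-rational : ¬ (∀ x → IsRational x)
    ¬all-rational all with all b₀ | all b₁
    ... | (p , b₀≈p) | (q , b₁≈q) = 1≉0 (begin
      1#     ≈⟨ ι.1#-homo ⟨
      ι 1ℚ   ≈⟨ ι-cong (proj₁ (coordinates-zero {1ℚ} {0ℚ} (sym (begin
                  ι 1ℚ * b₀ + ι 0ℚ * b₁ ≈⟨ +-cong (*-congˡ (trans b₀≈p (trans (ι-cong p≡0) ι.0#-homo))) (*-congʳ ι.0#-homo) ⟩
                  ι 1ℚ * 0# + 0# * b₁   ≈⟨ +-cong (zeroʳ _) (zeroˡ _) ⟩
                  0# + 0#               ≈⟨ +-identityʳ 0# ⟩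
                  0# ∎)))) ⟩
      ι 0ℚ   ≈⟨ ι.0#-homo ⟩
      0# ∎)
      where
      p≡0 : p ≡ 0ℚ
      p≡0 = ℚ.neg-injective (proj₂ (coordinates-zero {q} {ℚ.- p} (sym (begin
        ι q * b₀ + ι (ℚ.- p) * b₁ ≈⟨ +-cong (*-congˡ b₀≈p) (*-cong (ι.-‿homo p) b₁≈q) ⟩
        ι q * ι p + - ι p * ι q   ≈⟨ solve 2 (λ p q → q :* p :+ (:- p) :* q := con (+ 0)) refl (ι p) (ι q) ⟩
        0# ∎))))

    -- Cramer's rule for the coordinates of 1, x and x².
    quadratic-equation : ∀ {x} → ¬ IsRational x → ∃[ t ] ∃[ n ] x * x ≈ ι t * x - ι n
    quadratic-equation {x} irrational
      with coordinates 1# | coordinates x | coordinates (x * x)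
    ... | (e₀ , e₁ , 1≈) | (x₀ , x₁ , x≈) | (s₀ , s₁ , xx≈) = D⁻¹ ℚ.* T , D⁻¹ ℚ.* N , (begin
      x * x                                     ≈⟨ *-identityˡ _ ⟨
      1# * (x * x)                              ≈⟨ *-congʳ D-unit ⟨
      (ι D * ι D⁻¹) * (x * x)                   ≈⟨ solve 3 (λ d r s → d :* r :* s := r :* (d :* s)) refl (ι D) (ι D⁻¹) (x * x) ⟩
      ι D⁻¹ * (ι D * (x * x))                   ≈⟨ *-congˡ cramer ⟩
      ι D⁻¹ * (ι T * x - ι N)                   ≈⟨ solve 4 (λ r t x n → r :* (t :* x :- n) := r :* t :* x :- r :* n) refl (ι D⁻¹) (ι T) x (ι N) ⟩
      ι D⁻¹ * ι T * x - ι D⁻¹ * ι N             ≈⟨ +-cong (*-congʳ (ι.*-homo D⁻¹ T)) (-‿cong (ι.*-homo D⁻¹ N)) ⟨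
      ι (D⁻¹ ℚ.* T) * x - ι (D⁻¹ ℚ.* N) ∎)
      where
      infixl 7 _∧_
      _∧_ : ℚ × ℚ → ℚ × ℚ → ℚ
      (a , b) ∧ (c , d) = a ℚ.* d ℚ.- b ℚ.* c
      ι-∧ : ∀ a b c d → ι ((a , b) ∧ (c , d)) ≈ ι a * ι d - ι b * ι c
      ι-∧ a b c d = trans (ι.+-homo _ _) (+-cong (ι.*-homo a d) (trans (ι.-‿homo _) (-‿cong (ι.*-homo b c))))
      D T N : ℚ
      D = (e₀ , e₁) ∧ (x₀ , x₁)
      T = (e₀ , e₁) ∧ (s₀ , s₁)
      N = (x₀ , x₁) ∧ (s₀ , s₁)
      coefficients : Carrier → Carrier → Carrier → Carrier
      coefficients d t n = d * (ι s₀ * b₀ + ι s₁ * b₁) - (t * (ι x₀ * b₀ + ι x₁ * b₁) - n * (ι e₀ * b₀ + ι e₁ * b₁))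
      cramer : ι D * (x * x) ≈ ι T * x - ι N
      cramer = x≈y⇐x-y≈0 (begin
        ι D * (x * x) - (ι T * x - ι N)
          ≈⟨ +-cong (*-congˡ xx≈) (-‿cong (+-cong (*-congˡ x≈) (-‿cong (trans (sym (*-identityʳ _)) (*-congˡ 1≈))))) ⟩
        coefficients (ι D) (ι T) (ι N)
          ≈⟨ +-cong (*-congʳ (ι-∧ e₀ e₁ x₀ x₁)) (-‿cong (+-cong (*-congʳ (ι-∧ e₀ e₁ s₀ s₁)) (-‿cong (*-congʳ (ι-∧ x₀ x₁ s₀ s₁))))) ⟩
        coefficients (ι e₀ * ι x₁ - ι e₁ * ι x₀) (ι e₀ * ι s₁ - ι e₁ * ι s₀) (ι x₀ * ι s₁ - ι x₁ * ι s₀)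
          ≈⟨ solve 8 (λ e₀ e₁ x₀ x₁ s₀ s₁ b₀ b₁ →
               (e₀ :* x₁ :- e₁ :* x₀) :* (s₀ :* b₀ :+ s₁ :* b₁) :-
               ((e₀ :* s₁ :- e₁ :* s₀) :* (x₀ :* b₀ :+ x₁ :* b₁) :-
                (x₀ :* s₁ :- x₁ :* s₀) :* (e₀ :* b₀ :+ e₁ :* b₁)) := con (+ 0))
               refl (ι e₀) (ι e₁) (ι x₀) (ι x₁) (ι s₀) (ι s₁) b₀ b₁ ⟩
        0# ∎)
      D≡0-rational : D ≡ 0ℚ → ∀ q r → q ≢ 0ℚ →
        ι q * (ι x₀ * b₀ + ι x₁ * b₁) - ι r * (ι e₀ * b₀ + ι e₁ * b₁) ≈ 0# → IsRational x
      D≡0-rational D≡0 q r q≢0 eq = rational-quotient q q≢0 (begin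
        ι q * x                             ≈⟨ *-congˡ x≈ ⟩
        ι q * (ι x₀ * b₀ + ι x₁ * b₁)       ≈⟨ x≈y⇐x-y≈0 eq ⟩
        ι r * (ι e₀ * b₀ + ι e₁ * b₁)       ≈⟨ *-congˡ 1≈ ⟨
        ι r * 1#                            ≈⟨ *-identityʳ _ ⟩
        ι r ∎) (r , refl)
      -- `D` is the determinant of the coordinates of 1 and x. If it vanishes, a nonzero coordinate
      -- e₀ or e₁ of 1 gives x = x₀ / e₀ or x = x₁ / e₁, a rational number.
      D≢0 : D ≢ 0ℚ
      D≢0 D≡0 with e₀ ℚ.≟ 0ℚ | e₁ ℚ.≟ 0ℚ
      ... | no e₀≢0 | _ = irrational (D≡0-rational D≡0 e₀ x₀ e₀≢0 (begin
        _ ≈⟨ solve 6 (λ e₀ e₁ x₀ x₁ b₀ b₁ → e₀ :* (x₀ :* b₀ :+ x₁ :* b₁) :- x₀ :* (e₀ :* b₀ :+ e₁ :* b₁) :=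
               (e₀ :* x₁ :- e₁ :* x₀) :* b₁) refl (ι e₀) (ι e₁) (ι x₀) (ι x₁) b₀ b₁ ⟩
        (ι e₀ * ι x₁ - ι e₁ * ι x₀) * b₁ ≈⟨ *-congʳ (trans (sym (ι-∧ e₀ e₁ x₀ x₁)) (trans (ι-cong D≡0) ι.0#-homo)) ⟩
        0# * b₁ ≈⟨ zeroˡ b₁ ⟩
        0# ∎))
      ... | yes _ | no e₁≢0 = irrational (D≡0-rational D≡0 e₁ x₁ e₁≢0 (begin
        _ ≈⟨ solve 6 (λ e₀ e₁ x₀ x₁ b₀ b₁ → e₁ :* (x₀ :* b₀ :+ x₁ :* b₁) :- x₁ :* (e₀ :* b₀ :+ e₁ :* b₁) :=
               (e₀ :* x₁ :- e₁ :* x₀) :* (:- b₀)) refl (ι e₀) (ι e₁) (ι x₀) (ι x₁) b₀ b₁ ⟩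
        (ι e₀ * ι x₁ - ι e₁ * ι x₀) * (- b₀) ≈⟨ *-congʳ (trans (sym (ι-∧ e₀ e₁ x₀ x₁)) (trans (ι-cong D≡0) ι.0#-homo)) ⟩
        0# * - b₀ ≈⟨ zeroˡ _ ⟩
        0# ∎))
      ... | yes e₀≡0 | yes e₁≡0 = 1≉0 (begin
        1# ≈⟨ 1≈ ⟩
        ι e₀ * b₀ + ι e₁ * b₁ ≈⟨ +-cong (*-congʳ (trans (ι-cong e₀≡0) ι.0#-homo)) (*-congʳ (trans (ι-cong e₁≡0) ι.0#-homo)) ⟩
        0# * b₀ + 0# * b₁     ≈⟨ +-cong (zeroˡ b₀) (zeroˡ b₁) ⟩
        0# + 0#               ≈⟨ +-identityˡ 0# ⟩
        0# ∎)
      D⁻¹ : ℚ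
      D⁻¹ = proj₁ (ι-unit D≢0)
      D-unit : ι D * ι D⁻¹ ≈ 1#
      D-unit = proj₂ (ι-unit D≢0)

  open import Algebra.Properties.Semiring.Sum semiring using (sum; sum-cong-≋; ∑-distrib-+; *-distribˡ-sum)

  adjacency : ∀ {n} → Graph n → Fin n → Fin n → Carrier
  adjacency = Matrices.adjacencyMatrix rawRing

  sum-δ : ∀ {n} i (f : Vector Carrier n) → sum (λ j → (if does (i ≟ j) then f i else 0#)) ≈ f i
  sum-δ {suc n} zero f = trans (+-congˡ (Determinant.sum-zero R {n} (λ _ → 0#) λ _ → refl)) (+-identityʳ _)
  sum-δ (suc i) f = trans (+-identityˡ _) (sum-δ i (f ∘ suc))

  record IsEigenvector {n} (Γ : Graph n) (x : Carrier) (v : Vector Carrier n) : Set where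
    field
      index     : Fin n
      nonzero   : ¬ (v index ≈ 0#)
      eigen     : ∀ i → x * v i ≈ sum λ j → adjacency Γ i j * v j

  isField : IsFieldOfCharacteristic≢2 R
  isField = record { 1≉0 = 1≉0 ; 2-cancel = 2-cancel ; zero-or-unit = zero-or-unit }

  -- The factor X - r i vanishes at `r i` and evaluation commutes with `det`, so `r i` times the
  -- identity minus the adjacency matrix has determinant 0.
  eigenvalue⇒eigenvector : ∀ {n} (Γ : Graph n) {r} → AreEigenvalues K Γ r → ∀ i → ¬ ¬ (∃[ v ] IsEigenvector Γ (r i) v)
  eigenvalue⇒eigenvector {n} Γ {r} eigenvalues i k =
    Kernel.det≈0⇒singular R isField M det≈0 λ (v , (j , vⱼ≉0) , Mv≈0) →
      k (v , record { index = j ; nonzero = vⱼ≉0 ; eigen = λ l → x≈y⇐x-y≈0 (trans (sym (row v l)) (Mv≈0 l)) })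
    where
    x : Carrier
    x = r i
    open Evaluation R x using (eval; eval-charpoly; eval-cong; eval-product-zero; eval-+; eval-X; eval-const)
    open Polynomials rawRing using (polyRawRing; X; const; _+ₚ_)
    open RawSemiringDefs (RawRing.rawSemiring polyRawRing) using (product)
    A M : Fin n → Fin n → Carrier
    A = adjacency Γ
    M l j = (if does (l ≟ j) then x else 0#) + - A l j
    linear : Fin n → Polynomials.Poly rawRing
    linear j = X +ₚ const (- r j)
    det≈0 : Matrices.det rawRing M ≈ 0#
    det≈0 = begin
      Matrices.det rawRing M    ≈⟨ eval-charpoly A ⟨
      eval (charpoly rawRing A) ≈⟨ eval-cong (charpoly rawRing A) (product linear) eigenvalues ⟩
      eval (product linear)     ≈⟨ eval-product-zero linear i (trans (eval-+ X (const (- r i)))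
                                     (trans (+-cong eval-X (eval-const (- r i))) (-‿inverseʳ x))) ⟩
      0# ∎
    row : ∀ v l → sum (λ j → M l j * v j) ≈ x * v l - sum (λ j → A l j * v j)
    row v l = begin
      sum (λ j → M l j * v j)               ≈⟨ sum-cong-≋ {n} split ⟩
      sum (λ j → d j + - 1# * (A l j * v j)) ≈⟨ ∑-distrib-+ d (λ j → - 1# * (A l j * v j)) ⟩
      sum d + sum (λ j → - 1# * (A l j * v j)) ≈⟨ +-cong (sum-δ l (λ j → x * v j)) (sym (*-distribˡ-sum (- 1#) (λ j → A l j * v j))) ⟩
      x * v l + - 1# * sum (λ j → A l j * v j) ≈⟨ solve 2 (λ a b → a :+ (:- con (+ 1)) :* b := a :- b) refl (x * v l) _ ⟩
      x * v l - sum (λ j → A l j * v j) ∎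
      where
      d : Vector Carrier n
      d j = if does (l ≟ j) then x * v l else 0#
      split : ∀ j → M l j * v j ≈ d j + - 1# * (A l j * v j)
      split j with l ≟ j
      ... | yes ≡.refl = solve 3 (λ x a v → (x :+ :- a) :* v := x :* v :+ (:- con (+ 1)) :* (a :* v)) refl x (A l l) (v l)
      ... | no  _      = solve 2 (λ a v → (con (+ 0) :+ :- a) :* v := con (+ 0) :+ (:- con (+ 1)) :* (a :* v)) refl (A l j) (v j)

  EigenvaluesRational : ∀ {n} → Graph n → Set
  EigenvaluesRational Γ = HasDegree K 2 → ∀ x v → IsEigenvector Γ x v → ¬ ¬ IsRational x

-- Finitely many double negations combine into one, so all eigenvalues may be taken rational at
-- once. The field that they generate is then ℚ, which has no basis of two elements.
¬twoIntegral : ∀ {n} (Γ : Graph n) → (∀ K → Extension.EigenvaluesRational K Γ) → ¬ TwoIntegral Γ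
¬twoIntegral Γ eigenvalues-rational (K , (r , eigenvalues , generated) , degree) =
  ¬¬-Fin (λ i k → eigenvalue⇒eigenvector Γ eigenvalues i λ (v , v-eigen) →
           eigenvalues-rational K degree (r i) v v-eigen k)
    λ r-rational → Quadratic.¬all-rational degree λ x → generated-rational r-rational (generated x)
  where open Extension K

-- The sequences ζʲ + ζ⁻ʲ

module Chebyshev (K : FieldExtensionOfℚ) where
  open Extension K
  open CommutativeRing R hiding (zero; rawRing)
  open Solver using (solve; _:+_; _:*_; _:-_; :-_; _:=_; con)
  open import Algebra.Properties.Semiring.Sum semiring using (sum; sum-cong-≋; ∑-distrib-+; *-distribˡ-sum)
  open import Relation.Binary.Reasoning.Setoid setoid

  -- cheb (z + z⁻¹) j = zʲ + z⁻ʲ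
  cheb : Carrier → ℕ → Carrier
  cheb y zero          = int (+ 2)
  cheb y (suc zero)    = y
  cheb y (suc (suc j)) = y * cheb y (suc j) - cheb y j

  -- The product of zᵃ + z⁻ᵃ and zᵈ + z⁻ᵈ contains the powers ±(a + d) and ±(d - a). The difference
  -- is supplied as `m`, which avoids truncated subtraction.
  cheb-product : ∀ y a m {d} → d ≡ a ℕ.+ m → cheb y (a ℕ.+ d) + cheb y m ≈ cheb y a * cheb y d
  cheb-product y zero          m ≡.refl = solve 1 (λ u → u :+ u := con (+ 2) :* u) refl (cheb y m)
  cheb-product y (suc zero)    m ≡.refl =
    solve 3 (λ y u v → y :* u :- v :+ v := y :* u) refl y (cheb y (suc m)) (cheb y m)
  cheb-product y (suc (suc a)) m {d} ≡.refl = begin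
    y * U - V + cheb y m
      ≈⟨ solve 5 (λ y u v w m → y :* u :- v :+ m := y :* (u :+ w) :- (v :+ (y :* w :- m))) refl y U V W (cheb y m) ⟩
    y * (U + W) - (V + (y * W - cheb y m))
      ≈⟨ +-cong (*-congˡ (cheb-product y (suc a) (suc m) (≡.cong suc (≡.sym (ℕ.+-suc a m)))))
                (-‿cong (cheb-product y a (suc (suc m)) (≡.sym (≡.trans (ℕ.+-suc a (suc m)) (≡.cong suc (ℕ.+-suc a m)))))) ⟩
    y * (cheb y (suc a) * cheb y d) - cheb y a * cheb y d
      ≈⟨ solve 4 (λ y u v d → y :* (u :* d) :- v :* d := (y :* u :- v) :* d) refl y (cheb y (suc a)) (cheb y a) (cheb y d) ⟩
    cheb y (suc (suc a)) * cheb y d ∎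
    where
    U V W : Carrier
    U = cheb y (suc a ℕ.+ d)
    V = cheb y (a ℕ.+ d)
    W = cheb y (suc m)

  -- In terms of z this is (zᵃ)ᵇ = zᵇᵃ.
  cheb-∘ : ∀ y a b → cheb (cheb y a) b ≈ cheb y (b ℕ.* a)
  cheb-∘ y a zero          = refl
  cheb-∘ y a (suc zero)    = reflexive (≡.cong (cheb y) (≡.sym (ℕ.+-identityʳ a)))
  cheb-∘ y a (suc (suc b)) = begin
    cheb y a * cheb (cheb y a) (suc b) - cheb (cheb y a) b
      ≈⟨ +-cong (*-congˡ (cheb-∘ y a (suc b))) (-‿cong (cheb-∘ y a b)) ⟩
    cheb y a * cheb y (a ℕ.+ b ℕ.* a) - cheb y (b ℕ.* a)
      ≈⟨ +-congʳ (cheb-product y a (b ℕ.* a) ≡.refl) ⟨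
    cheb y (a ℕ.+ (a ℕ.+ b ℕ.* a)) + cheb y (b ℕ.* a) - cheb y (b ℕ.* a)
      ≈⟨ solve 2 (λ u v → u :+ v :- v := u) refl (cheb y (a ℕ.+ (a ℕ.+ b ℕ.* a))) (cheb y (b ℕ.* a)) ⟩
    cheb y (a ℕ.+ (a ℕ.+ b ℕ.* a)) ∎

  -- dirichlet (z + z⁻¹) l = z⁻ˡ + … + z⁰ + … + zˡ
  dirichlet : Carrier → ℕ → Carrier
  dirichlet y zero          = 1#
  dirichlet y (suc zero)    = 1# + y
  dirichlet y (suc (suc l)) = y * dirichlet y (suc l) - dirichlet y l

  -- The recurrence (u, v) ↦ (y u - v, u) conserves the form u² + v² - y u v, whose value at `l = 0`
  -- is 2 + y.
  dirichlet-invariant : ∀ y l (let s = dirichlet y) → s (suc l) * s (suc l) + s l * s l - y * (s (suc l) * s l) ≈ int (+ 2) + y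
  dirichlet-invariant y zero =
    solve 1 (λ y → (con (+ 1) :+ y) :* (con (+ 1) :+ y) :+ con (+ 1) :* con (+ 1) :- y :* ((con (+ 1) :+ y) :* con (+ 1))
                   := con (+ 2) :+ y) refl y
  dirichlet-invariant y (suc l) = trans
    (solve 3 (λ y u v → (y :* u :- v) :* (y :* u :- v) :+ u :* u :- y :* ((y :* u :- v) :* u)
                        := u :* u :+ v :* v :- y :* (u :* v)) refl y (dirichlet y (suc l)) (dirichlet y l))
    (dirichlet-invariant y l)

  private
    -- For w² = z²ˡ⁺¹ the odd case is 2 - w² - w⁻² = -(w - w⁻¹)², and w - w⁻¹ is the Dirichlet sum
    -- times the difference of the half powers of z. The even case is carried along because the
    -- recurrence reaches two steps back.
    2-cheb : ∀ y l (let s = dirichlet y) →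
      int (+ 2) - cheb y (1 ℕ.+ l ℕ.* 2) ≈ (int (+ 2) - y) * (s l * s l) ×
      int (+ 2) - cheb y (2 ℕ.+ l ℕ.* 2) ≈ (int (+ 2) - y) * (s l * s (suc l) + 1#)
    2-cheb y zero =
      solve 1 (λ y → con (+ 2) :- y := (con (+ 2) :- y) :* (con (+ 1) :* con (+ 1))) refl y ,
      solve 1 (λ y → con (+ 2) :- (y :* y :- con (+ 2)) := (con (+ 2) :- y) :* (con (+ 1) :* (con (+ 1) :+ y) :+ con (+ 1))) refl y
    2-cheb y (suc l) = odd , (begin
      int (+ 2) - (y * O - E)
        ≈⟨ solve 3 (λ y o e → con (+ 2) :- (y :* o :- e) := con (+ 2) :* (con (+ 2) :- y) :+ y :* (con (+ 2) :- o) :- (con (+ 2) :- e)) refl y O E ⟩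
      int (+ 2) * (int (+ 2) - y) + y * (int (+ 2) - O) - (int (+ 2) - E)
        ≈⟨ +-cong (+-congˡ (*-congˡ odd)) (-‿cong even) ⟩
      int (+ 2) * (int (+ 2) - y) + y * ((int (+ 2) - y) * (u * u)) - (int (+ 2) - y) * (v * u + 1#)
        ≈⟨ solve 3 (λ y u v → con (+ 2) :* (con (+ 2) :- y) :+ y :* ((con (+ 2) :- y) :* (u :* u)) :- (con (+ 2) :- y) :* (v :* u :+ con (+ 1))
                    := (con (+ 2) :- y) :* (u :* (y :* u :- v) :+ con (+ 1))) refl y u v ⟩
      (int (+ 2) - y) * (u * (y * u - v) + 1#) ∎)
      where
      u v O E : Carrier
      u = dirichlet y (suc l)
      v = dirichlet y l
      E = cheb y (2 ℕ.+ l ℕ.* 2)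
      O = cheb y (3 ℕ.+ l ℕ.* 2)
      even : int (+ 2) - E ≈ (int (+ 2) - y) * (v * u + 1#)
      even = proj₂ (2-cheb y l)
      odd : int (+ 2) - O ≈ (int (+ 2) - y) * (u * u)
      odd = begin
        int (+ 2) - (y * E - cheb y (1 ℕ.+ l ℕ.* 2))
          ≈⟨ solve 3 (λ y e o → con (+ 2) :- (y :* e :- o) := con (+ 2) :* (con (+ 2) :- y) :+ y :* (con (+ 2) :- e) :- (con (+ 2) :- o)) refl y E (cheb y (1 ℕ.+ l ℕ.* 2)) ⟩
        int (+ 2) * (int (+ 2) - y) + y * (int (+ 2) - E) - (int (+ 2) - cheb y (1 ℕ.+ l ℕ.* 2))
          ≈⟨ +-cong (+-congˡ (*-congˡ even)) (-‿cong (proj₁ (2-cheb y l))) ⟩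
        int (+ 2) * (int (+ 2) - y) + y * ((int (+ 2) - y) * (v * u + 1#)) - (int (+ 2) - y) * (v * v)
          ≈⟨ solve 3 (λ y u v → con (+ 2) :* (con (+ 2) :- y) :+ y :* ((con (+ 2) :- y) :* (v :* u :+ con (+ 1))) :- (con (+ 2) :- y) :* (v :* v)
                      := (con (+ 2) :- y) :* (con (+ 2) :+ y :- (u :* u :+ v :* v :- y :* (u :* v)) :+ u :* u)) refl y u v ⟩
        (int (+ 2) - y) * (int (+ 2) + y - (u * u + v * v - y * (u * v)) + u * u)
          ≈⟨ *-congˡ (+-congʳ (+-congˡ (-‿cong (dirichlet-invariant y l)))) ⟩
        (int (+ 2) - y) * (int (+ 2) + y - (int (+ 2) + y) + u * u)
          ≈⟨ solve 2 (λ y u → (con (+ 2) :- y) :* (con (+ 2) :+ y :- (con (+ 2) :+ y) :+ u :* u) := (con (+ 2) :- y) :* (u :* u)) refl y u ⟩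
        (int (+ 2) - y) * (u * u) ∎

  2-cheb-odd : ∀ y l → int (+ 2) - cheb y (1 ℕ.+ l ℕ.* 2) ≈ (int (+ 2) - y) * (dirichlet y l * dirichlet y l)
  2-cheb-odd y l = proj₁ (2-cheb y l)

  -- The index of cheb y (j - 1), as cheb y is even.
  below : ℕ → ℕ
  below zero    = 1
  below (suc j) = j

  cheb-step : ∀ y j → y * cheb y j ≈ cheb y (suc j) + cheb y (below j)
  cheb-step y zero    = solve 1 (λ y → y :* con (+ 2) := y :+ y) refl y
  cheb-step y (suc j) = solve 3 (λ y u v → y :* u := y :* u :- v :+ v) refl y (cheb y (suc j)) (cheb y j)

  -- The recurrence has order two, so the return of the two initial values 2 and `y` at index `n`
  -- makes the whole sequence periodic.
  record Periodic (n : ℕ) (y : Carrier) : Set where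
    field
      cheb-n  : cheb y n ≈ int (+ 2)
      cheb-1+n : cheb y (suc n) ≈ y

    cheb-+n : ∀ j → cheb y (j ℕ.+ n) ≈ cheb y j
    cheb-+n zero          = cheb-n
    cheb-+n (suc zero)    = cheb-1+n
    cheb-+n (suc (suc j)) = +-cong (*-congˡ (cheb-+n (suc j))) (-‿cong (cheb-+n j))

    cheb-+*n : ∀ j k → cheb y (j ℕ.+ k ℕ.* n) ≈ cheb y j
    cheb-+*n j zero    = reflexive (≡.cong (cheb y) (ℕ.+-identityʳ j))
    cheb-+*n j (suc k) = trans
      (reflexive (≡.cong (cheb y) (≡.trans (≡.cong (j ℕ.+_) (ℕ.+-comm n (k ℕ.* n))) (≡.sym (ℕ.+-assoc j (k ℕ.* n) n)))))
      (trans (cheb-+n (j ℕ.+ k ℕ.* n)) (cheb-+*n j k))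

    -- The index `j` is -1 modulo `n`; one step of the recurrence backwards from the indices 0 and 1
    -- gives `y`.
    cheb-reflect : ∀ j k → suc j ≡ k ℕ.* n → cheb y j ≈ y
    cheb-reflect j k 1+j≡k*n = begin
      cheb y j                                         ≈⟨ solve 2 (λ u v → v := u :- (u :- v)) refl (y * cheb y (suc j)) (cheb y j) ⟩
      y * cheb y (suc j) - cheb y (suc (suc j))        ≈⟨ +-cong (*-congˡ (trans (reflexive (≡.cong (cheb y) 1+j≡k*n)) (cheb-+*n 0 k)))
                                                            (-‿cong (trans (reflexive (≡.cong (cheb y ∘ suc) 1+j≡k*n)) (cheb-+*n 1 k))) ⟩
      y * int (+ 2) - y                                ≈⟨ solve 1 (λ y → y :* con (+ 2) :- y := y) refl y ⟩
      y ∎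

  ∑< : ℕ → (ℕ → Carrier) → Carrier
  ∑< n f = sum {n} (f ∘ toℕ)

  ∑<-cong : ∀ n {f g} → (∀ j → f j ≈ g j) → ∑< n f ≈ ∑< n g
  ∑<-cong n f≈g = sum-cong-≋ {n} (f≈g ∘ toℕ)

  ∑<-+ : ∀ n f g → ∑< n (λ j → f j + g j) ≈ ∑< n f + ∑< n g
  ∑<-+ n f g = ∑-distrib-+ {n} (f ∘ toℕ) (g ∘ toℕ)

  ∑<-* : ∀ n a f → a * ∑< n f ≈ ∑< n (λ j → a * f j)
  ∑<-* n a f = *-distribˡ-sum {n} a (f ∘ toℕ)

  ∑<-const : ∀ n a → ∑< n (λ _ → a) ≈ int (+ n) * a
  ∑<-const zero    a = sym (trans (*-congʳ int-0) (zeroˡ a))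
  ∑<-const (suc n) a = begin
    a + ∑< n (λ _ → a)     ≈⟨ +-congˡ (∑<-const n a) ⟩
    a + int (+ n) * a      ≈⟨ solve 2 (λ a m → a :+ m :* a := (con (+ 1) :+ m) :* a) refl a (int (+ n)) ⟩
    (1# + int (+ n)) * a   ≈⟨ *-congʳ (trans (int-+ (+ 1) (+ n)) (+-congʳ int-1)) ⟨
    int (+ suc n) * a ∎

  ∑<-shift : ∀ n f → f n ≈ f 0 → ∑< n (f ∘ suc) ≈ ∑< n f
  ∑<-shift n f fₙ≈f₀ = begin
    ∑< n (f ∘ suc)             ≈⟨ solve 2 (λ a s → s := a :+ s :- a) refl (f 0) (∑< n (f ∘ suc)) ⟩
    f 0 + ∑< n (f ∘ suc) - f 0 ≈⟨ +-cong (last n f) (-‿cong (sym fₙ≈f₀)) ⟩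
    ∑< n f + f n - f n         ≈⟨ solve 2 (λ a s → s :+ a :- a := s) refl (f n) (∑< n f) ⟩
    ∑< n f ∎
    where
    last : ∀ n f → f 0 + ∑< n (f ∘ suc) ≈ ∑< n f + f n
    last zero    f = +-comm _ _
    last (suc n) f = begin
      f 0 + (f 1 + ∑< n (λ j → f (suc (suc j)))) ≈⟨ +-congˡ (last n (f ∘ suc)) ⟩
      f 0 + (∑< n (f ∘ suc) + f (suc n)) ≈⟨ +-assoc _ _ _ ⟨
      f 0 + ∑< n (f ∘ suc) + f (suc n) ∎

  module _ {n y} (periodic : Periodic n y) where
    open Periodic periodic

    -- Summing `cheb-step` over a period gives y σ = 2 σ, since both shifts permute the period
    -- cyclically.
    ∑<-cheb : (y - int (+ 2)) * ∑< n (cheb y) ≈ 0#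
    ∑<-cheb = begin
      (y - int (+ 2)) * σ   ≈⟨ solve 2 (λ y s → (y :- con (+ 2)) :* s := y :* s :- (s :+ s)) refl y σ ⟩
      y * σ - (σ + σ)       ≈⟨ +-congʳ y*σ≈σ+σ ⟩
      σ + σ - (σ + σ)       ≈⟨ -‿inverseʳ (σ + σ) ⟩
      0# ∎
      where
      X : ℕ → Carrier
      X = cheb y
      σ : Carrier
      σ = ∑< n X
      shift₁ : ∑< n (X ∘ suc) ≈ σ
      shift₁ = ∑<-shift n X cheb-n
      y*σ≈σ+σ : y * σ ≈ σ + σ
      y*σ≈σ+σ = begin
        y * σ                              ≈⟨ *-congˡ shift₁ ⟨
        y * ∑< n (X ∘ suc)                 ≈⟨ ∑<-* n y (X ∘ suc) ⟩
        ∑< n (λ j → y * X (suc j))         ≈⟨ ∑<-cong n (λ j → cheb-step y (suc j)) ⟩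
        ∑< n (λ j → X (suc (suc j)) + X j) ≈⟨ ∑<-+ n (λ j → X (suc (suc j))) X ⟩
        ∑< n (λ j → X (suc (suc j))) + σ           ≈⟨ +-congʳ (trans (∑<-shift n (X ∘ suc) cheb-1+n) shift₁) ⟩
        σ + σ ∎

  -- Orthogonality of eigenvectors: the sum of the two neighbours is a self-adjoint operator on
  -- periodic sequences, and it multiplies one sequence by `y` and the other by `z`. Concretely, y τ
  -- and z τ both equal the same two shifted sums α + β.
  ∑<-cheb-product : ∀ {n y z} → Periodic n y → Periodic n z → (y - z) * ∑< n (λ j → cheb y j * cheb z j) ≈ 0#
  ∑<-cheb-product {n} {y} {z} y-periodic z-periodic = begin
    (y - z) * τ    ≈⟨ solve 3 (λ y z t → (y :- z) :* t := y :* t :- z :* t) refl y z τ ⟩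
    y * τ - z * τ  ≈⟨ +-cong y*τ (-‿cong z*τ) ⟩
    α + β - (α + β) ≈⟨ -‿inverseʳ (α + β) ⟩
    0# ∎
    where
    module y = Periodic y-periodic
    module z = Periodic z-periodic
    Y Z : ℕ → Carrier
    Y = cheb y
    Z = cheb z
    τ α β : Carrier
    τ = ∑< n (λ j → Y j * Z j)
    α = ∑< n (λ j → Y (suc j) * Z j)
    β = ∑< n (λ j → Y j * Z (suc j))
    τ-shift : ∑< n (λ j → Y (suc j) * Z (suc j)) ≈ τ
    τ-shift = ∑<-shift n (λ j → Y j * Z j) (*-cong y.cheb-n z.cheb-n)
    y*τ : y * τ ≈ α + β
    y*τ = begin
      y * τ                                         ≈⟨ *-congˡ τ-shift ⟨
      y * ∑< n (λ j → Y (suc j) * Z (suc j))        ≈⟨ ∑<-* n y (λ j → Y (suc j) * Z (suc j)) ⟩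
      ∑< n (λ j → y * (Y (suc j) * Z (suc j)))      ≈⟨ ∑<-cong n (λ j → trans (sym (*-assoc y (Y (suc j)) (Z (suc j)))) (trans (*-congʳ {Z (suc j)} (cheb-step y (suc j))) (distribʳ (Z (suc j)) _ _))) ⟩
      ∑< n (λ j → Y (suc (suc j)) * Z (suc j) + Y j * Z (suc j))
        ≈⟨ ∑<-+ n (λ j → Y (suc (suc j)) * Z (suc j)) (λ j → Y j * Z (suc j)) ⟩
      ∑< n (λ j → Y (suc (suc j)) * Z (suc j)) + β  ≈⟨ +-congʳ (∑<-shift n (λ j → Y (suc j) * Z j) (*-cong y.cheb-1+n z.cheb-n)) ⟩
      α + β ∎
    z*τ : z * τ ≈ α + β
    z*τ = begin
      z * τ                                         ≈⟨ *-congˡ τ-shift ⟨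
      z * ∑< n (λ j → Y (suc j) * Z (suc j))        ≈⟨ ∑<-* n z (λ j → Y (suc j) * Z (suc j)) ⟩
      ∑< n (λ j → z * (Y (suc j) * Z (suc j)))
        ≈⟨ ∑<-cong n (λ j → trans (solve 3 (λ z a b → z :* (a :* b) := a :* (z :* b)) refl z (Y (suc j)) (Z (suc j)))
                              (trans (*-congˡ {Y (suc j)} (trans (cheb-step z (suc j)) (+-comm (Z (suc (suc j))) (Z j)))) (distribˡ _ _ _))) ⟩
      ∑< n (λ j → Y (suc j) * Z j + Y (suc j) * Z (suc (suc j)))
        ≈⟨ ∑<-+ n (λ j → Y (suc j) * Z j) (λ j → Y (suc j) * Z (suc (suc j))) ⟩
      α + ∑< n (λ j → Y (suc j) * Z (suc (suc j)))  ≈⟨ +-congˡ (∑<-shift n (λ j → Y j * Z (suc j)) (*-cong y.cheb-n z.cheb-1+n)) ⟩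
      α + β ∎

-- Integrality and conjugation

coprime-*ˡ : ∀ {a b c} → Coprime a c → Coprime b c → Coprime (a ℕ.* b) c
coprime-*ˡ a⊥c b⊥c (k∣ab , k∣c) =
  b⊥c (Coprime.coprime-divisor (λ (i∣k , i∣a) → a⊥c (i∣a , ℕ∣.∣-trans i∣k k∣c)) k∣ab , k∣c)

coprime-^ˡ : ∀ {a c} → Coprime a c → ∀ m → Coprime (a ℕ.^ m) c
coprime-^ˡ {c = c} a⊥c zero    = Coprime.1-coprimeTo c
coprime-^ˡ         a⊥c (suc m) = coprime-*ˡ a⊥c (coprime-^ˡ a⊥c m)

∣*^-cancel : ∀ {a b c} → Coprime a c → ∀ m → a ∣ b ℕ.* c ℕ.^ m → a ∣ b
∣*^-cancel {a} {b} {c} a⊥c zero    a∣ = ≡.subst (a ∣_) (ℕ.*-identityʳ b) a∣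
∣*^-cancel {a} {b} {c} a⊥c (suc m) a∣ =
  ∣*^-cancel a⊥c m (Coprime.coprime-divisor a⊥c (≡.subst (a ∣_) b*[c*c^m]≡c*[b*c^m] a∣))
  where
  b*[c*c^m]≡c*[b*c^m] : b ℕ.* (c ℕ.* c ℕ.^ m) ≡ c ℕ.* (b ℕ.* c ℕ.^ m)
  b*[c*c^m]≡c*[b*c^m] = ℕ.+-*-Solver.solve 3 (λ b c d → b :* (c :* d) := c :* (b :* d)) ≡.refl b c (c ℕ.^ m)
    where open ℕ.+-*-Solver

n<[2+a]^n : ∀ a n → n < (2 ℕ.+ a) ℕ.^ n
n<[2+a]^n a zero    = s≤s z≤n
n<[2+a]^n a (suc n) = begin-strict
  suc n                                       <⟨ ℕ.+-mono-≤-< (ℕ.m^n>0 (2 ℕ.+ a) n) (n<[2+a]^n a n) ⟩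
  b ℕ.+ b                                     ≤⟨ ℕ.+-monoʳ-≤ b (ℕ.m≤m+n b (a ℕ.* b)) ⟩
  b ℕ.+ (b ℕ.+ a ℕ.* b) ∎
  where
  open ℕ.≤-Reasoning
  b : ℕ
  b = (2 ℕ.+ a) ℕ.^ n

-- Coprimality turns the hypothesis into aᵐ ∣ b for every m. For a ≥ 2 this fails at m = b, because
-- b < aᵇ.
bounded-denominator⇒1 : ∀ {a c} b → .{{ℕ.NonZero a}} → .{{ℕ.NonZero b}} → Coprime a c →
                        (∀ m → a ℕ.^ m ∣ b ℕ.* c ℕ.^ m) → a ≡ 1
bounded-denominator⇒1 {1} b a⊥c a∣ = ≡.refl
bounded-denominator⇒1 {suc (suc a)} b a⊥c a∣ = ⊥-elim
  (ℕ.<⇒≱ (n<[2+a]^n a b) (ℕ∣.∣⇒≤ (∣*^-cancel (coprime-^ˡ a⊥c b) b (a∣ b))))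

abs-^ : ∀ i m → ℤ.∣ i ℤ.^ m ∣ ≡ ℤ.∣ i ∣ ℕ.^ m
abs-^ i zero    = ≡.refl
abs-^ i (suc m) = ≡.trans (ℤ.abs-* i (i ℤ.^ m)) (≡.cong (ℤ.∣ i ∣ ℕ.*_) (abs-^ i m))

square-unit : ∀ i j → i ℤ.* i ℤ.* j ≡ + 1 → i ℤ.* i ≡ + 1
square-unit i j iij≡1 with ℕ.m*n≡1⇒m≡1 ℤ.∣ i ∣ _ (≡.trans (≡.sym (≡.trans (≡.cong ℤ.∣_∣ (ℤ.*-assoc i i j)) (ℤ.abs-* i (i ℤ.* j)))) (≡.cong ℤ.∣_∣ iij≡1))
square-unit (+ 1)    j iij≡1 | ≡.refl = ≡.refl
square-unit -[1+ 0 ] j iij≡1 | ≡.refl = ≡.refl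

parity : ∀ n → ∃[ l ] (n ≡ l ℕ.* 2 ⊎ n ≡ 1 ℕ.+ l ℕ.* 2)
parity zero = 0 , inj₁ ≡.refl
parity (suc n) with parity n
... | l , inj₁ n≡2l   = l , inj₂ (≡.cong suc n≡2l)
... | l , inj₂ n≡1+2l = suc l , inj₁ (≡.cong suc n≡1+2l)

-- An even `j` becomes odd when the odd modulus is added once. This makes `2-cheb-odd`, which speaks
-- of odd multiples, available for every residue.
odd-representative : ∀ h j → ∃[ l ] ∃[ e ] 1 ℕ.+ l ℕ.* 2 ≡ j ℕ.+ e ℕ.* (1 ℕ.+ h ℕ.* 2)
odd-representative h j with parity j
... | l , inj₂ ≡.refl = l , 0 , ≡.sym (ℕ.+-identityʳ _)
... | l , inj₁ ≡.refl = l ℕ.+ h , 1 ,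
  ℕ.+-*-Solver.solve 2 (λ l h → con 1 :+ (l :+ h) :* con 2 := l :* con 2 :+ (con 1 :* (con 1 :+ h :* con 2))) ≡.refl l h
  where open ℕ.+-*-Solver

product-mod : ∀ i j e e′ m → (i ℕ.+ e′ ℕ.* m) ℕ.* (j ℕ.+ e ℕ.* m) ≡
              i ℕ.* j ℕ.+ (i ℕ.* e ℕ.+ e′ ℕ.* j ℕ.+ e′ ℕ.* e ℕ.* m) ℕ.* m
product-mod = ℕ.+-*-Solver.solve 5
  (λ i j e e′ m → (i :+ e′ :* m) :* (j :+ e :* m) := i :* j :+ (i :* e :+ e′ :* j :+ e′ :* e :* m) :* m) ≡.refl
  where open ℕ.+-*-Solver

module QuadraticConjugate (K : FieldExtensionOfℚ) where
  open FieldExtensionOfℚ K using (ι)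
  open Extension K
  open Chebyshev K
  open CommutativeRing R hiding (zero; rawRing)
  open Solver using (solve; _:+_; _:*_; _:-_; :-_; _:=_; con)
  open import Algebra.Properties.Semiring.Exp semiring using (_^_)
  open import Relation.Binary.Reasoning.Setoid setoid

  -- Instantiated twice: the conjugation calculus runs over ℚ first, and again over ℤ once t and n
  -- are known to be integers.
  record IsSubring (P : Carrier → Set) : Set where
    field
      ≈∈ : ∀ {a b} → a ≈ b → P a → P b
      int∈ : ∀ z → P (int z)
      +∈   : ∀ {a b} → P a → P b → P (a + b)
      *∈   : ∀ {a b} → P a → P b → P (a * b)
      neg∈ : ∀ {a} → P a → P (- a)

  IsInteger : Carrier → Set
  IsInteger a = ∃[ z ] a ≈ int z

  rational-isSubring : IsSubring IsRational
  rational-isSubring = record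
    { ≈∈ = rational-resp ; int∈ = λ z → fromℤ z , refl
    ; +∈ = rational-+ ; *∈ = rational-* ; neg∈ = rational-neg }

  integer-isSubring : IsSubring IsInteger
  integer-isSubring = record
    { ≈∈ = λ a≈b (z , a≈z) → z , trans (sym a≈b) a≈z
    ; int∈ = λ z → z , refl
    ; +∈   = λ (y , a≈y) (z , b≈z) → y ℤ.+ z , trans (+-cong a≈y b≈z) (sym (int-+ y z))
    ; *∈   = λ (y , a≈y) (z , b≈z) → y ℤ.* z , trans (*-cong a≈y b≈z) (sym (int-* y z))
    ; neg∈ = λ (z , a≈z) → ℤ.- z , trans (-‿cong a≈z) (sym (int-neg z)) }

  clear-denominator : ∀ {a} q → a ≈ ι q → int (ℚ.↧ q) * a ≈ int (ℚ.↥ q)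
  clear-denominator q a≈q = trans (*-congˡ a≈q) (trans (sym (ι.*-homo _ q)) (ι-cong (↧*≡↥ q)))

  -- For a = n / d in lowest terms, integrality of D aᵐ says dᵐ ∣ D nᵐ; as this holds for all m, d =
  -- 1.
  bounded-powers⇒integer : ∀ {a} D → .{{ℕ.NonZero D}} → IsRational a →
                           (∀ m → IsInteger (int (+ D) * a ^ m)) → IsInteger a
  bounded-powers⇒integer {a} D (q@(mkℚ n d-1 c) , a≈q) bounded = n , (begin
    a              ≈⟨ *-identityˡ a ⟨
    1# * a         ≈⟨ *-congʳ (trans (reflexive (≡.cong (int ∘ +_) d≡1)) int-1) ⟨
    int (+ d) * a  ≈⟨ clear-denominator q a≈q ⟩
    int n ∎)
    where
    d : ℕ
    d = suc d-1
    powers : ∀ m → int ((+ d) ℤ.^ m) * a ^ m ≈ int (n ℤ.^ m)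
    powers zero    = *-identityʳ _
    powers (suc m) = begin
      int (+ d ℤ.* (+ d) ℤ.^ m) * (a * a ^ m)       ≈⟨ *-congʳ (int-* (+ d) _) ⟩
      int (+ d) * int ((+ d) ℤ.^ m) * (a * a ^ m)
        ≈⟨ solve 4 (λ d e a b → d :* e :* (a :* b) := d :* a :* (e :* b)) refl (int (+ d)) (int ((+ d) ℤ.^ m)) a (a ^ m) ⟩
      int (+ d) * a * (int ((+ d) ℤ.^ m) * a ^ m)   ≈⟨ *-cong (clear-denominator q a≈q) (powers m) ⟩
      int n * int (n ℤ.^ m)                         ≈⟨ int-* n _ ⟨
      int (n ℤ.* n ℤ.^ m) ∎
    d^m∣ : ∀ m → d ℕ.^ m ∣ D ℕ.* ℤ.∣ n ∣ ℕ.^ m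
    d^m∣ m with bounded m
    ... | (z , Da^m≈z) = divides ℤ.∣ z ∣ (≡.sym (≡.trans (≡.cong (ℤ.∣ z ∣ ℕ.*_) (≡.sym (abs-^ (+ d) m)))
        (≡.trans (≡.sym (ℤ.abs-* z ((+ d) ℤ.^ m))) (≡.trans (≡.cong ℤ.∣_∣ cleared)
        (≡.trans (ℤ.abs-* (+ D) (n ℤ.^ m)) (≡.cong (D ℕ.*_) (abs-^ n m)))))))
      where
      cleared : z ℤ.* (+ d) ℤ.^ m ≡ + D ℤ.* n ℤ.^ m
      cleared = int-injective (begin
        int (z ℤ.* (+ d) ℤ.^ m)                    ≈⟨ int-* z _ ⟩
        int z * int ((+ d) ℤ.^ m)                  ≈⟨ *-congʳ Da^m≈z ⟨
        int (+ D) * a ^ m * int ((+ d) ℤ.^ m)      ≈⟨ solve 3 (λ x y z → x :* y :* z := x :* (z :* y)) refl (int (+ D)) (a ^ m) (int ((+ d) ℤ.^ m)) ⟩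
        int (+ D) * (int ((+ d) ℤ.^ m) * a ^ m)    ≈⟨ *-congˡ (powers m) ⟩
        int (+ D) * int (n ℤ.^ m)                  ≈⟨ int-* (+ D) _ ⟨
        int (+ D ℤ.* n ℤ.^ m) ∎)
    d≡1 : d ≡ 1
    d≡1 = bounded-denominator⇒1 D (Coprime.sym (Coprime.recompute c)) d^m∣

  common-denominator : ∀ {m} (f : Fin m → Carrier) → (∀ i → IsRational (f i)) →
                       ∃[ D ] ℕ.NonZero D × (∀ i → IsInteger (int (+ D) * f i))
  common-denominator {zero}  f f-rational = 1 , _ , λ ()
  common-denominator {suc m} f f-rational with f-rational zero | common-denominator (f ∘ suc) (f-rational ∘ suc)
  ... | (q@(mkℚ n d-1 c) , f₀≈q) | (D , D≢0 , integral) = suc d-1 ℕ.* D , ℕ.m*n≢0 (suc d-1) D {{_}} {{D≢0}} , λ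
    { zero → Int.≈∈ (begin
        int (+ D) * (int (+ d) * f zero)   ≈⟨ solve 3 (λ x y z → x :* (y :* z) := y :* x :* z) refl (int (+ D)) (int (+ d)) (f zero) ⟩
        int (+ d) * int (+ D) * f zero     ≈⟨ *-congʳ int-d*D ⟨
        int (+ (d ℕ.* D)) * f zero ∎) (Int.*∈ (Int.int∈ (+ D)) (n , clear-denominator q f₀≈q))
    ; (suc i) → Int.≈∈ (begin
        int (+ d) * (int (+ D) * f (suc i)) ≈⟨ *-assoc _ _ _ ⟨
        int (+ d) * int (+ D) * f (suc i)   ≈⟨ *-congʳ int-d*D ⟨
        int (+ (d ℕ.* D)) * f (suc i) ∎) (Int.*∈ (Int.int∈ (+ d)) (integral i)) }
    where
    module Int = IsSubring integer-isSubring
    d : ℕ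
    d = suc d-1
    int-d*D : int (+ (d ℕ.* D)) ≈ int (+ d) * int (+ D)
    int-d*D = trans (reflexive (≡.cong int (ℤ.pos-* d D))) (int-* (+ d) (+ D))

  common-denominator₂ : ∀ {l m} (f : Fin l → Fin m → Carrier) → (∀ i j → IsRational (f i j)) →
                        ∃[ D ] ℕ.NonZero D × (∀ i j → IsInteger (int (+ D) * f i j))
  common-denominator₂ {l} {m} f f-rational =
    let (D , D≢0 , integral) = common-denominator (λ k → entry (Fin.remQuot m k)) (λ k → f-rational _ _)
    in D , D≢0 , λ i j → ≡.subst (λ ij → IsInteger (int (+ D) * entry ij)) (Fin.remQuot-combine i j) (integral (Fin.combine i j))
    where
    entry : Fin l × Fin m → Carrier
    entry (i , j) = f i j

  module Conjugation {x t n : Carrier} (x² : x * x ≈ t * x - n) where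
    x′ : Carrier
    x′ = t - x

    xx′≈n : x * x′ ≈ n
    xx′≈n = begin
      x * (t - x)         ≈⟨ solve 2 (λ x t → x :* (t :- x) := t :* x :- x :* x) refl x t ⟩
      t * x - x * x       ≈⟨ +-congˡ (-‿cong x²) ⟩
      t * x - (t * x - n) ≈⟨ solve 3 (λ x t n → t :* x :- (t :* x :- n) := n) refl x t n ⟩
      n ∎

    x′² : x′ * x′ ≈ t * x′ - n
    x′² = begin
      x′ * x′          ≈⟨ solve 2 (λ x t → (t :- x) :* (t :- x) := t :* (t :- x) :- x :* (t :- x)) refl x t ⟩
      t * x′ - x * x′  ≈⟨ +-congˡ (-‿cong xx′≈n) ⟩
      t * x′ - n ∎

    -- Conjugation on P[x] as a relation: both elements have the same expression p + q x, read at
    -- `x` and at `x′`. A function would require `p` and `q` to be unique, which depends on x being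
    -- irrational.
    record Conjugate (P : Carrier → Set) (a a′ : Carrier) : Set where
      field
        {p q} : Carrier
        p∈    : P p
        q∈    : P q
        a≈    : a ≈ p + q * x
        a′≈   : a′ ≈ p + q * x′

    module _ {P : Carrier → Set} (P-subring : IsSubring P) (t∈ : P t) (n∈ : P n) where
      open IsSubring P-subring

      private
        0∈ : P 0#
        0∈ = ≈∈ int-0 (int∈ (+ 0))
        1∈ : P 1#
        1∈ = ≈∈ int-1 (int∈ (+ 1))

      conjugate-const : ∀ {a} → P a → Conjugate P a a
      conjugate-const {a} a∈ = record { p∈ = a∈ ; q∈ = 0∈ ; a≈ = a≈a+0* x ; a′≈ = a≈a+0* x′ }
        where
        a≈a+0* : ∀ x → a ≈ a + 0# * x
        a≈a+0* x = solve 2 (λ a x → a := a :+ con (+ 0) :* x) refl a x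

      conjugate-x : Conjugate P x x′
      conjugate-x = record { p∈ = 0∈ ; q∈ = 1∈ ; a≈ = x≈0+1* x ; a′≈ = x≈0+1* x′ }
        where
        x≈0+1* : ∀ x → x ≈ 0# + 1# * x
        x≈0+1* x = solve 1 (λ x → x := con (+ 0) :+ con (+ 1) :* x) refl x

      conjugate-+ : ∀ {a a′ b b′} → Conjugate P a a′ → Conjugate P b b′ → Conjugate P (a + b) (a′ + b′)
      conjugate-+ ca cb = record
        { p∈ = +∈ ca.p∈ cb.p∈ ; q∈ = +∈ ca.q∈ cb.q∈
        ; a≈ = trans (+-cong ca.a≈ cb.a≈) (regroup x) ; a′≈ = trans (+-cong ca.a′≈ cb.a′≈) (regroup x′) }
        where
        module ca = Conjugate ca
        module cb = Conjugate cb
        regroup : ∀ x → (ca.p + ca.q * x) + (cb.p + cb.q * x) ≈ (ca.p + cb.p) + (ca.q + cb.q) * x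
        regroup x = solve 5 (λ p q r s x → (p :+ q :* x) :+ (r :+ s :* x) := (p :+ r) :+ (q :+ s) :* x) refl ca.p ca.q cb.p cb.q x

      conjugate-neg : ∀ {a a′} → Conjugate P a a′ → Conjugate P (- a) (- a′)
      conjugate-neg ca = record
        { p∈ = neg∈ ca.p∈ ; q∈ = neg∈ ca.q∈
        ; a≈ = trans (-‿cong ca.a≈) (negate x) ; a′≈ = trans (-‿cong ca.a′≈) (negate x′) }
        where
        module ca = Conjugate ca
        negate : ∀ x → - (ca.p + ca.q * x) ≈ - ca.p + - ca.q * x
        negate x = solve 3 (λ p q x → :- (p :+ q :* x) := (:- p) :+ (:- q) :* x) refl ca.p ca.q x

      conjugate-* : ∀ {a a′ b b′} → Conjugate P a a′ → Conjugate P b b′ → Conjugate P (a * b) (a′ * b′)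
      conjugate-* ca cb = record
        { p∈ = +∈ (*∈ ca.p∈ cb.p∈) (neg∈ (*∈ (*∈ ca.q∈ cb.q∈) n∈))
        ; q∈ = +∈ (+∈ (*∈ ca.p∈ cb.q∈) (*∈ ca.q∈ cb.p∈)) (*∈ (*∈ ca.q∈ cb.q∈) t∈)
        ; a≈ = trans (*-cong ca.a≈ cb.a≈) (multiply x²)
        ; a′≈ = trans (*-cong ca.a′≈ cb.a′≈) (multiply x′²) }
        where
        module ca = Conjugate ca
        module cb = Conjugate cb
        -- Only the quadratic equation enters, so one computation serves both roots.
        multiply : ∀ {x} → x * x ≈ t * x - n → (ca.p + ca.q * x) * (cb.p + cb.q * x) ≈
          (ca.p * cb.p - ca.q * cb.q * n) + (ca.p * cb.q + ca.q * cb.p + ca.q * cb.q * t) * x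
        multiply {x} x² = begin
          (ca.p + ca.q * x) * (cb.p + cb.q * x)
            ≈⟨ solve 5 (λ p q r s x → (p :+ q :* x) :* (r :+ s :* x) := p :* r :+ (p :* s :+ q :* r) :* x :+ q :* s :* (x :* x))
                 refl ca.p ca.q cb.p cb.q x ⟩
          ca.p * cb.p + (ca.p * cb.q + ca.q * cb.p) * x + ca.q * cb.q * (x * x)
            ≈⟨ +-congˡ (*-congˡ x²) ⟩
          ca.p * cb.p + (ca.p * cb.q + ca.q * cb.p) * x + ca.q * cb.q * (t * x - n)
            ≈⟨ solve 7 (λ p q r s x t n → p :* r :+ (p :* s :+ q :* r) :* x :+ q :* s :* (t :* x :- n) :=
                 (p :* r :- q :* s :* n) :+ (p :* s :+ q :* r :+ q :* s :* t) :* x) refl ca.p ca.q cb.p cb.q x t n ⟩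
          _ ∎

      conjugate-swap : ∀ {a a′} → Conjugate P a a′ → Conjugate P a′ a
      conjugate-swap ca = record
        { p∈ = +∈ ca.p∈ (*∈ ca.q∈ t∈) ; q∈ = neg∈ ca.q∈
        ; a≈ = trans ca.a′≈ (solve 4 (λ p q t x → p :+ q :* (t :- x) := (p :+ q :* t) :+ (:- q) :* x) refl ca.p ca.q t x)
        ; a′≈ = trans ca.a≈ (solve 4 (λ p q t x → p :+ q :* x := (p :+ q :* t) :+ (:- q) :* (t :- x)) refl ca.p ca.q t x) }
        where
        module ca = Conjugate ca

      trace∈ : ∀ {a a′} → Conjugate P a a′ → P (a + a′)
      trace∈ ca = ≈∈ (sym (trans (+-cong ca.a≈ ca.a′≈)
        (solve 4 (λ p q t x → (p :+ q :* x) :+ (p :+ q :* (t :- x)) := con (+ 2) :* p :+ q :* t) refl ca.p ca.q t x)))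
        (+∈ (*∈ (int∈ (+ 2)) ca.p∈) (*∈ ca.q∈ t∈))
        where
        module ca = Conjugate ca

      norm∈ : ∀ {a a′} → Conjugate P a a′ → P (a * a′)
      norm∈ {a} {a′} ca = ≈∈ (sym (begin
        a * a′ ≈⟨ *-cong ca.a≈ ca.a′≈ ⟩
        (ca.p + ca.q * x) * (ca.p + ca.q * x′)
          ≈⟨ solve 4 (λ p q t x → (p :+ q :* x) :* (p :+ q :* (t :- x)) := p :* p :+ p :* q :* t :+ q :* q :* (x :* (t :- x)))
               refl ca.p ca.q t x ⟩
        ca.p * ca.p + ca.p * ca.q * t + ca.q * ca.q * (x * x′) ≈⟨ +-congˡ (*-congˡ xx′≈n) ⟩
        ca.p * ca.p + ca.p * ca.q * t + ca.q * ca.q * n ∎))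
        (+∈ (+∈ (*∈ ca.p∈ ca.p∈) (*∈ (*∈ ca.p∈ ca.q∈) t∈)) (*∈ (*∈ ca.q∈ ca.q∈) n∈))
        where
        module ca = Conjugate ca

      conjugate-cheb : ∀ j → Conjugate P (cheb x j) (cheb x′ j)
      conjugate-cheb zero          = conjugate-const (int∈ (+ 2))
      conjugate-cheb (suc zero)    = conjugate-x
      conjugate-cheb (suc (suc j)) =
        conjugate-+ (conjugate-* conjugate-x (conjugate-cheb (suc j))) (conjugate-neg (conjugate-cheb j))

      conjugate-dirichlet : ∀ {a a′} → Conjugate P a a′ → ∀ l → Conjugate P (dirichlet a l) (dirichlet a′ l)
      conjugate-dirichlet ca zero          = conjugate-const 1∈
      conjugate-dirichlet ca (suc zero)    = conjugate-+ (conjugate-const 1∈) ca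
      conjugate-dirichlet ca (suc (suc l)) =
        conjugate-+ (conjugate-* ca (conjugate-dirichlet ca (suc l))) (conjugate-neg (conjugate-dirichlet ca l))

  rational-multiple : ∀ {x p q} → ¬ IsRational x → IsRational p → IsRational q → p + q * x ≈ 0# → q ≈ 0#
  rational-multiple {x} {p} {q} irrational p-rational (r , q≈r) p+qx≈0 with r ℚ.≟ 0ℚ
  ... | yes ≡.refl = trans q≈r ι.0#-homo
  ... | no  r≢0    = ⊥-elim (irrational (rational-quotient r r≢0 (begin
    ι r * x          ≈⟨ *-congʳ q≈r ⟨
    q * x            ≈⟨ solve 3 (λ p q x → q :* x := (p :+ q :* x) :- p) refl p q x ⟩
    p + q * x - p    ≈⟨ +-congʳ p+qx≈0 ⟩
    0# - p           ≈⟨ +-identityˡ (- p) ⟩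
    - p ∎) (rational-neg p-rational)))

-- Integrality and norms for an irrational x with periodic Chebyshev sequence

module PeriodicQuadratic (K : FieldExtensionOfℚ) where
  open FieldExtensionOfℚ K using (ι)
  open Extension K
  open Chebyshev K
  open QuadraticConjugate K
  open CommutativeRing R hiding (zero; rawRing)
  open Solver using (solve; _:+_; _:*_; _:-_; :-_; _:=_; con)
  open import Algebra.Properties.Semiring.Exp semiring using (_^_)
  open import Algebra.Properties.Semiring.Sum semiring using (sum-cong-≋)
  open import Relation.Binary.Reasoning.Setoid setoid

  module _ {x : Carrier} {t n : ℚ} (irrational : ¬ IsRational x) (x² : x * x ≈ ι t * x - ι n)
    {m : ℕ} (m≢0 : ℕ.NonZero m) (periodic : Periodic m x) where

    open Conjugation x²
    private
      instance
        m-nonZero : ℕ.NonZero m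
        m-nonZero = m≢0
      t-rational : IsRational (ι t)
      t-rational = t , refl
      n-rational : IsRational (ι n)
      n-rational = n , refl
      module Int = IsSubring integer-isSubring
      X X′ : ℕ → Carrier
      X  = cheb x
      X′ = cheb x′
      X-conjugate : ∀ j → Conjugate IsRational (X j) (X′ j)
      X-conjugate = conjugate-cheb rational-isSubring t-rational n-rational
      infixl 6 _⊕_
      _⊕_ : ∀ {a a′ b b′} → Conjugate IsRational a a′ → Conjugate IsRational b b′ → Conjugate IsRational (a + b) (a′ + b′)
      _⊕_ = conjugate-+ rational-isSubring t-rational n-rational
      ⊖_ : ∀ {a a′} → Conjugate IsRational a a′ → Conjugate IsRational (- a) (- a′)
      ⊖_ = conjugate-neg rational-isSubring t-rational n-rational

    -- As 1 and x are independent over ℚ, a = 0 forces q = 0 and then p = 0. Equations such as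
    -- `X m ≈ X 0` thereby pass to `x′`, which gives its periodicity.
    conjugate-zero : ∀ {a a′} → Conjugate IsRational a a′ → a ≈ 0# → a′ ≈ 0#
    conjugate-zero {a} {a′} ca a≈0 = begin
      a′                   ≈⟨ ca.a′≈ ⟩
      ca.p + ca.q * x′     ≈⟨ +-congˡ (vanish x′) ⟩
      ca.p + 0#            ≈⟨ +-congˡ (vanish x) ⟨
      ca.p + ca.q * x      ≈⟨ ca.a≈ ⟨
      a                    ≈⟨ a≈0 ⟩
      0# ∎
      where
      module ca = Conjugate ca
      vanish : ∀ y → ca.q * y ≈ 0#
      vanish y = trans (*-congʳ (rational-multiple irrational ca.p∈ ca.q∈ (trans (sym ca.a≈) a≈0))) (zeroˡ y)

    periodic′ : Periodic m x′
    periodic′ = record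
      { cheb-n = x≈y⇐x-y≈0 (conjugate-zero
          (X-conjugate m ⊕ ⊖ X-conjugate 0) (trans (+-congʳ P.cheb-n) (-‿inverseʳ _)))
      ; cheb-1+n = x≈y⇐x-y≈0 (conjugate-zero
          (X-conjugate (suc m) ⊕ ⊖ X-conjugate 1) (trans (+-congʳ P.cheb-1+n) (-‿inverseʳ _))) }
      where
      module P = Periodic periodic

    private
      module P  = Periodic periodic
      module P′ = Periodic periodic′

    x′-irrational : ¬ IsRational x′
    x′-irrational x′-rational = irrational (rational-resp
      (solve 2 (λ t x → t :- (t :- x) := x) refl (ι t) x) (rational-+ t-rational (rational-neg x′-rational)))

    x-x′≉0 : ¬ (x - x′ ≈ 0#)
    x-x′≉0 x-x′≈0 = irrational (rational-quotient (fromℤ (+ 2)) (λ ()) (begin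
      int (+ 2) * x           ≈⟨ solve 2 (λ x t → con (+ 2) :* x := t :+ (x :- (t :- x))) refl x (ι t) ⟩
      ι t + (x - x′)          ≈⟨ +-congˡ x-x′≈0 ⟩
      ι t + 0#                ≈⟨ +-identityʳ _ ⟩
      ι t ∎) t-rational)

    -- The traces of X i * X′ j. There are finitely many of them, so they have a common denominator D;
    -- the additive group they span is stable under t and n, so the powers of t and n have bounded denominators.
    c : ℕ → ℕ → Carrier
    c i j = X i * X′ j + X′ i * X j

    c-rational : ∀ i j → IsRational (c i j)
    c-rational i j = trace∈ rational-isSubring t-rational n-rational
      (conjugate-* rational-isSubring t-rational n-rational (X-conjugate i)
        (conjugate-swap rational-isSubring t-rational n-rational (X-conjugate j)))

    reduce : ∀ i → ∃[ k ] X i ≈ X (toℕ {m} k) × X′ i ≈ X′ (toℕ k)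
    reduce i = Fin.fromℕ< (ℕ.m%n<n i m) , reduction P.cheb-+*n , reduction P′.cheb-+*n
      where
      reduction : ∀ {y} → (∀ j k → cheb y (j ℕ.+ k ℕ.* m) ≈ cheb y j) →
                  cheb y i ≈ cheb y (toℕ (Fin.fromℕ< (ℕ.m%n<n i m)))
      reduction {y} cheb-+*n = begin
        cheb y i                          ≈⟨ reflexive (≡.cong (cheb y) (ℕ.m≡m%n+[m/n]*n i m)) ⟩
        cheb y (i % m ℕ.+ i / m ℕ.* m)    ≈⟨ cheb-+*n (i % m) (i / m) ⟩
        cheb y (i % m)                    ≈⟨ reflexive (≡.cong (cheb y) (≡.sym (Fin.toℕ-fromℕ< (ℕ.m%n<n i m)))) ⟩
        _ ∎

    c-common-denominator : ∃[ D ] ℕ.NonZero D × (∀ i j → IsInteger (int (+ D) * c i j))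
    c-common-denominator = D , D≢0 , λ i j →
      let (k , Xᵢ≈ , X′ᵢ≈) = reduce i
          (l , Xⱼ≈ , X′ⱼ≈) = reduce j
      in Int.≈∈ (*-congˡ (sym (+-cong (*-cong Xᵢ≈ X′ⱼ≈) (*-cong X′ᵢ≈ Xⱼ≈)))) (integral k l)
      where
      bound : ∃[ D ] ℕ.NonZero D × (∀ k l → IsInteger (int (+ D) * c (toℕ {m} k) (toℕ {m} l)))
      bound = common-denominator₂ (λ k l → c (toℕ k) (toℕ l)) (λ k l → c-rational (toℕ k) (toℕ l))
      D : ℕ
      D = proj₁ bound
      D≢0 : ℕ.NonZero D
      D≢0 = proj₁ (proj₂ bound)
      integral : ∀ k l → IsInteger (int (+ D) * c (toℕ {m} k) (toℕ {m} l))
      integral = proj₂ (proj₂ bound)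

    -- Here t = x + x′. In each product one root multiplies the first factor and the other root the
    -- second, and `cheb-step` turns either multiplication into a sum of neighbours.
    t*c : ∀ i j → ι t * c i j ≈ (c (suc i) j + c (below i) j) + (c i (suc j) + c i (below j))
    t*c i j = begin
      ι t * c i j
        ≈⟨ solve 6 (λ t x a b a′ b′ → t :* (a :* b′ :+ a′ :* b) :=
             (x :* a :* b′ :+ (t :- x) :* a′ :* b) :+ (a :* ((t :- x) :* b′) :+ a′ :* (x :* b))) refl (ι t) x (X i) (X j) (X′ i) (X′ j) ⟩
      (x * X i * X′ j + x′ * X′ i * X j) + (X i * (x′ * X′ j) + X′ i * (x * X j))
        ≈⟨ +-cong (+-cong (*-congʳ (cheb-step x i)) (*-congʳ (cheb-step x′ i))) (+-cong (*-congˡ (cheb-step x′ j)) (*-congˡ (cheb-step x j))) ⟩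
      ((X (suc i) + X (below i)) * X′ j + (X′ (suc i) + X′ (below i)) * X j) +
      (X i * (X′ (suc j) + X′ (below j)) + X′ i * (X (suc j) + X (below j)))
        ≈⟨ +-cong
             (solve 6 (λ s b s′ b′ y y′ → (s :+ b) :* y′ :+ (s′ :+ b′) :* y := (s :* y′ :+ s′ :* y) :+ (b :* y′ :+ b′ :* y)) refl
               (X (suc i)) (X (below i)) (X′ (suc i)) (X′ (below i)) (X j) (X′ j))
             (solve 6 (λ s b s′ b′ y y′ → y :* (s′ :+ b′) :+ y′ :* (s :+ b) := (y :* s′ :+ y′ :* s) :+ (y :* b′ :+ y′ :* b)) refl
               (X (suc j)) (X (below j)) (X′ (suc j)) (X′ (below j)) (X i) (X′ i)) ⟩
      _ ∎

    -- Here n = x x′, so both factors move to their neighbours simultaneously.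
    n*c : ∀ i j → ι n * c i j ≈ (c (suc i) (suc j) + c (suc i) (below j)) + (c (below i) (suc j) + c (below i) (below j))
    n*c i j = begin
      ι n * c i j ≈⟨ *-congʳ xx′≈n ⟨
      x * x′ * c i j
        ≈⟨ solve 6 (λ x x′ a b a′ b′ → x :* x′ :* (a :* b′ :+ a′ :* b) := x :* a :* (x′ :* b′) :+ x′ :* a′ :* (x :* b))
             refl x x′ (X i) (X j) (X′ i) (X′ j) ⟩
      x * X i * (x′ * X′ j) + x′ * X′ i * (x * X j)
        ≈⟨ +-cong (*-cong (cheb-step x i) (cheb-step x′ j)) (*-cong (cheb-step x′ i) (cheb-step x j)) ⟩
      (X (suc i) + X (below i)) * (X′ (suc j) + X′ (below j)) + (X′ (suc i) + X′ (below i)) * (X (suc j) + X (below j))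
        ≈⟨ solve 8 (λ s b s′ b′ u v u′ v′ → (s :+ b) :* (u′ :+ v′) :+ (s′ :+ b′) :* (u :+ v) :=
             ((s :* u′ :+ s′ :* u) :+ (s :* v′ :+ s′ :* v)) :+ ((b :* u′ :+ b′ :* u) :+ (b :* v′ :+ b′ :* v))) refl
             (X (suc i)) (X (below i)) (X′ (suc i)) (X′ (below i)) (X (suc j)) (X (below j)) (X′ (suc j)) (X′ (below j)) ⟩
      _ ∎

    stable⇒integer : ∀ {u} → IsRational u →
      (∀ D → (∀ i j → IsInteger (D * c i j)) → ∀ i j → IsInteger (D * (u * c i j))) → IsInteger u
    stable⇒integer {u} u-rational stable = bounded c-common-denominator
      where
      bounded : ∃[ D ] ℕ.NonZero D × (∀ i j → IsInteger (int (+ D) * c i j)) → IsInteger u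
      -- The 8 is `c 0 0`, that is 2 * 2 + 2 * 2: integrality of D uᵏ `c 0 0` bounds the
      -- denominators of all powers of u by 8 D.
      bounded (D , D≢0 , integral) = bounded-powers⇒integer (D ℕ.* 8) {{ℕ.m*n≢0 D 8 {{D≢0}}}} u-rational λ k →
        Int.≈∈ (begin
          int (+ D) * u ^ k * c 0 0
            ≈⟨ solve 2 (λ d v → d :* v :* (con (+ 2) :* con (+ 2) :+ con (+ 2) :* con (+ 2)) := d :* con (+ 8) :* v) refl (int (+ D)) (u ^ k) ⟩
          int (+ D) * int (+ 8) * u ^ k ≈⟨ *-congʳ (trans (reflexive (≡.cong int (ℤ.pos-* D 8))) (int-* (+ D) (+ 8))) ⟨
          int (+ (D ℕ.* 8)) * u ^ k ∎) (powers k 0 0)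
        where
        powers : ∀ k i j → IsInteger (int (+ D) * u ^ k * c i j)
        powers zero    i j = Int.≈∈ (*-congʳ (sym (*-identityʳ _))) (integral i j)
        powers (suc k) i j = Int.≈∈
          (solve 4 (λ d v u e → d :* v :* (u :* e) := d :* (u :* v) :* e) refl (int (+ D)) (u ^ k) u (c i j))
          (stable (int (+ D) * u ^ k) (powers k) i j)

    private
      four-integers : ∀ {D a b d e} → IsInteger (D * a) → IsInteger (D * b) → IsInteger (D * d) → IsInteger (D * e) →
                      IsInteger (D * ((a + b) + (d + e)))
      four-integers {D} {a} {b} {d} {e} a∈ b∈ d∈ e∈ = Int.≈∈
        (solve 5 (λ D a b d e → (D :* a :+ D :* b) :+ (D :* d :+ D :* e) := D :* ((a :+ b) :+ (d :+ e))) refl D a b d e)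
        (Int.+∈ (Int.+∈ a∈ b∈) (Int.+∈ d∈ e∈))

    t-integer : IsInteger (ι t)
    t-integer = stable⇒integer t-rational λ D integral i j → Int.≈∈ (*-congˡ (sym (t*c i j)))
      (four-integers (integral (suc i) j) (integral (below i) j) (integral i (suc j)) (integral i (below j)))

    n-integer : IsInteger (ι n)
    n-integer = stable⇒integer n-rational λ D integral i j → Int.≈∈ (*-congˡ (sym (n*c i j)))
      (four-integers (integral (suc i) (suc j)) (integral (suc i) (below j)) (integral (below i) (suc j)) (integral (below i) (below j)))

    ν : ℕ → Carrier
    ν j = (int (+ 2) - X j) * (int (+ 2) - X′ j)

    X-conjugate-integer : ∀ j → Conjugate IsInteger (X j) (X′ j)
    X-conjugate-integer = conjugate-cheb integer-isSubring t-integer n-integer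

    ν-integer : ∀ j → IsInteger (ν j)
    ν-integer j = norm∈ integer-isSubring t-integer n-integer
      (conjugate-+ integer-isSubring t-integer n-integer
        (conjugate-const integer-isSubring t-integer n-integer (Int.int∈ (+ 2)))
        (conjugate-neg integer-isSubring t-integer n-integer (X-conjugate-integer j)))

    abstract
      z : ℕ → ℤ
      z j = proj₁ (ν-integer j)

      ν≈z : ∀ j → ν j ≈ int (z j)
      ν≈z j = proj₂ (ν-integer j)

    z-cong : ∀ i j → X i ≈ X j → X′ i ≈ X′ j → z i ≡ z j
    z-cong i j Xᵢ≈Xⱼ X′ᵢ≈X′ⱼ = int-injective (begin
      int (z i) ≈⟨ ν≈z i ⟨
      ν i       ≈⟨ *-cong (+-congˡ (-‿cong Xᵢ≈Xⱼ)) (+-congˡ (-‿cong X′ᵢ≈X′ⱼ)) ⟩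
      ν j       ≈⟨ ν≈z j ⟩
      int (z j) ∎)

    -- Norms are taken in `2-cheb-odd` at `X a`. The witness is the norm of the Dirichlet sum, an
    -- integer because `X a` and `X′ a` are conjugate over ℤ.
    z-odd-multiple : ∀ a l → ∃[ s ] z ((1 ℕ.+ l ℕ.* 2) ℕ.* a) ≡ z a ℤ.* (s ℤ.* s)
    z-odd-multiple a l = s , int-injective (begin
      int (z (k ℕ.* a)) ≈⟨ ν≈z (k ℕ.* a) ⟨
      ν (k ℕ.* a)       ≈⟨ *-cong (factor x) (factor x′) ⟩
      A * (S * S) * (A′ * (S′ * S′))
        ≈⟨ solve 4 (λ a a′ s s′ → a :* (s :* s) :* (a′ :* (s′ :* s′)) := a :* a′ :* (s :* s′ :* (s :* s′))) refl A A′ S S′ ⟩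
      ν a * (S * S′ * (S * S′))     ≈⟨ *-cong (ν≈z a) (*-cong SS′≈s SS′≈s) ⟩
      int (z a) * (int s * int s)   ≈⟨ *-congˡ (int-* s s) ⟨
      int (z a) * int (s ℤ.* s)     ≈⟨ int-* (z a) (s ℤ.* s) ⟨
      int (z a ℤ.* (s ℤ.* s)) ∎)
      where
      k : ℕ
      k = 1 ℕ.+ l ℕ.* 2
      A A′ S S′ : Carrier
      A  = int (+ 2) - X a
      A′ = int (+ 2) - X′ a
      S  = dirichlet (X a) l
      S′ = dirichlet (X′ a) l
      abstract
        norm : IsInteger (S * S′)
        norm = norm∈ integer-isSubring t-integer n-integer
          (conjugate-dirichlet integer-isSubring t-integer n-integer (X-conjugate-integer a) l)
      s : ℤ
      s = proj₁ norm
      SS′≈s : S * S′ ≈ int s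
      SS′≈s = proj₂ norm
      factor : ∀ y → int (+ 2) - cheb y (k ℕ.* a) ≈ (int (+ 2) - cheb y a) * (dirichlet (cheb y a) l * dirichlet (cheb y a) l)
      factor y = trans (+-congˡ (-‿cong (sym (cheb-∘ y a k)))) (2-cheb-odd (cheb y a) l)

    z₁≢0 : z 1 ≢ + 0
    z₁≢0 z₁≡0 = domain (trans (ν≈z 1) (trans (reflexive (≡.cong int z₁≡0)) int-0)) (2-y≉0 irrational) (2-y≉0 x′-irrational)
      where
      2-y≉0 : ∀ {y} → ¬ IsRational y → ¬ (int (+ 2) - y ≈ 0#)
      2-y≉0 y-irrational 2-y≈0 = y-irrational (fromℤ (+ 2) , sym (x≈y⇐x-y≈0 2-y≈0))

    -- Each term is 4 - 2 (X j + X′ j) + X j X′ j, and only the constants survive the summation. The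
    -- double negation comes from cancelling x - 2, x′ - 2 and x - x′.
    ∑ν : ¬ ¬ (∑< m ν ≈ int (+ m) * int (+ 4))
    ∑ν k = domain (∑<-cheb periodic) (y-2≉0 irrational) λ σ≈0 →
           domain (∑<-cheb periodic′) (y-2≉0 x′-irrational) λ σ′≈0 →
           domain (∑<-cheb-product periodic periodic′) x-x′≉0 λ τ≈0 → k (begin
      ∑< m ν
        ≈⟨ ∑<-cong m (λ j → solve 2 (λ a b → (con (+ 2) :- a) :* (con (+ 2) :- b) := con (+ 4) :+ ((:- con (+ 2)) :* (a :+ b) :+ a :* b)) refl (X j) (X′ j)) ⟩
      ∑< m (λ j → int (+ 4) + (- int (+ 2) * (X j + X′ j) + X j * X′ j))
        ≈⟨ ∑<-+ m (λ _ → int (+ 4)) (λ j → - int (+ 2) * (X j + X′ j) + X j * X′ j) ⟩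
      ∑< m (λ _ → int (+ 4)) + ∑< m (λ j → - int (+ 2) * (X j + X′ j) + X j * X′ j)
        ≈⟨ +-cong (∑<-const m (int (+ 4))) (begin
             ∑< m (λ j → - int (+ 2) * (X j + X′ j) + X j * X′ j)
               ≈⟨ ∑<-+ m (λ j → - int (+ 2) * (X j + X′ j)) (λ j → X j * X′ j) ⟩
             ∑< m (λ j → - int (+ 2) * (X j + X′ j)) + ∑< m (λ j → X j * X′ j)
               ≈⟨ +-cong (trans (sym (∑<-* m (- int (+ 2)) (λ j → X j + X′ j))) (*-congˡ (trans (∑<-+ m X X′) (+-cong σ≈0 σ′≈0)))) τ≈0 ⟩
             - int (+ 2) * (0# + 0#) + 0#
               ≈⟨ solve 1 (λ a → a :* (con (+ 0) :+ con (+ 0)) :+ con (+ 0) := con (+ 0)) refl (- int (+ 2)) ⟩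
             0# ∎) ⟩
      int (+ m) * int (+ 4) + 0# ≈⟨ +-identityʳ _ ⟩
      int (+ m) * int (+ 4) ∎)
      where
      y-2≉0 : ∀ {y} → ¬ IsRational y → ¬ (y - int (+ 2) ≈ 0#)
      y-2≉0 y-irrational y-2≈0 = y-irrational (fromℤ (+ 2) , x≈y⇐x-y≈0 y-2≈0)

    -- An odd k congruent to j gives z j = z 1 · s². An odd k′ congruent to a Bézout inverse i of j
    -- leads back to z 1 = z j · s′². As z 1 ≠ 0, s² divides 1, hence s² = 1.
    z-constant : ∀ h → m ≡ 1 ℕ.+ h ℕ.* 2 → ∀ j → Bézout.Identity 1 j m → z j ≡ z 1
    z-constant h ≡.refl j = inverse
      where
      l e k : ℕ
      l = proj₁ (odd-representative h j)
      e = proj₁ (proj₂ (odd-representative h j))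
      k = 1 ℕ.+ l ℕ.* 2
      k≡j+em : k ≡ j ℕ.+ e ℕ.* m
      k≡j+em = proj₂ (proj₂ (odd-representative h j))
      s : ℤ
      s = proj₁ (z-odd-multiple 1 l)
      zₖ≡zⱼ : z k ≡ z j
      zₖ≡zⱼ = z-cong k j (trans (reflexive (≡.cong X k≡j+em)) (P.cheb-+*n j e))
                         (trans (reflexive (≡.cong X′ k≡j+em)) (P′.cheb-+*n j e))
      zₖ≡z₁s² : z k ≡ z 1 ℤ.* (s ℤ.* s)
      zₖ≡z₁s² = ≡.subst (λ i → z i ≡ z 1 ℤ.* (s ℤ.* s)) (ℕ.*-identityʳ k) (proj₂ (z-odd-multiple 1 l))
      s²≡1⇒ : s ℤ.* s ≡ + 1 → z j ≡ z 1
      s²≡1⇒ s²≡1 = ≡.trans (≡.sym zₖ≡zⱼ) (≡.trans zₖ≡z₁s² (≡.trans (≡.cong (z 1 ℤ.*_) s²≡1) (ℤ.*-identityʳ (z 1))))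
      module _ (i : ℕ) (Xᵢⱼ≈x : X (i ℕ.* j) ≈ x) (X′ᵢⱼ≈x′ : X′ (i ℕ.* j) ≈ x′) where
        l′ e′ k′ r : ℕ
        l′ = proj₁ (odd-representative h i)
        e′ = proj₁ (proj₂ (odd-representative h i))
        k′ = 1 ℕ.+ l′ ℕ.* 2
        r  = i ℕ.* e ℕ.+ e′ ℕ.* j ℕ.+ e′ ℕ.* e ℕ.* m
        k′≡i+e′m : k′ ≡ i ℕ.+ e′ ℕ.* m
        k′≡i+e′m = proj₂ (proj₂ (odd-representative h i))
        s′ : ℤ
        s′ = proj₁ (z-odd-multiple k l′)
        k′k≡ : k′ ℕ.* k ≡ i ℕ.* j ℕ.+ r ℕ.* m
        k′k≡ = ≡.trans (≡.cong₂ ℕ._*_ k′≡i+e′m k≡j+em) (product-mod i j e e′ m)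
        zₖ′ₖ≡z₁ : z (k′ ℕ.* k) ≡ z 1
        zₖ′ₖ≡z₁ = z-cong (k′ ℕ.* k) 1
          (trans (reflexive (≡.cong X k′k≡)) (trans (P.cheb-+*n (i ℕ.* j) r) Xᵢⱼ≈x))
          (trans (reflexive (≡.cong X′ k′k≡)) (trans (P′.cheb-+*n (i ℕ.* j) r) X′ᵢⱼ≈x′))
        z₁s²s′²≡z₁ : z 1 ℤ.* (s ℤ.* s ℤ.* (s′ ℤ.* s′)) ≡ z 1 ℤ.* + 1
        z₁s²s′²≡z₁ = ≡.trans (≡.sym (ℤ.*-assoc (z 1) (s ℤ.* s) (s′ ℤ.* s′)))
          (≡.trans (≡.cong (ℤ._* (s′ ℤ.* s′)) (≡.sym zₖ≡z₁s²))
          (≡.trans (≡.sym (proj₂ (z-odd-multiple k l′))) (≡.trans zₖ′ₖ≡z₁ (≡.sym (ℤ.*-identityʳ (z 1))))))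
        inverse⇒ : z j ≡ z 1
        inverse⇒ = s²≡1⇒ (square-unit s (s′ ℤ.* s′) (ℤ.*-cancelˡ-≡ (z 1) _ _ {{ℤ.≢-nonZero z₁≢0}} z₁s²s′²≡z₁))
      inverse : Bézout.Identity 1 j m → z j ≡ z 1
      inverse (Bézout.+- i q 1+qm≡ij) = inverse⇒ i
        (trans (reflexive (≡.cong X (≡.sym 1+qm≡ij))) (P.cheb-+*n 1 q))
        (trans (reflexive (≡.cong X′ (≡.sym 1+qm≡ij))) (P′.cheb-+*n 1 q))
      -- Here i j is -1 modulo m, which serves as well as 1 because the sequence is even.
      inverse (Bézout.-+ i q 1+ij≡qm) = inverse⇒ i (P.cheb-reflect _ q 1+ij≡qm) (P′.cheb-reflect _ q 1+ij≡qm)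

  prime-period⇒rational : HasDegree K 2 → ∀ {p x} → Prime p → 5 < p → Periodic p x → ¬ ¬ IsRational x
  prime-period⇒rational degree {p@(suc q)} {x} p-prime 5<p periodic irrational =
    ∑ν irrational x² _ periodic λ ∑ν≈ → ℕ.<⇒≱ 5<p (s≤s (ℕ∣.∣⇒≤ (q∣4 ∑ν≈)))
    where
    t n : ℚ
    t = proj₁ (Quadratic.quadratic-equation degree irrational)
    n = proj₁ (proj₂ (Quadratic.quadratic-equation degree irrational))
    x² : x * x ≈ ι t * x - ι n
    x² = proj₂ (proj₂ (Quadratic.quadratic-equation degree irrational))
    ν′ : ℕ → Carrier
    ν′ = ν irrational x² _ periodic
    z′ : ℕ → ℤ
    z′ = z irrational x² _ periodic
    odd : ∃[ h ] p ≡ 1 ℕ.+ h ℕ.* 2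
    odd with parity p
    ... | h , inj₂ p≡1+2h = h , p≡1+2h
    ... | h , inj₁ p≡2h with Prime.prime⇒irreducible p-prime (divides h p≡2h)
    ...   | inj₂ ≡.refl = ⊥-elim (ℕ.<⇒≱ 5<p (s≤s (s≤s z≤n)))
    constant : ∀ j → suc j < p → z′ (suc j) ≡ z′ 1
    constant j j<p = z-constant irrational x² _ periodic (proj₁ odd) (proj₂ odd) (suc j)
      (Coprime.coprime-Bézout (Coprime.sym (Coprime.prime⇒coprime p-prime j<p)))
    -- The term at 0 vanishes as `X 0` is 2, and the other q = p - 1 terms all equal z₁. So q z₁ = 4
    -- p = 4 + 4 q, whence q ∣ 4, while 5 < p makes q at least 5.
    q∣4 : ∑< p ν′ ≈ int (+ p) * int (+ 4) → q ∣ 4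
    q∣4 ∑ν≈ = ℕ∣.∣m+n∣m⇒∣n (≡.subst (q ∣_) (ℕ.+-comm 4 (q ℕ.* 4))
      (divides ℤ.∣ z′ 1 ∣ (≡.trans (≡.sym (ℤ.abs-* (+ p) (+ 4))) (≡.trans (≡.cong ℤ.∣_∣ (≡.sym qz≡4p))
        (≡.trans (ℤ.abs-* (+ q) (z′ 1)) (ℕ.*-comm q _)))))) (ℕ∣.m∣m*n 4)
      where
      qz≡4p : + q ℤ.* z′ 1 ≡ + p ℤ.* + 4
      qz≡4p = int-injective (begin
        int (+ q ℤ.* z′ 1)        ≈⟨ int-* (+ q) (z′ 1) ⟩
        int (+ q) * int (z′ 1)    ≈⟨ ∑<-const q _ ⟨
        ∑< q (λ _ → int (z′ 1))   ≈⟨ sum-cong-≋ {q} (λ j → trans (ν≈z irrational x² _ periodic (suc (toℕ j)))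
                                        (reflexive (≡.cong int (constant (toℕ j) (s≤s (Fin.toℕ<n j)))))) ⟨
        ∑< q (ν′ ∘ suc)           ≈⟨ +-identityˡ _ ⟨
        0# + ∑< q (ν′ ∘ suc)      ≈⟨ +-congʳ (solve 0 ((con (+ 2) :- con (+ 2)) :* (con (+ 2) :- con (+ 2)) := con (+ 0)) refl) ⟨
        ∑< p ν′                   ≈⟨ ∑ν≈ ⟩
        int (+ p) * int (+ 4)     ≈⟨ int-* (+ p) (+ 4) ⟨
        int (+ p ℤ.* + 4) ∎)

-- Eigenvalue criteria for graphs

module EigenvalueCriteria {n} (Γ : Graph n) where
  open Graph Γ
  open import Function.Endo.Propositional (Fin n) using () renaming (_^_ to _^^_)

  Close : Fin n → Fin n → Set
  Close i j = i ≡ j ⊎ Adj i j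

  module _ (K : FieldExtensionOfℚ) where
    open FieldExtensionOfℚ K using (ι)
    open Extension K
    open CommutativeRing R hiding (zero; rawRing)
    open Solver using (solve; _:+_; _:*_; _:-_; :-_; _:=_; con)
    open import Algebra.Properties.Semiring.Sum semiring using (sum; sum-cong-≋; ∑-distrib-+; *-distribʳ-sum)
    open import Relation.Binary.Reasoning.Setoid setoid

    private
      sum-rational : ∀ {m} (f : Fin m → Carrier) → (∀ i → IsRational (f i)) → IsRational (sum f)
      sum-rational {zero}  f f-rational = 0ℚ , sym ι.0#-homo
      sum-rational {suc m} f f-rational = rational-+ (f-rational zero) (sum-rational (f ∘ suc) (f-rational ∘ suc))

      indicator : ∀ {A : Set} → Dec A → Carrier
      indicator A? = if does A? then 1# else 0#

      indicator-rational : ∀ {A} (A? : Dec A) → IsRational (indicator A?)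
      indicator-rational (yes _) = 1ℚ , sym ι.1#-homo
      indicator-rational (no _)  = 0ℚ , sym ι.0#-homo

      indicator-cong : ∀ {A B} (A? : Dec A) (B? : Dec B) → (A → B) → (B → A) → indicator A? ≈ indicator B?
      indicator-cong (yes _) (yes _) _   _   = refl
      indicator-cong (no _)  (no _)  _   _   = refl
      indicator-cong (yes a) (no ¬b) a→b _   = ⊥-elim (¬b (a→b a))
      indicator-cong (no ¬a) (yes b) _   b→a = ⊥-elim (¬a (b→a b))

      indicator-*-cong : ∀ {A a b} (A? : Dec A) → (A → a ≈ b) → indicator A? * a ≈ indicator A? * b
      indicator-*-cong (yes p) a≈b = *-congˡ (a≈b p)
      indicator-*-cong (no _)  _   = trans (zeroˡ _) (sym (zeroˡ _))

    -- On a disjoint union of cliques, (x + 1) v is constant on each clique: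
    -- either x = -1, or v is constant there and x + 1 is the size of a clique.
    transitive⇒rational : (∀ {i j k} → Close i j → Close j k → Close i k) → EigenvaluesRational Γ
    transitive⇒rational close-trans degree x v v-eigen ¬rational = zero-or-unit (x + 1#) λ
      { (inj₁ x+1≈0) → ¬rational (rational-resp
          (solve 1 (λ x → (x :+ con (+ 1)) :- con (+ 1) := x) refl x)
          (rational-+ (0ℚ , trans x+1≈0 (sym ι.0#-homo)) (rational-neg 1-rational)))
      ; (inj₂ (y , unit)) → domain (clique-size (λ i j close → unit-cancel unit (v-difference i j close))) V.nonzero λ size≈0 →
          ¬rational (rational-resp (begin
            sum (B i₀) - 1# - (sum (B i₀) - (x + 1#)) ≈⟨ solve 2 (λ s x → s :- con (+ 1) :- (s :- (x :+ con (+ 1))) := x) refl (sum (B i₀)) x ⟩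
            x ∎)
          (rational-+ (rational-+ (sum-rational (B i₀) (B-rational i₀)) (rational-neg 1-rational))
            (rational-neg (0ℚ , trans size≈0 (sym ι.0#-homo))))) }
      where
      module V = IsEigenvector v-eigen
      i₀ : Fin n
      i₀ = V.index
      1-rational : IsRational 1#
      1-rational = 1ℚ , sym ι.1#-homo
      close? : ∀ i j → Dec (Close i j)
      close? i j = i ≟ j ⊎-dec adj? i j
      -- This is the adjacency matrix plus the identity: its rows agree within a clique, and v has
      -- eigenvalue x + 1 for it.
      B : Fin n → Fin n → Carrier
      B i j = indicator (close? i j)
      B-rational : ∀ i j → IsRational (B i j)
      B-rational i j = indicator-rational (close? i j)
      close-sym : ∀ {i j} → Close i j → Close j i
      close-sym (inj₁ ≡.refl) = inj₁ ≡.refl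
      close-sym (inj₂ adj)    = inj₂ (symm adj)
      B-cong : ∀ {i k} → Close i k → ∀ j → B i j ≈ B k j
      B-cong {i} {k} close j =
        indicator-cong (close? i j) (close? k j) (close-trans (close-sym close)) (close-trans close)
      B-split : ∀ i j → B i j * v j ≈ adjacency Γ i j * v j + (if does (i ≟ j) then v i else 0#)
      B-split i j with i ≟ j | adj? i j
      ... | yes ≡.refl | yes loop = ⊥-elim (irrefl ≡.refl loop)
      ... | yes ≡.refl | no _ = solve 1 (λ a → con (+ 1) :* a := con (+ 0) :* a :+ a) refl (v i)
      ... | no _ | yes _ = solve 1 (λ a → con (+ 1) :* a := con (+ 1) :* a :+ con (+ 0)) refl (v j)
      ... | no _ | no _  = solve 1 (λ a → con (+ 0) :* a := con (+ 0) :* a :+ con (+ 0)) refl (v j)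
      B-eigen : ∀ i → (x + 1#) * v i ≈ sum λ j → B i j * v j
      B-eigen i = begin
        (x + 1#) * v i        ≈⟨ solve 2 (λ x a → (x :+ con (+ 1)) :* a := x :* a :+ a) refl x (v i) ⟩
        x * v i + v i         ≈⟨ +-cong (V.eigen i) (sym (sum-δ i v)) ⟩
        sum (λ j → adjacency Γ i j * v j) + sum (λ j → if does (i ≟ j) then v i else 0#)
          ≈⟨ ∑-distrib-+ (λ j → adjacency Γ i j * v j) (λ j → if does (i ≟ j) then v i else 0#) ⟨
        sum (λ j → adjacency Γ i j * v j + (if does (i ≟ j) then v i else 0#)) ≈⟨ sum-cong-≋ (B-split i) ⟨
        sum (λ j → B i j * v j) ∎
      v-difference : ∀ i k → Close i k → (x + 1#) * (v i - v k) ≈ 0#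
      v-difference i k close = begin
        (x + 1#) * (v i - v k)               ≈⟨ solve 3 (λ x a b → x :* (a :- b) := x :* a :- x :* b) refl (x + 1#) (v i) (v k) ⟩
        (x + 1#) * v i - (x + 1#) * v k      ≈⟨ +-cong (trans (B-eigen i) (sum-cong-≋ λ j → *-congʳ {v j} (B-cong close j))) (-‿cong (B-eigen k)) ⟩
        sum (λ j → B k j * v j) - sum (λ j → B k j * v j) ≈⟨ -‿inverseʳ _ ⟩
        0# ∎
      clique-size : (∀ i j → Close i j → v i - v j ≈ 0#) → v i₀ * (sum (B i₀) - (x + 1#)) ≈ 0#
      clique-size v-constant = begin
        v i₀ * (sum (B i₀) - (x + 1#))            ≈⟨ solve 3 (λ a s x → a :* (s :- x) := s :* a :- x :* a) refl (v i₀) (sum (B i₀)) (x + 1#) ⟩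
        sum (B i₀) * v i₀ - (x + 1#) * v i₀       ≈⟨ +-cong (*-distribʳ-sum (v i₀) (B i₀)) (-‿cong (B-eigen i₀)) ⟩
        sum (λ j → B i₀ j * v i₀) - sum (λ j → B i₀ j * v j) ≈⟨ +-congʳ (sum-cong-≋ constant) ⟩
        sum (λ j → B i₀ j * v j) - sum (λ j → B i₀ j * v j)  ≈⟨ -‿inverseʳ _ ⟩
        0# ∎
        where
        constant : ∀ j → B i₀ j * v i₀ ≈ B i₀ j * v j
        constant j = indicator-*-cong (close? i₀ j) λ close → x≈y⇐x-y≈0 (v-constant i₀ j close)

    -- Summing v over σʲ i and σ⁻ʲ i gives cheb x j times v i.
    prime-cycles⇒rational : ∀ {p} → Prime p → 5 < p → (σ τ : Fin n → Fin n) →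
      (∀ i → τ (σ i) ≡ i) → (∀ i → σ (τ i) ≡ i) → (∀ i → σ i ≢ τ i) →
      (∀ i j → Adj i j ⇔ (σ i ≡ j ⊎ τ i ≡ j)) → (∀ i → (σ ^^ p) i ≡ i) → (∀ i → (τ ^^ p) i ≡ i) →
      EigenvaluesRational Γ
    prime-cycles⇒rational {p} p-prime 5<p σ τ τσ≗id στ≗id σ≢τ adj⇔ σᵖ≗id τᵖ≗id degree x v v-eigen ¬rational =
      -- The walks close after p steps, so `u p` equals `u 0` and `u (suc p)` equals `u 1`.
      -- Cancelling the nonzero coordinate `v i₀` leaves the two conditions of `Periodic`.
      domain (scaled p 0 (+-cong (reflexive (≡.cong v (σᵖ≗id i₀))) (reflexive (≡.cong v (τᵖ≗id i₀))))) V.nonzero λ cheb-p →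
      domain (scaled (suc p) 1 (+-cong (reflexive (≡.cong (v ∘ σ) (σᵖ≗id i₀))) (reflexive (≡.cong (v ∘ τ) (τᵖ≗id i₀))))) V.nonzero λ cheb-1+p →
      PeriodicQuadratic.prime-period⇒rational K degree p-prime 5<p
        (record { cheb-n = x≈y⇐x-y≈0 cheb-p ; cheb-1+n = x≈y⇐x-y≈0 cheb-1+p }) ¬rational
      where
      open Chebyshev K using (cheb)
      module V = IsEigenvector v-eigen
      i₀ : Fin n
      i₀ = V.index
      entry : ∀ i j → adjacency Γ i j * v j ≈ (if does (σ i ≟ j) then v (σ i) else 0#) + (if does (τ i ≟ j) then v (τ i) else 0#)
      entry i j with adj? i j | σ i ≟ j | τ i ≟ j
      ... | _       | yes σi≡j   | yes τi≡j   = ⊥-elim (σ≢τ i (≡.trans σi≡j (≡.sym τi≡j)))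
      ... | yes _   | yes ≡.refl | no _       = solve 1 (λ a → con (+ 1) :* a := a :+ con (+ 0)) refl (v j)
      ... | yes _   | no _       | yes ≡.refl = solve 1 (λ a → con (+ 1) :* a := con (+ 0) :+ a) refl (v j)
      ... | no _    | no _       | no _       = solve 1 (λ a → con (+ 0) :* a := con (+ 0) :+ con (+ 0)) refl (v j)
      ... | no ¬adj | yes σi≡j   | no _       = ⊥-elim (¬adj (Equivalence.from (adj⇔ i j) (inj₁ σi≡j)))
      ... | no ¬adj | no _       | yes τi≡j   = ⊥-elim (¬adj (Equivalence.from (adj⇔ i j) (inj₂ τi≡j)))
      ... | yes adj | no σi≢j    | no τi≢j    with Equivalence.to (adj⇔ i j) adj
      ...   | inj₁ σi≡j = ⊥-elim (σi≢j σi≡j)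
      ...   | inj₂ τi≡j = ⊥-elim (τi≢j τi≡j)
      step : ∀ i → x * v i ≈ v (σ i) + v (τ i)
      step i = begin
        x * v i ≈⟨ V.eigen i ⟩
        sum (λ j → adjacency Γ i j * v j) ≈⟨ sum-cong-≋ (entry i) ⟩
        sum (λ j → (if does (σ i ≟ j) then v (σ i) else 0#) + (if does (τ i ≟ j) then v (τ i) else 0#))
          ≈⟨ ∑-distrib-+ (λ j → if does (σ i ≟ j) then v (σ i) else 0#) (λ j → if does (τ i ≟ j) then v (τ i) else 0#) ⟩
        sum (λ j → if does (σ i ≟ j) then v (σ i) else 0#) + sum (λ j → if does (τ i ≟ j) then v (τ i) else 0#)
          ≈⟨ +-cong (sum-δ (σ i) v) (sum-δ (τ i) v) ⟩
        v (σ i) + v (τ i) ∎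
      u : ℕ → Carrier
      u j = v ((σ ^^ j) i₀) + v ((τ ^^ j) i₀)
      u≈cheb : ∀ j → u j ≈ cheb x j * v i₀
      u≈cheb zero       = solve 1 (λ a → a :+ a := con (+ 2) :* a) refl (v i₀)
      u≈cheb (suc zero) = sym (step i₀)
      u≈cheb (suc (suc j)) = begin
        v (σ (σ a)) + v (τ (τ b))
          ≈⟨ solve 4 (λ p q r s → p :+ q := ((p :+ r) :+ (s :+ q)) :- (r :+ s)) refl (v (σ (σ a))) (v (τ (τ b))) (v a) (v b) ⟩
        ((v (σ (σ a)) + v a) + (v b + v (τ (τ b)))) - (v a + v b)
          ≈⟨ +-congʳ (+-cong (+-congˡ (reflexive (≡.cong v (τσ≗id a)))) (+-congʳ (reflexive (≡.cong v (στ≗id b))))) ⟨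
        ((v (σ (σ a)) + v (τ (σ a))) + (v (σ (τ b)) + v (τ (τ b)))) - (v a + v b)
          ≈⟨ +-congʳ (+-cong (step (σ a)) (step (τ b))) ⟨
        (x * v (σ a) + x * v (τ b)) - u j
          ≈⟨ solve 4 (λ x p q r → (x :* p :+ x :* q) :- r := x :* (p :+ q) :- r) refl x (v (σ a)) (v (τ b)) (u j) ⟩
        x * u (suc j) - u j
          ≈⟨ +-cong (*-congˡ (u≈cheb (suc j))) (-‿cong (u≈cheb j)) ⟩
        x * (cheb x (suc j) * v i₀) - cheb x j * v i₀
          ≈⟨ solve 4 (λ x p q a → x :* (p :* a) :- q :* a := (x :* p :- q) :* a) refl x (cheb x (suc j)) (cheb x j) (v i₀) ⟩
        cheb x (suc (suc j)) * v i₀ ∎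
        where
        a b : Fin n
        a = (σ ^^ j) i₀
        b = (τ ^^ j) i₀
      scaled : ∀ j k → u j ≈ u k → v i₀ * (cheb x j - cheb x k) ≈ 0#
      scaled j k uⱼ≈uₖ = begin
        v i₀ * (cheb x j - cheb x k)          ≈⟨ solve 3 (λ a p q → a :* (p :- q) := p :* a :- q :* a) refl (v i₀) (cheb x j) (cheb x k) ⟩
        cheb x j * v i₀ - cheb x k * v i₀     ≈⟨ +-cong (trans (sym (u≈cheb j)) uⱼ≈uₖ) (-‿cong (sym (u≈cheb k))) ⟩
        u k - u k                             ≈⟨ -‿inverseʳ (u k) ⟩
        0# ∎

-- Finite groups

open import Data.List.Base using (List; []; _∷_; length; applyUpTo)
import Data.List.Properties as List
open import Data.List.Relation.Unary.All using (_∷_)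
open import Data.List.Relation.Unary.Any as Any using (Any; here; there)
import Data.List.Relation.Unary.Any.Properties as Any
open import Data.Nat.ListAction using (product)
open import Data.Vec.Base using ([]; _∷_)

∣p∪q∣≤∣p∣+∣q∣ : ∀ {n} (p q : Subset n) → ∣ p ∪ q ∣ ≤ ∣ p ∣ ℕ.+ ∣ q ∣
∣p∪q∣≤∣p∣+∣q∣ []          []          = z≤n
∣p∪q∣≤∣p∣+∣q∣ (true ∷ p)  (true ∷ q)  = s≤s (ℕ.≤-trans (∣p∪q∣≤∣p∣+∣q∣ p q) (ℕ.+-monoʳ-≤ ∣ p ∣ (ℕ.n≤1+n ∣ q ∣)))
∣p∪q∣≤∣p∣+∣q∣ (true ∷ p)  (false ∷ q) = s≤s (∣p∪q∣≤∣p∣+∣q∣ p q)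
∣p∪q∣≤∣p∣+∣q∣ (false ∷ p) (true ∷ q)  = ℕ.≤-trans (s≤s (∣p∪q∣≤∣p∣+∣q∣ p q)) (ℕ.≤-reflexive (≡.sym (ℕ.+-suc ∣ p ∣ ∣ q ∣)))
∣p∪q∣≤∣p∣+∣q∣ (false ∷ p) (false ∷ q) = ∣p∪q∣≤∣p∣+∣q∣ p q

x≢y⇒2≤∣p∣ : ∀ {n} {x y} {p : Subset n} → x Subset.∈ p → y Subset.∈ p → x ≢ y → 2 ≤ ∣ p ∣
x≢y⇒2≤∣p∣ {x = x} {y} {p} x∈p y∈p x≢y = ℕ.≤-trans (s≤s 1≤∣p-x∣) (Subset.x∈p⇒∣p-x∣<∣p∣ x∈p)
  where
  1≤∣p-x∣ : 1 ≤ ∣ p Subset.- x ∣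
  1≤∣p-x∣ = ℕ.≤-trans (s≤s z≤n) (Subset.x∈p⇒∣p-x∣<∣p∣ (Subset.x∈p∧x≢y⇒x∈p-y y∈p (x≢y ∘ ≡.sym)))

prime-divisor : ∀ {n} → 1 < n → ∃[ p ] Prime p × p ∣ n
prime-divisor {suc n} 1<n with factorise (suc n)
... | record { factors = [] ; isFactorisation = n≡1 } = ⊥-elim (ℕ.<⇒≢ 1<n (≡.sym n≡1))
... | record { factors = p ∷ ps ; isFactorisation = n≡ ; factorsPrime = p-prime ∷ _ } =
  p , p-prime , divides (product ps) (≡.trans n≡ (ℕ.*-comm p (product ps)))

module FiniteGroupProperties {c ℓ} (G : FiniteGroup c ℓ) where
  open FiniteGroup G
  open GroupProperties group
  open Mult monoid using () renaming
    (_×_ to infixr 8 _·_; ×-congʳ to ·-congʳ; ×-congˡ to ·-congˡ; ×-homo-+ to ·-homo-+; ×-assocˡ to ·-assoc)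
  open import Relation.Binary.Reasoning.Setoid setoid

  index-cong : ∀ {g h} → g ≈ h → index g ≡ index h
  index-cong = Inverse.to-cong enum

  index-element : ∀ i → index (element i) ≡ i
  index-element i = Inverse.inverseˡ enum refl

  element-index : ∀ g → element (index g) ≈ g
  element-index g = Inverse.inverseʳ enum ≡.refl

  index-injective : ∀ {g h} → index g ≡ index h → g ≈ h
  index-injective {g} {h} eq = trans (sym (element-index g)) (trans (reflexive (≡.cong element eq)) (element-index h))

  _≈?_ : ∀ g h → Dec (g ≈ h)
  g ≈? h with index g ≟ index h
  ... | yes eq = yes (index-injective eq)
  ... | no neq = no (neq ∘ index-cong)

  infix 4 _∈ₗ_
  _∈ₗ_ : Carrier → List Carrier → Set _
  g ∈ₗ L = Any (g ≈_) L

  ∈ₗ-resp : ∀ {g h L} → g ≈ h → g ∈ₗ L → h ∈ₗ L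
  ∈ₗ-resp g≈h = Any.map (trans (sym g≈h))

  subset : List Carrier → Subset order
  subset []      = Subset.⊥
  subset (a ∷ L) = ⁅ index a ⁆ ∪ subset L

  ∈-subset⁺ : ∀ {g} L → g ∈ₗ L → index g Subset.∈ subset L
  ∈-subset⁺ (a ∷ L) (here g≈a) = Subset.p⊆p∪q (subset L)
    (≡.subst (Subset._∈ ⁅ index a ⁆) (≡.sym (index-cong g≈a)) (Subset.x∈⁅x⁆ (index a)))
  ∈-subset⁺ (a ∷ L) (there g∈L) = Subset.q⊆p∪q ⁅ index a ⁆ (subset L) (∈-subset⁺ L g∈L)

  ∈-subset⁻ : ∀ {g} L → index g Subset.∈ subset L → g ∈ₗ L
  ∈-subset⁻ []      g∈ = ⊥-elim (Subset.∉⊥ g∈)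
  ∈-subset⁻ (a ∷ L) g∈ with Subset.x∈p∪q⁻ ⁅ index a ⁆ (subset L) g∈
  ... | inj₁ g∈a = here (index-injective (Subset.x∈⁅y⁆⇒x≡y (index a) g∈a))
  ... | inj₂ g∈L = there (∈-subset⁻ L g∈L)

  ∣subset∣≤length : ∀ L → ∣ subset L ∣ ≤ length L
  ∣subset∣≤length []      = ℕ.≤-reflexive (Subset.∣⊥∣≡0 order)
  ∣subset∣≤length (a ∷ L) = ℕ.≤-trans (∣p∪q∣≤∣p∣+∣q∣ ⁅ index a ⁆ (subset L))
    (ℕ.+-mono-≤ (ℕ.≤-reflexive (Subset.∣⁅x⁆∣≡1 (index a))) (∣subset∣≤length L))

  quotient-ε : ∀ i j → element j ∙ element i ⁻¹ ≈ ε → i ≡ j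
  quotient-ε i j eq = ≡.trans (≡.sym (index-element i)) (≡.trans (index-cong (sym (x∙y⁻¹≈ε⇒x≈y _ _ eq))) (index-element j))

  -- Cayley graphs with rational eigenvalues

  module _ (L : List Carrier) (ε∉L : ¬ (ε ∈ₗ L)) (L⁻¹ : ∀ {g} → g ∈ₗ L → g ⁻¹ ∈ₗ L) where

    ε∉subset : IdentityFree G (subset L)
    ε∉subset = ε∉L ∘ ∈-subset⁻ L

    subset⁻¹ : InverseClosed G (subset L)
    subset⁻¹ g = mk⇔ (∈-subset⁺ L ∘ L⁻¹ ∘ ∈-subset⁻ L)
      (λ g⁻¹∈ → ∈-subset⁺ L (∈ₗ-resp (⁻¹-involutive g) (L⁻¹ (∈-subset⁻ L g⁻¹∈))))

    cayley : Graph order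
    cayley = Cay G (subset L) ε∉subset subset⁻¹

    rational⇒∉𝓑 : ∀ {k a b} → 4 ≤ k → a ∈ₗ L → b ∈ₗ L → ¬ (a ≈ b) → length L ≤ 4 →
                  (∀ K → Extension.EigenvaluesRational K cayley) → G ∉ 𝓑 k
    rational⇒∉𝓑 4≤k a∈L b∈L a≉b ∣L∣≤4 eigenvalues-rational G∈𝓑 = ¬twoIntegral cayley eigenvalues-rational
      (G∈𝓑 (subset L) ε∉subset subset⁻¹ (x≢y⇒2≤∣p∣ (∈-subset⁺ L a∈L) (∈-subset⁺ L b∈L) (a≉b ∘ index-injective))
        (ℕ.≤-trans (∣subset∣≤length L) (ℕ.≤-trans ∣L∣≤4 4≤k)))

    -- Two vertices are equal or adjacent exactly when they lie in the same right coset of the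
    -- subgroup `ε ∷ L`; closure under products makes this transitive, so the graph is a union of
    -- cliques.
    subgroup⇒∉𝓑 : ∀ {k a b} → 4 ≤ k → a ∈ₗ L → b ∈ₗ L → ¬ (a ≈ b) → length L ≤ 4 →
                  (∀ {g h} → g ∈ₗ ε ∷ L → h ∈ₗ ε ∷ L → g ∙ h ∈ₗ ε ∷ L) → G ∉ 𝓑 k
    subgroup⇒∉𝓑 4≤k a∈L b∈L a≉b ∣L∣≤4 ∙-closed = rational⇒∉𝓑 4≤k a∈L b∈L a≉b ∣L∣≤4 λ K →
      EigenvalueCriteria.transitive⇒rational cayley K λ {i} {j} {k} ij jk →
        ∈⇒close (∈ₗ-resp (quotient-∙ i j k) (∙-closed (close⇒∈ jk) (close⇒∈ ij)))
      where
      open EigenvalueCriteria cayley using (Close)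
      quotient-∙ : ∀ i j k → (element k ∙ element j ⁻¹) ∙ (element j ∙ element i ⁻¹) ≈ element k ∙ element i ⁻¹
      quotient-∙ i j k = trans (assoc _ _ _) (∙-congˡ (\\-leftDividesʳ (element j) (element i ⁻¹)))
      close⇒∈ : ∀ {i j} → Close i j → element j ∙ element i ⁻¹ ∈ₗ ε ∷ L
      close⇒∈ {i} (inj₁ ≡.refl) = here (inverseʳ (element i))
      close⇒∈     (inj₂ adj)    = there (∈-subset⁻ L adj)
      ∈⇒close : ∀ {i j} → element j ∙ element i ⁻¹ ∈ₗ ε ∷ L → Close i j
      ∈⇒close {i} {j} (here eq)  = inj₁ (quotient-ε i j eq)
      ∈⇒close         (there ∈L) = inj₂ (∈-subset⁺ L ∈L)

  ∈ₗ-strip : ∀ {g L} → ¬ (g ≈ ε) → g ∈ₗ ε ∷ L → g ∈ₗ L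
  ∈ₗ-strip g≉ε (here g≈ε)  = ⊥-elim (g≉ε g≈ε)
  ∈ₗ-strip g≉ε (there g∈L) = g∈L

  ⁻¹≈ε⇒≈ε : ∀ {g} → g ⁻¹ ≈ ε → g ≈ ε
  ⁻¹≈ε⇒≈ε g⁻¹≈ε = ⁻¹-injective (trans g⁻¹≈ε (sym ε⁻¹≈ε))

  n·ε≈ε : ∀ n → n · ε ≈ ε
  n·ε≈ε zero    = refl
  n·ε≈ε (suc n) = trans (identityˡ _) (n·ε≈ε n)

  multiple-power : ∀ {g} m n → n · g ≈ ε → (m ℕ.* n) · g ≈ ε
  multiple-power {g} m n gⁿ≈ε = trans (sym (·-assoc g m n)) (trans (·-congʳ m gⁿ≈ε) (n·ε≈ε m))

  coprime-power : ∀ {g m n} → Coprime m n → m · g ≈ ε → n · g ≈ ε → g ≈ ε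
  coprime-power {g} {m} {n} m⊥n gᵐ≈ε gⁿ≈ε with Coprime.coprime-Bézout m⊥n
  ... | Bézout.+- x y 1+yn≡xm = from-multiple y n (x ℕ.* m) gⁿ≈ε 1+yn≡xm (multiple-power x m gᵐ≈ε)
    where
    from-multiple : ∀ y n z → n · g ≈ ε → 1 ℕ.+ y ℕ.* n ≡ z → z · g ≈ ε → g ≈ ε
    from-multiple y n z gⁿ≈ε eq gᶻ≈ε = begin
      g                    ≈⟨ identityʳ g ⟨
      g ∙ ε                ≈⟨ ∙-congˡ (multiple-power y n gⁿ≈ε) ⟨
      g ∙ (y ℕ.* n) · g    ≈⟨ ·-congˡ eq ⟩
      z · g                ≈⟨ gᶻ≈ε ⟩
      ε ∎
  ... | Bézout.-+ x y 1+xm≡yn = begin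
    g                    ≈⟨ identityʳ g ⟨
    g ∙ ε                ≈⟨ ∙-congˡ (multiple-power x m gᵐ≈ε) ⟨
    g ∙ (x ℕ.* m) · g    ≈⟨ ·-congˡ 1+xm≡yn ⟩
    (y ℕ.* n) · g        ≈⟨ multiple-power y n gⁿ≈ε ⟩
    ε ∎

  -- The order of g is `suc q`, so the nontrivial powers number q and `q ≤ 4` is the bound on the
  -- size of S. The orders covered are 3, 4 and 5.
  cyclic⇒∉𝓑 : ∀ {k g} q → 4 ≤ k → 2 ≤ q → q ≤ 4 → suc q · g ≈ ε →
              (∀ {i} → i < q → ¬ (suc i · g ≈ ε)) → G ∉ 𝓑 k
  cyclic⇒∉𝓑 {k} {g} q 4≤k 2≤q q≤4 gᵐ≈ε gⁱ≉ε =
    subgroup⇒∉𝓑 L ε∉L L⁻¹ 4≤k (power∈ (ℕ.≤-trans (s≤s z≤n) 2≤q)) (power∈ 2≤q) g≉g²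
      (ℕ.≤-trans (ℕ.≤-reflexive (List.length-applyUpTo (λ i → suc i · g) q)) q≤4)
      λ a∈ b∈ → let (i , a≈gⁱ) = ∈⇒power a∈ ; (j , b≈gʲ) = ∈⇒power b∈ in
        ∈ₗ-resp (sym (trans (∙-cong a≈gⁱ b≈gʲ) (sym (·-homo-+ g i j)))) (power∈′ (i ℕ.+ j))
    where
    L : List Carrier
    L = applyUpTo (λ i → suc i · g) q
    power∈ : ∀ {i} → i < q → suc i · g ∈ₗ L
    power∈ = Any.applyUpTo⁺ (λ i → suc i · g) refl
    ∈⇒power : ∀ {a} → a ∈ₗ ε ∷ L → ∃[ i ] a ≈ i · g
    ∈⇒power (here a≈ε)  = 0 , a≈ε
    ∈⇒power (there a∈L) = let (i , _ , a≈) = Any.applyUpTo⁻ (λ i → suc i · g) a∈L in suc i , a≈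
    g∙-closed : ∀ {a} → a ∈ₗ ε ∷ L → g ∙ a ∈ₗ ε ∷ L
    g∙-closed (here a≈ε) = there (∈ₗ-resp (∙-congˡ (sym a≈ε)) (power∈ (ℕ.≤-trans (s≤s z≤n) 2≤q)))
    g∙-closed (there a∈L) with Any.applyUpTo⁻ (λ i → suc i · g) a∈L
    ... | (i , i<q , a≈) with ℕ.m≤n⇒m<n∨m≡n i<q
    ...   | inj₁ 1+i<q  = there (∈ₗ-resp (∙-congˡ (sym a≈)) (power∈ 1+i<q))
    ...   | inj₂ ≡.refl = here (trans (∙-congˡ a≈) gᵐ≈ε)
    power∈′ : ∀ i → i · g ∈ₗ ε ∷ L
    power∈′ zero    = here refl
    power∈′ (suc i) = g∙-closed (power∈′ i)
    ε∉L : ¬ (ε ∈ₗ L)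
    ε∉L ε∈L = let (i , i<q , ε≈) = Any.applyUpTo⁻ (λ i → suc i · g) ε∈L in gⁱ≉ε i<q (sym ε≈)
    L⁻¹ : ∀ {a} → a ∈ₗ L → a ⁻¹ ∈ₗ L
    L⁻¹ {a} a∈L = ∈ₗ-strip (λ a⁻¹≈ε → ε∉L (∈ₗ-resp (⁻¹≈ε⇒≈ε a⁻¹≈ε) a∈L))
      (∈ₗ-resp (inverse-power (∈⇒power (there a∈L))) (power∈′ (q ℕ.* proj₁ (∈⇒power (there a∈L)))))
      where
      -- The inverse of gⁱ is taken as the power q i, because i + q i is a multiple of the order
      -- `suc q`; this avoids negative exponents.
      inverse-power : ((i , _) : ∃[ i ] a ≈ i · g) → (q ℕ.* i) · g ≈ a ⁻¹
      inverse-power (i , a≈gⁱ) = inverseʳ-unique a _ (begin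
        a ∙ (q ℕ.* i) · g      ≈⟨ ∙-congʳ a≈gⁱ ⟩
        i · g ∙ (q ℕ.* i) · g  ≈⟨ ·-homo-+ g i (q ℕ.* i) ⟨
        (suc q ℕ.* i) · g      ≈⟨ ·-congˡ (ℕ.*-comm (suc q) i) ⟩
        (i ℕ.* suc q) · g      ≈⟨ multiple-power i (suc q) gᵐ≈ε ⟩
        ε ∎)
    g≉g² : ¬ (1 · g ≈ 2 · g)
    g≉g² g≈g² = gⁱ≉ε (ℕ.≤-trans (s≤s z≤n) 2≤q) (sym (∙-cancelˡ g _ _ g≈g²))

  -- When all squares are trivial, every element is its own inverse and a, b commute, so ε, a, b and
  -- a b form a Klein four-group.
  klein⇒∉𝓑 : ∀ {k a b} → 4 ≤ k → (∀ g → g ∙ g ≈ ε) → ¬ (a ≈ ε) → ¬ (b ≈ ε) → ¬ (a ≈ b) → G ∉ 𝓑 k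
  klein⇒∉𝓑 {k} {a} {b} 4≤k g²≈ε a≉ε b≉ε a≉b =
    subgroup⇒∉𝓑 L ε∉L (λ {g} → ∈ₗ-resp (inverseʳ-unique g g (g²≈ε g))) 4≤k (here refl) (there (here refl)) a≉b
      (s≤s (s≤s (s≤s z≤n))) closed
    where
    L : List Carrier
    L = a ∷ b ∷ a ∙ b ∷ []
    g∙g∙h≈h : ∀ g h → g ∙ (g ∙ h) ≈ h
    g∙g∙h≈h g h = trans (sym (assoc g g h)) (trans (∙-congʳ (g²≈ε g)) (identityˡ h))
    b∙a≈a∙b : b ∙ a ≈ a ∙ b
    b∙a≈a∙b = begin
      b ∙ a                       ≈⟨ g∙g∙h≈h a (b ∙ a) ⟨
      a ∙ (a ∙ (b ∙ a))           ≈⟨ ∙-congˡ (g∙g∙h≈h b _) ⟨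
      a ∙ (b ∙ (b ∙ (a ∙ (b ∙ a)))) ≈⟨ ∙-congˡ (∙-congˡ (sym (assoc b a (b ∙ a)))) ⟩
      a ∙ (b ∙ ((b ∙ a) ∙ (b ∙ a))) ≈⟨ ∙-congˡ (∙-congˡ (g²≈ε (b ∙ a))) ⟩
      a ∙ (b ∙ ε)                 ≈⟨ ∙-congˡ (identityʳ b) ⟩
      a ∙ b ∎
    ε∉L : ¬ (ε ∈ₗ L)
    ε∉L (here ε≈a)                 = a≉ε (sym ε≈a)
    ε∉L (there (here ε≈b))         = b≉ε (sym ε≈b)
    ε∉L (there (there (here ε≈ab))) = a≉b (begin
      a            ≈⟨ identityʳ a ⟨
      a ∙ ε        ≈⟨ ∙-congˡ ε≈ab ⟩
      a ∙ (a ∙ b)  ≈⟨ g∙g∙h≈h a b ⟩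
      b ∎)
    ∈-ε : ∀ {g} → g ≈ ε → g ∈ₗ ε ∷ L
    ∈-ε = here
    ∈-a : ∀ {g} → g ≈ a → g ∈ₗ ε ∷ L
    ∈-a = there ∘ here
    ∈-b : ∀ {g} → g ≈ b → g ∈ₗ ε ∷ L
    ∈-b = there ∘ there ∘ here
    ∈-ab : ∀ {g} → g ≈ a ∙ b → g ∈ₗ ε ∷ L
    ∈-ab = there ∘ there ∘ there ∘ here
    a∙-closed : ∀ {g} → g ∈ₗ ε ∷ L → a ∙ g ∈ₗ ε ∷ L
    a∙-closed (here g≈ε)                         = ∈-a (trans (∙-congˡ g≈ε) (identityʳ a))
    a∙-closed (there (here g≈a))                 = ∈-ε (trans (∙-congˡ g≈a) (g²≈ε a))
    a∙-closed (there (there (here g≈b)))         = ∈-ab (∙-congˡ g≈b)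
    a∙-closed (there (there (there (here g≈ab)))) = ∈-b (trans (∙-congˡ g≈ab) (g∙g∙h≈h a b))
    b∙-closed : ∀ {g} → g ∈ₗ ε ∷ L → b ∙ g ∈ₗ ε ∷ L
    b∙-closed (here g≈ε)                         = ∈-b (trans (∙-congˡ g≈ε) (identityʳ b))
    b∙-closed (there (here g≈a))                 = ∈-ab (trans (∙-congˡ g≈a) b∙a≈a∙b)
    b∙-closed (there (there (here g≈b)))         = ∈-ε (trans (∙-congˡ g≈b) (g²≈ε b))
    b∙-closed (there (there (there (here g≈ab)))) = ∈-a (trans (∙-congˡ (trans g≈ab (sym b∙a≈a∙b))) (g∙g∙h≈h b a))
    closed : ∀ {g h} → g ∈ₗ ε ∷ L → h ∈ₗ ε ∷ L → g ∙ h ∈ₗ ε ∷ L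
    closed {g} {h} (here g≈ε) h∈         = ∈ₗ-resp (sym (trans (∙-congʳ g≈ε) (identityˡ h))) h∈
    closed (there (here g≈a)) h∈         = ∈ₗ-resp (∙-congʳ (sym g≈a)) (a∙-closed h∈)
    closed (there (there (here g≈b))) h∈ = ∈ₗ-resp (∙-congʳ (sym g≈b)) (b∙-closed h∈)
    closed {h = h} (there (there (there (here g≈ab)))) h∈ =
      ∈ₗ-resp (trans (sym (assoc a b h)) (∙-congʳ (sym g≈ab))) (a∙-closed (b∙-closed h∈))

  -- Left multiplications by g and by its inverse lead from a vertex to its two neighbours and have
  -- trivial p-th power. The neighbours differ: g² = ε together with gᵖ = ε would give g = ε, as 2
  -- and p are coprime.
  prime>5⇒∉𝓑 : ∀ {k p g} → 4 ≤ k → Prime p → 5 < p → p · g ≈ ε → ¬ (g ≈ ε) → G ∉ 𝓑 k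
  prime>5⇒∉𝓑 {k} {p} {g} 4≤k p-prime 5<p gᵖ≈ε g≉ε =
    rational⇒∉𝓑 L ε∉L L⁻¹ 4≤k (here refl) (there (here refl)) g≉g⁻¹ (s≤s (s≤s z≤n)) λ K →
      EigenvalueCriteria.prime-cycles⇒rational cay K p-prime 5<p (shift g) (shift (g ⁻¹))
        (λ i → shift-inverse i (inverseˡ g)) (λ i → shift-inverse i (inverseʳ g)) shift≢ adj⇔
        (λ i → shift-power i gᵖ≈ε) (λ i → shift-power i g⁻ᵖ≈ε)
    where
    L : List Carrier
    L = g ∷ g ⁻¹ ∷ []
    ε∉L : ¬ (ε ∈ₗ L)
    ε∉L (here ε≈g)           = g≉ε (sym ε≈g)
    ε∉L (there (here ε≈g⁻¹)) = g≉ε (⁻¹≈ε⇒≈ε (sym ε≈g⁻¹))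
    L⁻¹ : ∀ {a} → a ∈ₗ L → a ⁻¹ ∈ₗ L
    L⁻¹ (here a≈g)           = there (here (⁻¹-cong a≈g))
    L⁻¹ (there (here a≈g⁻¹)) = here (trans (⁻¹-cong a≈g⁻¹) (⁻¹-involutive g))
    cay : Graph order
    cay = cayley L ε∉L L⁻¹
    open import Function.Endo.Propositional (Fin order) using () renaming (_^_ to _^^_)
    g≉g⁻¹ : ¬ (g ≈ g ⁻¹)
    g≉g⁻¹ g≈g⁻¹ = g≉ε (coprime-power (Coprime.prime⇒coprime p-prime (ℕ.≤-trans (s≤s (s≤s (s≤s z≤n))) 5<p)) gᵖ≈ε
      (trans (∙-congˡ (identityʳ g)) (trans (∙-congˡ g≈g⁻¹) (inverseʳ g))))
    shift : Carrier → Fin order → Fin order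
    shift a i = index (a ∙ element i)
    shift-∙ : ∀ a b i → shift a (shift b i) ≡ shift (a ∙ b) i
    shift-∙ a b i = index-cong (trans (∙-congˡ (element-index _)) (sym (assoc a b (element i))))
    shift-ε : ∀ {a} i → a ≈ ε → shift a i ≡ i
    shift-ε i a≈ε = ≡.trans (index-cong (trans (∙-congʳ a≈ε) (identityˡ (element i)))) (index-element i)
    shift-inverse : ∀ {a b} i → a ∙ b ≈ ε → shift a (shift b i) ≡ i
    shift-inverse {a} {b} i ab≈ε = ≡.trans (shift-∙ a b i) (shift-ε i ab≈ε)
    shift^ : ∀ a n i → (shift a ^^ n) i ≡ shift (n · a) i
    shift^ a zero    i = ≡.sym (shift-ε i refl)
    shift^ a (suc n) i = ≡.trans (≡.cong (shift a) (shift^ a n i)) (shift-∙ a (n · a) i)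
    shift-power : ∀ {a} i → p · a ≈ ε → (shift a ^^ p) i ≡ i
    shift-power {a} i aᵖ≈ε = ≡.trans (shift^ a p i) (shift-ε i aᵖ≈ε)
    shift≢ : ∀ i → shift g i ≢ shift (g ⁻¹) i
    shift≢ i eq = g≉g⁻¹ (∙-cancelʳ (element i) _ _ (index-injective eq))
    inverse-power : ∀ n → n · g ∙ n · (g ⁻¹) ≈ ε
    inverse-power zero    = identityˡ ε
    inverse-power (suc n) = begin
      (g ∙ n · g) ∙ (g ⁻¹ ∙ n · (g ⁻¹))  ≈⟨ ∙-congʳ (trans (∙-congʳ (sym (identityʳ g))) (trans (sym (·-homo-+ g 1 n)) (trans (·-congˡ (ℕ.+-comm 1 n)) (·-homo-+ g n 1)))) ⟩
      (n · g ∙ (g ∙ ε)) ∙ (g ⁻¹ ∙ n · (g ⁻¹)) ≈⟨ ∙-congʳ (∙-congˡ (identityʳ g)) ⟩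
      (n · g ∙ g) ∙ (g ⁻¹ ∙ n · (g ⁻¹))  ≈⟨ assoc _ _ _ ⟩
      n · g ∙ (g ∙ (g ⁻¹ ∙ n · (g ⁻¹)))  ≈⟨ ∙-congˡ (\\-leftDividesˡ g _) ⟩
      n · g ∙ n · (g ⁻¹)                 ≈⟨ inverse-power n ⟩
      ε ∎
    g⁻ᵖ≈ε : p · (g ⁻¹) ≈ ε
    g⁻ᵖ≈ε = trans (sym (identityˡ _)) (trans (∙-congʳ (sym gᵖ≈ε)) (inverse-power p))
    adj⇔ : ∀ i j → Graph.Adj cay i j ⇔ (shift g i ≡ j ⊎ shift (g ⁻¹) i ≡ j)
    adj⇔ i j = mk⇔ (to ∘ ∈-subset⁻ L) (∈-subset⁺ L ∘ from)
      where
      forward : ∀ {a} → element j ∙ element i ⁻¹ ≈ a → shift a i ≡ j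
      forward {a} eq = ≡.trans (index-cong (trans (∙-congʳ (sym eq)) (//-rightDividesˡ (element i) (element j)))) (index-element j)
      backward : ∀ {a} → shift a i ≡ j → element j ∙ element i ⁻¹ ≈ a
      backward {a} ≡.refl = trans (∙-congʳ (element-index _)) (//-rightDividesʳ (element i) a)
      to : element j ∙ element i ⁻¹ ∈ₗ L → shift g i ≡ j ⊎ shift (g ⁻¹) i ≡ j
      to (here eq)         = inj₁ (forward eq)
      to (there (here eq)) = inj₂ (forward eq)
      from : shift g i ≡ j ⊎ shift (g ⁻¹) i ≡ j → element j ∙ element i ⁻¹ ∈ₗ L
      from (inj₁ eq) = here (backward eq)
      from (inj₂ eq) = there (here (backward eq))

  -- Elements of order 4 or of odd prime order

  finite-order : ∀ g → ∃[ n ] suc n · g ≈ ε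
  finite-order g with Fin.pigeonhole (ℕ.n<1+n order) (λ i → index (toℕ i · g))
  ... | (i , j , i<j , eq) = d , sym (∙-cancelˡ (toℕ i · g) _ _ (begin
      toℕ i · g ∙ ε             ≈⟨ identityʳ _ ⟩
      toℕ i · g                 ≈⟨ index-injective eq ⟩
      toℕ j · g                 ≈⟨ ·-congˡ (≡.trans (≡.sym (ℕ.m+[n∸m]≡n i<j)) (≡.sym (ℕ.+-suc (toℕ i) d))) ⟩
      (toℕ i ℕ.+ suc d) · g     ≈⟨ ·-homo-+ g (toℕ i) (suc d) ⟩
      toℕ i · g ∙ suc d · g ∎))
    where
    d : ℕ
    d = toℕ j ℕ.∸ suc (toℕ i)

  HasOrder4Element HasOddPrimeOrderElement : Set (c ⊔ ℓ)
  HasOrder4Element        = ∃[ h ] 4 · h ≈ ε × ¬ (2 · h ≈ ε)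
  HasOddPrimeOrderElement = ∃[ p ] ∃[ h ] Prime p × p ≢ 2 × p · h ≈ ε × ¬ (h ≈ ε)

  -- Descent on an exponent n that annihilates g, with g² ≠ ε as invariant; the exact order is never
  -- computed. For even n either g⁴ = ε, or g² takes the place of g and the exponent is halved. For
  -- odd n = m p either gᵐ has order p, or m annihilates g already.
  order-4-or-odd-prime : ∀ n {g} → Acc _<_ n → n ≢ 0 → n · g ≈ ε → ¬ (2 · g ≈ ε) → HasOrder4Element ⊎ HasOddPrimeOrderElement
  order-4-or-odd-prime n {g} (acc rec) n≢0 gⁿ≈ε g²≉ε with parity n
  ... | zero , inj₁ n≡0 = ⊥-elim (n≢0 n≡0)
  ... | l@(suc l-1) , inj₁ ≡.refl with (2 · (2 · g)) ≈? ε
  ...   | yes g⁴≈ε = inj₁ (g , trans (sym (·-assoc g 2 2)) g⁴≈ε , g²≉ε)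
  ...   | no  g⁴≉ε = order-4-or-odd-prime l (rec (ℕ.m<m*n l 2 (s≤s (s≤s z≤n)))) (λ ()) (trans (·-assoc g l 2) gⁿ≈ε) g⁴≉ε
  -- Here n = 1, so g would be trivial.
  order-4-or-odd-prime n {g} (acc rec) n≢0 gⁿ≈ε g²≉ε | zero , inj₂ ≡.refl =
    ⊥-elim (g²≉ε (multiple-power {g} 2 1 gⁿ≈ε))
  order-4-or-odd-prime n {g} (acc rec) n≢0 gⁿ≈ε g²≉ε | l@(suc l-1) , inj₂ n≡1+2l
    with prime-divisor {n} (≡.subst (1 <_) (≡.sym n≡1+2l) (s≤s (s≤s z≤n)))
  ... | (p , p-prime , divides m n≡mp) with (m · g) ≈? ε
  ...   | no gᵐ≉ε = inj₂ (p , m · g , p-prime , p≢2 , trans (·-assoc g p m) (trans (·-congˡ (≡.trans (ℕ.*-comm p m) (≡.sym n≡mp))) gⁿ≈ε) , gᵐ≉ε)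
    where
    p≢2 : p ≢ 2
    p≢2 ≡.refl = ℕ.even≢odd m l (≡.trans (ℕ.*-comm 2 m) (≡.trans (≡.sym n≡mp) (≡.trans n≡1+2l (≡.cong suc (ℕ.*-comm l 2)))))
  ...   | yes gᵐ≈ε = order-4-or-odd-prime m (rec m<n) m≢0 gᵐ≈ε g²≉ε
    where
    m≢0 : m ≢ 0
    m≢0 ≡.refl = n≢0 n≡mp
    m<n : m < n
    m<n = ≡.subst (m <_) (≡.sym n≡mp) (ℕ.m<m*n m p {{ℕ.≢-nonZero m≢0}} (ℕ.nonTrivial⇒n>1 p {{Prime.prime⇒nonTrivial p-prime}}))

  order4⇒∉𝓑 : ∀ {k} → 4 ≤ k → HasOrder4Element → G ∉ 𝓑 k
  order4⇒∉𝓑 4≤k (h , h⁴≈ε , h²≉ε) = cyclic⇒∉𝓑 3 4≤k (s≤s (s≤s z≤n)) (s≤s (s≤s (s≤s z≤n))) h⁴≈ε λ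
    { {0} _ h≈ε → h²≉ε (multiple-power {h} 2 1 h≈ε)
    ; {1} _ h²≈ε → h²≉ε h²≈ε
    ; {2} _ h³≈ε → h²≉ε (multiple-power {h} 2 1 (trans (identityʳ h) (coprime-power {h} {4} {3} (Coprime.gcd≡1⇒coprime ≡.refl) h⁴≈ε h³≈ε)))
    ; {suc (suc (suc _))} (s≤s (s≤s (s≤s ()))) _ }

  odd-prime-order⇒∉𝓑 : ∀ {k} → 4 ≤ k → HasOddPrimeOrderElement → G ∉ 𝓑 k
  odd-prime-order⇒∉𝓑 {k} 4≤k (p , h , p-prime , p≢2 , hᵖ≈ε , h≉ε) = by-size p p-prime p≢2 hᵖ≈ε (ℕ.<-≤-connex 5 p)
    where
    -- Every smaller positive exponent is coprime to the prime `suc q`, so this is the exact order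
    -- of h.
    small : ∀ q → 2 ≤ q → q ≤ 4 → Prime (suc q) → suc q · h ≈ ε → G ∉ 𝓑 k
    small q 2≤q q≤4 p-prime hᵖ≈ε = cyclic⇒∉𝓑 q 4≤k 2≤q q≤4 hᵖ≈ε λ {i} i<q hⁱ≈ε →
      h≉ε (coprime-power (Coprime.prime⇒coprime p-prime (s≤s i<q)) hᵖ≈ε hⁱ≈ε)
    by-size : ∀ p → Prime p → p ≢ 2 → p · h ≈ ε → 5 < p ⊎ p ≤ 5 → G ∉ 𝓑 k
    by-size p p-prime p≢2 hᵖ≈ε (inj₁ 5<p) = prime>5⇒∉𝓑 4≤k p-prime 5<p hᵖ≈ε h≉ε
    by-size 0 p-prime p≢2 hᵖ≈ε (inj₂ _)   = ⊥-elim (Prime.¬prime[0] p-prime)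
    by-size 1 p-prime p≢2 hᵖ≈ε (inj₂ _)   = ⊥-elim (Prime.¬prime[1] p-prime)
    by-size 2 p-prime p≢2 hᵖ≈ε (inj₂ _)   = ⊥-elim (p≢2 ≡.refl)
    by-size (suc q@(suc (suc _))) p-prime p≢2 hᵖ≈ε (inj₂ p≤5) = small q (s≤s (s≤s z≤n)) (ℕ.s≤s⁻¹ p≤5) p-prime hᵖ≈ε

  -- Either some square is nontrivial, which leads to order 4 or an odd prime order, or the group
  -- has exponent at most 2 and contains a Klein four-group.
  ∉𝓑 : ∀ k → 4 ≤ k → 3 ≤ order → G ∉ 𝓑 k
  ∉𝓑 k 4≤k 3≤order with Fin.any? (λ i → ¬? ((2 · element i) ≈? ε))
  ... | yes (i , g²≉ε) = let (n , gⁿ≈ε) = finite-order (element i) in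
    found (order-4-or-odd-prime (suc n) (<-wellFounded (suc n)) (λ ()) gⁿ≈ε g²≉ε)
    where
    found : HasOrder4Element ⊎ HasOddPrimeOrderElement → G ∉ 𝓑 k
    found (inj₁ order4)   = order4⇒∉𝓑 4≤k order4
    found (inj₂ oddPrime) = odd-prime-order⇒∉𝓑 4≤k oddPrime
  -- The position of ε in the enumeration is unknown, so the two elements are the quotients of a₁
  -- and a₂ by a₀: they are nontrivial and distinct whichever elements the first three are.
  ... | no no-square = klein⇒∉𝓑 4≤k square (nontrivial 1<3 (λ ())) (nontrivial 2<3 (λ ())) distinct
    where
    1<3 : 1 < 3
    1<3 = s≤s (s≤s z≤n)
    2<3 : 2 < 3
    2<3 = s≤s (s≤s (s≤s z≤n))
    at : ∀ i → i < 3 → Fin order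
    at i i<3 = Fin.fromℕ< (ℕ.≤-trans i<3 3≤order)
    a₀ a₁ a₂ : Fin order
    a₀ = at 0 (s≤s z≤n)
    a₁ = at 1 1<3
    a₂ = at 2 2<3
    at-injective : ∀ {i j} (i<3 : i < 3) (j<3 : j < 3) → i ≢ j → at i i<3 ≢ at j j<3
    at-injective i<3 j<3 i≢j eq = i≢j (≡.trans (≡.sym (Fin.toℕ-fromℕ< _)) (≡.trans (≡.cong toℕ eq) (Fin.toℕ-fromℕ< _)))
    nontrivial : ∀ {i} (i<3 : i < 3) → 0 ≢ i → ¬ (element (at i i<3) ∙ element a₀ ⁻¹ ≈ ε)
    nontrivial {i} i<3 0≢i eq = at-injective (s≤s z≤n) i<3 0≢i (quotient-ε a₀ (at i i<3) eq)
    distinct : ¬ (element a₁ ∙ element a₀ ⁻¹ ≈ element a₂ ∙ element a₀ ⁻¹)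
    distinct eq = at-injective 1<3 2<3 (λ ())
      (≡.trans (≡.sym (index-element a₁)) (≡.trans (index-cong (∙-cancelʳ (element a₀ ⁻¹) _ _ eq)) (index-element a₂)))
    square : ∀ g → g ∙ g ≈ ε
    square g with (2 · element (index g)) ≈? ε
    ... | yes g²≈ε = trans (sym (trans (∙-congˡ (identityʳ _)) (∙-cong (element-index g) (element-index g)))) g²≈ε
    ... | no g²≉ε  = ⊥-elim (no-square (index g , g²≉ε))

theorem6p3 : ∀ {c ℓ : Level} (k : ℕ) → 4 ≤ k →
    (G : FiniteGroup c ℓ) → 3 ≤ FiniteGroup.order G → G ∉ 𝓑 k
theorem6p3 k 4≤k G 3≤order = FiniteGroupProperties.∉𝓑 G k 4≤k 3≤order
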